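{- Let $p$ be a prime, let $k,\ell$ be positive integers, and write $q:=p^k$ and $Q:=p^\ell$. Let $r$ be a positive integer such that $r\equiv Q+1\pmod{q+1}$. Let $a,b,c,d\in\mathbb{F}_{q^2}$ and write $A(X):=aX^{Q+1}+bX^Q+cX+d$. Then $X^rA(X^{q-1})$ permutes $\mathbb{F}_{q^2}$ if and only if $p=2$, $\gcd(r,q-1)=1$, and $A(X)=\delta A_0(\gamma X)$ for some $\gamma\in\mu_{q+1}$, some $\delta\in\mathbb{F}_{q^2}^*$, and some $A_0(X)\in\mathbb{F}_{q^2}[X]$ such that one of the following holds: (1) $\mathrm{ord}_2(k)\le\mathrm{ord}_2(\ell)$ and there exist $\alpha,\beta\in\mathbb{F}_{q^2}\setminus\mathbb{F}_q$ for which $$A_0(X)=(\alpha^{Q+1}+\beta)X^{Q+1}+(\alpha^{q+Q}+\beta)X^Q+(\alpha^{qQ+1}+\beta)X+(\alpha^{qQ+q}+\beta);$$ (2) $\mathrm{ord}_2(k)\ne\mathrm{ord}_2(\ell)$ and either $A_0(X)=X^{Q+1}$ or there exist $\alpha,\beta\in\mathbb{F}_{q^2}\setminus\mu_{q+1}$ for which $$A_0(X)=(\alpha^{qQ+q}+\beta)X^{Q+1}+(\alpha^{qQ}+\alpha\beta)X^Q+(\alpha^q+\alpha^Q\beta)X+(1+\alpha^{Q+1}\beta);$$ (3) $\mathrm{ord}_2(k)\ge\mathrm{ord}_2(\ell)$ and either $A_0(X)=X^Q$ or there exist $\alpha,\beta\in\mathbb{F}_{q^2}\setminus\mu_{q+1}$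 for which $$A_0(X)=(\alpha^{qQ}+\alpha^q\beta)X^{Q+1}+(\alpha^{qQ+1}+\beta)X^Q+(1+\alpha^{q+Q}\beta)X+(\alpha+\alpha^Q\beta).$$
   Context: A polynomial $f(X)\in\mathbb{F}_{q^2}[X]$ permutes $\mathbb{F}_{q^2}$ if $\alpha\mapsto f(\alpha)$ is a bijection of $\mathbb{F}_{q^2}$. $\mu_{q+1}$ denotes the set of $(q+1)$-th roots of unity in $\mathbb{F}_{q^2}^*$. For a positive integer $n$, $\mathrm{ord}_2(n)$ is the largest integer $i\ge 0$ such that $2^i\mid n$. -}

module Defs where

open import Level using (Level; _⊔_) renaming (suc to lsuc)
open import Algebra.Bundles using (CommutativeRing)
open import Data.Bool.Base using (if_then_else_)
open import Data.Fin.Base using (Fin)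
open import Data.List.Base using (List; []; _∷_; [_]; map; replicate; _++_)
open import Data.Nat.Base as ℕ using (ℕ; zero; suc; z≤n; s≤s; NonZero)
open import Data.Nat.Divisibility using (_∣_; _∣?_; 1∣_; ∣⇒≤)
import Data.Nat.Properties as ℕ
open import Data.Product.Base using (_×_; _,_; ∃-syntax)
open import Function.Bundles using (Inverse)
open import Relation.Binary.PropositionalEquality as ≡ using (_≡_)
open import Relation.Nullary using (¬_; Dec; yes; no; does; contradiction)
open import Relation.Unary using (Pred)
import Algebra.Definitions
import Algebra.Properties.Semiring.Exp
import Function.Definitions

-- Largest i ≤ m with 2 ^ i ∣ n.
ord₂≤ : ℕ → ℕ → ℕ
ord₂≤ zero    n = zero
ord₂≤ (suc m) n = if does (2 ℕ.^ suc m ∣? n) then suc m else ord₂≤ m n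

-- For n ≥ 1 the search bound n loses nothing, as 2 ^ i ∣ n forces i < n;
-- see ord₂-∣ and ord₂-largest.  The value at n = 0 is a junk value.
ord₂ : ℕ → ℕ
ord₂ n = ord₂≤ n n

ord₂≤-∣ : ∀ m n → 2 ℕ.^ ord₂≤ m n ∣ n
ord₂≤-∣ zero    n = 1∣ n
ord₂≤-∣ (suc m) n with 2 ℕ.^ suc m ∣? n
... | yes d = d
... | no  _ = ord₂≤-∣ m n

ord₂≤-largest : ∀ m n i → i ℕ.≤ m → 2 ℕ.^ i ∣ n → i ℕ.≤ ord₂≤ m n
ord₂≤-largest zero    n i i≤m d = i≤m
ord₂≤-largest (suc m) n i i≤m d with 2 ℕ.^ suc m ∣? n
... | yes _ = i≤m
... | no ¬d = ord₂≤-largest m n i (ℕ.≤-pred (ℕ.≤∧≢⇒< i≤m λ { ≡.refl → ¬d d })) d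

i<2^i : ∀ i → i ℕ.< 2 ℕ.^ i
i<2^i zero    = s≤s z≤n
i<2^i (suc i) = ℕ.+-mono-≤ (ℕ.≤-trans (s≤s z≤n) (i<2^i i))
  (ℕ.≤-trans (i<2^i i) (ℕ.m≤m+n _ 0))

ord₂-∣ : ∀ n → 2 ℕ.^ ord₂ n ∣ n
ord₂-∣ n = ord₂≤-∣ n n

ord₂-largest : ∀ n .{{_ : NonZero n}} i → 2 ℕ.^ i ∣ n → i ℕ.≤ ord₂ n
ord₂-largest n i d =
  ord₂≤-largest n n i (ℕ.≤-trans (ℕ.<⇒≤ (i<2^i i)) (∣⇒≤ d)) d

-- A field with exactly n elements modulo ≈.  Since n is finite, ≈ is decidable,
-- so the discrete field axiom below loses nothing against an apartness relation.
record FiniteField (c ℓ : Level) (n : ℕ) : Set (lsuc (c ⊔ ℓ)) where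
  field
    commutativeRing : CommutativeRing c ℓ

  open CommutativeRing commutativeRing public
  open Algebra.Definitions _≈_ public using (Invertible)
  open Algebra.Properties.Semiring.Exp semiring public using (_^_)

  field
    0≉1        : ¬ (0# ≈ 1#)
    invertible : ∀ x → ¬ (x ≈ 0#) → Invertible 1# _*_ x
    order      : Inverse setoid (≡.setoid (Fin n))

module Subsets {c ℓ n} (F : FiniteField c ℓ n) where
  open FiniteField F

  μ : ℕ → Pred Carrier ℓ
  μ m x = x ^ m ≈ 1#

  -- A subfield with exactly m elements, given by an enumeration without
  -- repetition (up to ≈).
  record SubfieldOfOrder (m : ℕ) : Set (c ⊔ ℓ) where
    field
      element   : Fin m → Carrier
      injective : ∀ {i j} → element i ≈ element j → i ≡ j

    Member : Pred Carrier ℓ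
    Member x = ∃[ i ] element i ≈ x

    field
      0-member   : Member 0#
      1-member   : Member 1#
      +-closed   : ∀ {x y} → Member x → Member y → Member (x + y)
      neg-closed : ∀ {x} → Member x → Member (- x)
      *-closed   : ∀ {x y} → Member x → Member y → Member (x * y)
      inv-closed : ∀ {x y} → Member x → x * y ≈ 1# → Member y

  -- The subfield 𝔽_q of F.  A finite field has at most one subfield of a given
  -- order, so lying in some subfield of order q is lying in that one.
  𝔽 : ℕ → Pred Carrier (c ⊔ ℓ)
  𝔽 q x = ∃[ S ] SubfieldOfOrder.Member {q} S x

-- Polynomials in one variable as coefficient lists, constant term first;
-- trailing zeros are allowed, and ≈ₚ identifies lists that differ by them.
module Polynomials {c ℓ} (R : CommutativeRing c ℓ) where
  open CommutativeRing R
  open Function.Definitions using (Bijective)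

  Poly : Set c
  Poly = List Carrier

  coeff : Poly → ℕ → Carrier
  coeff []      _       = 0#
  coeff (a ∷ f) zero    = a
  coeff (a ∷ f) (suc i) = coeff f i

  infix  4 _≈ₚ_
  infixl 6 _+ₚ_
  infixl 7 _*ₚ_
  infixr 8 _·_
  infixr 9 _∘ₚ_ X^_

  _≈ₚ_ : Poly → Poly → Set ℓ
  f ≈ₚ g = ∀ i → coeff f i ≈ coeff g i

  X^_ : ℕ → Poly
  X^ n = replicate n 0# ++ [ 1# ]

  _·_ : Carrier → Poly → Poly
  a · f = map (a *_) f

  _+ₚ_ : Poly → Poly → Poly
  []      +ₚ g       = g
  (a ∷ f) +ₚ []      = a ∷ f
  (a ∷ f) +ₚ (b ∷ g) = (a + b) ∷ (f +ₚ g)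

  _*ₚ_ : Poly → Poly → Poly
  []      *ₚ g = []
  (a ∷ f) *ₚ g = a · g +ₚ (0# ∷ f *ₚ g)

  -- Substitution: f ∘ₚ g is f(g(X)).
  _∘ₚ_ : Poly → Poly → Poly
  []      ∘ₚ g = []
  (a ∷ f) ∘ₚ g = [ a ] +ₚ g *ₚ (f ∘ₚ g)

  eval : Poly → Carrier → Carrier
  eval []      x = 0#
  eval (a ∷ f) x = a + x * eval f x

  Permutes : Poly → Set (c ⊔ ℓ)
  Permutes f = Bijective _≈_ _≈_ (eval f)

  quadrinomial : ℕ → (a b c d : Carrier) → Poly
  quadrinomial Q a b c d =
    a · X^ (Q ℕ.+ 1) +ₚ b · X^ Q +ₚ c · X^ 1 +ₚ d · X^ 0

-- Let x̄ = x^q, φ x = x^Q and K = {x : x̄ = x}.  Up to factors in K, the polynomial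
-- X^r A(X^(q−1)) takes the values f x = a x̄ φx̄ + b x φx̄ + c x̄ φx + d x φx, so it permutes F
-- if and only if gcd(r , q − 1) = 1 and f induces an injection of F*/K*.  The
-- determinant of f + z f̄, as a bilinear form in (x , x̄) and (φx , φx̄), is a quadratic
-- polynomial in z that has a root in F; at a root, f + z f̄ = u φ(w) for K-linear maps
-- u and w.  If z z̄ ≠ 1, then u φ(w) still permutes F*/K*, hence the sum of
-- (u φ(w))^(q−1) over F vanishes (Hermite), which forces u to be a multiple of w or of w̄.
-- If z z̄ = 1, then f + z f̄ vanishes on just one line, so u and w have the same kernel,
-- and the two roots z exhibit f as a combination of two (Q+1)-st powers of K-valued
-- linear forms.  This gives the three families.  They permute F*/K* if and only if
-- t ↦ t^(Q+1) or t ↦ t^(Q−1) is injective on K* or on the (q+1)-st roots of unity.  For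
-- odd p the element −1 prevents this; for p = 2 it is a condition on ord₂ k and ord₂ ℓ,
-- read off from the roots of unity whose order divides a Fermat number 2^2^i + 1.

module Submission where

open import Algebra.Bundles using (AbelianGroup; CommutativeMonoid; CommutativeRing)
import Algebra.Construct.DirectProduct as DirectProduct
import Algebra.Properties.AbelianGroup
import Algebra.Properties.CommutativeMonoid.Sum
import Algebra.Properties.CommutativeSemiring.Binomial
import Algebra.Properties.CommutativeSemiring.Exp
import Algebra.Properties.Ring
import Algebra.Properties.Semiring.Exp
import Algebra.Properties.Semiring.Mult
import Algebra.Properties.Semiring.Mult.TCOptimised
import Algebra.Properties.Semiring.Sum
import Algebra.Solver.Ring
import Algebra.Solver.Ring.AlmostCommutativeRing as ACR
open import Data.Empty using (⊥)
open import Data.Fin.Base as Fin using (Fin; zero; suc; toℕ; fromℕ)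
open import Data.Fin.Permutation using (Permutation′; permutation)
import Data.Fin.Properties as Fin
open import Data.Integer.Base as ℤ using (ℤ; +_; -[1+_]; +[1+_])
import Data.Integer.Properties as ℤ
open import Data.List.Base as List using (List)
import Data.List.Membership.Propositional as Membership
open import Data.List.Membership.Propositional.Properties using (∈-allFin; ∈-filter⁺; ∈-filter⁻; ∈-lookup)
import Data.List.Relation.Unary.All as All
open import Data.List.Relation.Unary.AllPairs using (_∷_)
import Data.List.Relation.Unary.Any as Any
open import Data.List.Relation.Unary.Any.Properties using (lookup-index)
open import Data.List.Relation.Unary.Unique.Propositional using (Unique)
import Data.List.Relation.Unary.Unique.Propositional.Properties as Unique
open import Data.Maybe.Base using (Maybe; just; nothing)
open import Data.Nat as ℕ using (ℕ; zero; suc; NonZero; _%_; _∸_; _!; s≤s; z≤n)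
open import Data.Nat.Combinatorics using (_C_; nCn≡1; k![n∸k]!∣n!)
open import Data.Nat.Combinatorics.Specification using (nCk≡n!/k![n-k]!)
open import Data.Nat.Coprimality using (Coprime; coprime-divisor)
open import Data.Nat.DivMod using (m/n*n≡m; m≡m%n+[m/n]*n; m%n<n)
open import Data.Nat.Divisibility using (_∣_; divides; ∣-trans; ∣⇒≤; ∣1⇒≡1; m∣m*n; n∣m*n; m%n≡0⇒n∣m; ∣m+n∣m⇒∣n; *-monoʳ-∣; *-cancelˡ-∣)
open import Data.Nat.GCD using (gcd; GCD; gcd-GCD; gcd[m,n]∣m; gcd[m,n]∣n; module Bézout)
open import Data.Nat.Primality using (Prime; prime[2]; euclidsLemma; prime⇒nonZero; prime⇒irreducible; prime⇒nonTrivial)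
import Data.Nat.Properties as ℕ
import Data.Nat.Solver as ℕSolver
open import Data.Product using (_×_; _,_; ∃-syntax; proj₁; proj₂)
open import Data.Sum as Sum using (_⊎_; inj₁; inj₂; [_,_]′)
open import Data.Vec.Base as Vec using (Vec; []; _∷_; lookup)
import Data.Vec.Properties as Vec
open import Defs
open import Function using (_∘_)
open import Function.Bundles using (_⇔_; mk⇔; Equivalence; Inverse)
open import Function.Definitions using (Injective)
open import Level using (_⊔_)
open import Relation.Binary.PropositionalEquality as ≡ using (_≡_; _≢_)
import Relation.Binary.Reasoning.Setoid
import Relation.Binary.Reflection
open import Relation.Nullary using (¬_; Dec; yes; no; contradiction)
open import Relation.Nullary.Decidable using (map′; ¬?; decidable-stable)
open import Relation.Unary using (_∈_; _∉_)

-- The map `f` evaluates a K-bilinear form at (x , φ x) and is not additive, so injectivity on F*/K*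
-- cannot be read off a kernel. Hermite's criterion takes the place of linear algebra: `f` differs
-- from the permutation polynomial by factors in K*, which the exponent q - 1 removes, and s ↦ s + z
-- s̄ is a bijection when z z̄ ≠ 1, so the (q-1)-st powers of f + z f̄ sum to 0. After the
-- substitution s = w(x) the summand is ((g₁ s + g₂ s̄) φ s)^(q-1), a combination of powers of s
-- with exponents (q-1)(i+1+Q), i < q. Since q + 1 is prime to Q, exactly one of these is divisible
-- by q² - 1; its coefficient is a product of powers of g₁ and - g₂, so one of the two vanishes. If
-- z z̄ = 1, then s ↦ s + z s̄ has rank one and Hermite says nothing. There the symmetry of f + z f̄
-- under s ↦ z s̄ replaces it, and it forces the second root z to have norm 1 as well. The roots z
-- exist because κ = Δ̄ z satisfies a quadratic equation over K. Without a root in F it would yield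
-- an integral domain F[ξ] with more than q² solutions of x^(q²) = x.

-- Ring solvers, plain and with an involution

-- Integer coefficients, unlike coefficients in an arbitrary ring, have decidable
-- equality that computes, so the normal forms cancel.
module IntegerSolver {c ℓ} (R : CommutativeRing c ℓ) where
  open CommutativeRing R
  open Algebra.Properties.Ring ring
  open Algebra.Properties.AbelianGroup +-abelianGroup using (⁻¹-∙-comm)
  open Algebra.Properties.Semiring.Mult.TCOptimised semiring using (1+×; ×-homo-+; ×1-homo-*) renaming (_×_ to _⋅_)
  open Relation.Binary.Reasoning.Setoid setoid

  fromℤ : ℤ → Carrier
  fromℤ (+ n)    = n ⋅ 1#
  fromℤ -[1+ n ] = - (suc n ⋅ 1#)

  fromℤ-⊖ : ∀ m n → fromℤ (m ℤ.⊖ n) ≈ m ⋅ 1# - n ⋅ 1#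
  fromℤ-⊖ zero    zero    = sym (-‿inverseʳ 0#)
  fromℤ-⊖ zero    (suc n) = sym (+-identityˡ _)
  fromℤ-⊖ (suc m) zero    = sym (trans (+-congˡ -0#≈0#) (+-identityʳ _))
  fromℤ-⊖ (suc m) (suc n) = begin
    fromℤ (suc m ℤ.⊖ suc n)                ≡⟨ ≡.cong fromℤ (ℤ.[1+m]⊖[1+n]≡m⊖n m n) ⟩
    fromℤ (m ℤ.⊖ n)                        ≈⟨ fromℤ-⊖ m n ⟩
    m ⋅ 1# - n ⋅ 1#                        ≈⟨ +-congʳ (+-identityʳ _) ⟨
    (m ⋅ 1# + 0#) - n ⋅ 1#                 ≈⟨ +-congʳ (+-congˡ (-‿inverseʳ 1#)) ⟨
    (m ⋅ 1# + (1# - 1#)) - n ⋅ 1#          ≈⟨ +-congʳ (+-assoc _ _ _) ⟨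
    (m ⋅ 1# + 1# - 1#) - n ⋅ 1#            ≈⟨ +-assoc _ _ _ ⟩
    (m ⋅ 1# + 1#) + (- 1# - n ⋅ 1#)        ≈⟨ +-cong (+-comm _ _) (⁻¹-∙-comm _ _) ⟩
    (1# + m ⋅ 1#) - (1# + n ⋅ 1#)          ≈⟨ +-cong (1+× m 1#) (-‿cong (1+× n 1#)) ⟨
    suc m ⋅ 1# - suc n ⋅ 1#                ∎

  fromℤ-neg : ∀ i → fromℤ (ℤ.- i) ≈ - fromℤ i
  fromℤ-neg (+ zero)  = sym -0#≈0#
  fromℤ-neg +[1+ n ]  = refl
  fromℤ-neg -[1+ n ]  = sym (-‿involutive _)

  fromℤ-+ : ∀ i j → fromℤ (i ℤ.+ j) ≈ fromℤ i + fromℤ j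
  fromℤ-+ (+ m)    (+ n)    = ×-homo-+ 1# m n
  fromℤ-+ (+ m)    -[1+ n ] = fromℤ-⊖ m (suc n)
  fromℤ-+ -[1+ m ] (+ n)    = trans (fromℤ-⊖ n (suc m)) (+-comm _ _)
  fromℤ-+ -[1+ m ] -[1+ n ] = begin
    - (suc (suc (m ℕ.+ n)) ⋅ 1#)      ≡⟨ ≡.cong (λ k → - (suc k ⋅ 1#)) (ℕ.+-suc m n) ⟨
    - ((suc m ℕ.+ suc n) ⋅ 1#)        ≈⟨ -‿cong (×-homo-+ 1# (suc m) (suc n)) ⟩
    - (suc m ⋅ 1# + suc n ⋅ 1#)       ≈⟨ ⁻¹-∙-comm _ _ ⟨
    - (suc m ⋅ 1#) - suc n ⋅ 1#       ∎

  fromℤ-*⁺ : ∀ m j → fromℤ (+ m ℤ.* j) ≈ fromℤ (+ m) * fromℤ j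
  fromℤ-*⁺ m (+ n)    = begin
    fromℤ (+ m ℤ.* + n)   ≡⟨ ≡.cong fromℤ (≡.sym (ℤ.pos-* m n)) ⟩
    (m ℕ.* n) ⋅ 1#        ≈⟨ ×1-homo-* m n ⟩
    m ⋅ 1# * n ⋅ 1#       ∎
  fromℤ-*⁺ m -[1+ n ] = begin
    fromℤ (+ m ℤ.* -[1+ n ])       ≡⟨ ≡.cong fromℤ (ℤ.neg-distribʳ-* (+ m) +[1+ n ]) ⟨
    fromℤ (ℤ.- (+ m ℤ.* +[1+ n ])) ≈⟨ fromℤ-neg (+ m ℤ.* +[1+ n ]) ⟩
    - fromℤ (+ m ℤ.* +[1+ n ])     ≈⟨ -‿cong (fromℤ-*⁺ m +[1+ n ]) ⟩
    - (m ⋅ 1# * suc n ⋅ 1#)        ≈⟨ -‿distribʳ-* _ _ ⟩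
    m ⋅ 1# * - (suc n ⋅ 1#)        ∎

  fromℤ-* : ∀ i j → fromℤ (i ℤ.* j) ≈ fromℤ i * fromℤ j
  fromℤ-* (+ m)    j = fromℤ-*⁺ m j
  fromℤ-* -[1+ m ] j = begin
    fromℤ (-[1+ m ] ℤ.* j)         ≡⟨ ≡.cong fromℤ (ℤ.neg-distribˡ-* +[1+ m ] j) ⟨
    fromℤ (ℤ.- (+[1+ m ] ℤ.* j))   ≈⟨ fromℤ-neg (+[1+ m ] ℤ.* j) ⟩
    - fromℤ (+[1+ m ] ℤ.* j)       ≈⟨ -‿cong (fromℤ-*⁺ (suc m) j) ⟩
    - (suc m ⋅ 1# * fromℤ j)       ≈⟨ -‿distribˡ-* _ _ ⟩
    - (suc m ⋅ 1#) * fromℤ j       ∎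

  almostCommutativeRing : ACR.AlmostCommutativeRing c ℓ
  almostCommutativeRing = ACR.fromCommutativeRing R

  fromℤ-morphism : ℤ.+-*-rawRing ACR.-Raw-AlmostCommutative⟶ almostCommutativeRing
  fromℤ-morphism = record
    { ⟦_⟧ = fromℤ ; +-homo = fromℤ-+ ; *-homo = fromℤ-* ; -‿homo = fromℤ-neg
    ; 0-homo = refl ; 1-homo = refl }

  fromℤ-≟ : ∀ i j → Maybe (fromℤ i ≈ fromℤ j)
  fromℤ-≟ i j with i ℤ.≟ j
  ... | yes ≡.refl = just refl
  ... | no  _      = nothing

  open Algebra.Solver.Ring ℤ.+-*-rawRing almostCommutativeRing fromℤ-morphism fromℤ-≟ public

record Involution {c ℓ} (R : CommutativeRing c ℓ) : Set (c ⊔ ℓ) where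
  open CommutativeRing R hiding (zero)
  field
    bar      : Carrier → Carrier
    bar-cong : ∀ {x y} → x ≈ y → bar x ≈ bar y
    bar-+    : ∀ x y → bar (x + y) ≈ bar x + bar y
    bar-*    : ∀ x y → bar (x * y) ≈ bar x * bar y
    bar-neg  : ∀ x → bar (- x) ≈ - bar x
    bar-0    : bar 0# ≈ 0#
    bar-1    : bar 1# ≈ 1#
    bar-bar  : ∀ x → bar (bar x) ≈ x

-- The involution is pushed to the variables, each of which then counts as two:
-- its value and the image of its value.
module InvolutionSolver {c ℓ} (R : CommutativeRing c ℓ) (I : Involution R) where

  open CommutativeRing R hiding (zero)
  open Involution I
  private module S = IntegerSolver R
  open Relation.Binary.Reasoning.Setoid setoid

  infixl 6 _⊕_ _⊝_
  infixl 7 _⊗_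
  infix  8 ⊝_

  data Expr (n : ℕ) : Set where
    var     : Fin n → Expr n
    𝟘 𝟙     : Expr n
    _⊕_ _⊗_ : Expr n → Expr n → Expr n
    ⊝_ ⋆    : Expr n → Expr n

  _⊝_ : ∀ {n} → Expr n → Expr n → Expr n
  e ⊝ f = e ⊕ ⊝ f

  ⟦_⟧ : ∀ {n} → Expr n → Vec Carrier n → Carrier
  ⟦ var i ⟧ ρ = lookup ρ i
  ⟦ 𝟘 ⟧     ρ = 0#
  ⟦ 𝟙 ⟧     ρ = 1#
  ⟦ e ⊕ f ⟧ ρ = ⟦ e ⟧ ρ + ⟦ f ⟧ ρ
  ⟦ e ⊗ f ⟧ ρ = ⟦ e ⟧ ρ * ⟦ f ⟧ ρ
  ⟦ ⊝ e ⟧   ρ = - ⟦ e ⟧ ρ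
  ⟦ ⋆ e ⟧   ρ = bar (⟦ e ⟧ ρ)

  push push⋆ : ∀ {n} → Expr n → S.Polynomial (n ℕ.+ n)
  push {n} (var i) = S.var (i Fin.↑ˡ n)
  push 𝟘           = S.con (+ 0)
  push 𝟙           = S.con (+ 1)
  push (e ⊕ f)     = push e S.:+ push f
  push (e ⊗ f)     = push e S.:* push f
  push (⊝ e)       = S.:- push e
  push (⋆ e)       = push⋆ e
  push⋆ {n} (var i) = S.var (n Fin.↑ʳ i)
  push⋆ 𝟘           = S.con (+ 0)
  push⋆ 𝟙           = S.con (+ 1)
  push⋆ (e ⊕ f)     = push⋆ e S.:+ push⋆ f
  push⋆ (e ⊗ f)     = push⋆ e S.:* push⋆ f
  push⋆ (⊝ e)       = S.:- push⋆ e
  push⋆ (⋆ e)       = push e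

  double : ∀ {n} → Vec Carrier n → Vec Carrier (n ℕ.+ n)
  double ρ = ρ Vec.++ Vec.map bar ρ

  push-correct  : ∀ {n} (e : Expr n) ρ → S.⟦ push e ⟧ (double ρ) ≈ ⟦ e ⟧ ρ
  push⋆-correct : ∀ {n} (e : Expr n) ρ → S.⟦ push⋆ e ⟧ (double ρ) ≈ bar (⟦ e ⟧ ρ)
  push-correct (var i) ρ = reflexive (Vec.lookup-++ˡ ρ (Vec.map bar ρ) i)
  push-correct 𝟘       ρ = refl
  push-correct 𝟙       ρ = refl
  push-correct (e ⊕ f) ρ = +-cong (push-correct e ρ) (push-correct f ρ)
  push-correct (e ⊗ f) ρ = *-cong (push-correct e ρ) (push-correct f ρ)
  push-correct (⊝ e)   ρ = -‿cong (push-correct e ρ)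
  push-correct (⋆ e)   ρ = push⋆-correct e ρ
  push⋆-correct (var i) ρ = reflexive (≡.trans (Vec.lookup-++ʳ ρ (Vec.map bar ρ) i) (Vec.lookup-map i bar ρ))
  push⋆-correct 𝟘       ρ = sym bar-0
  push⋆-correct 𝟙       ρ = sym bar-1
  push⋆-correct (e ⊕ f) ρ = trans (+-cong (push⋆-correct e ρ) (push⋆-correct f ρ)) (sym (bar-+ _ _))
  push⋆-correct (e ⊗ f) ρ = trans (*-cong (push⋆-correct e ρ) (push⋆-correct f ρ)) (sym (bar-* _ _))
  push⋆-correct (⊝ e)   ρ = trans (-‿cong (push⋆-correct e ρ)) (sym (bar-neg _))
  push⋆-correct (⋆ e)   ρ = trans (push-correct e ρ) (sym (bar-bar _))

  ⟦_⟧↓ : ∀ {n} → Expr n → Vec Carrier n → Carrier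
  ⟦ e ⟧↓ ρ = S.⟦ push e ⟧↓ (double ρ)

  ⟦⟧↓-correct : ∀ {n} (e : Expr n) ρ → ⟦ e ⟧↓ ρ ≈ ⟦ e ⟧ ρ
  ⟦⟧↓-correct e ρ = trans (S.correct (push e) (double ρ)) (push-correct e ρ)

  open Relation.Binary.Reflection setoid var ⟦_⟧ ⟦_⟧↓ ⟦⟧↓-correct public
    using (solve) renaming (_⊜_ to _≣_)

-- Additivity of Frobenius powers

prime∤! : ∀ {p} → Prime p → ∀ j → j ℕ.< p → ¬ p ∣ j !
prime∤! pr zero    _   d = contradiction (∣1⇒≡1 d) (ℕ.nonTrivial⇒≢1 {{prime⇒nonTrivial pr}})
prime∤! pr (suc j) j<p d with euclidsLemma (suc j) (j !) pr d
... | inj₁ e = ℕ.<⇒≱ j<p (∣⇒≤ e)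
... | inj₂ e = prime∤! pr j (ℕ.<-trans (ℕ.n<1+n j) j<p) e

n∣n! : ∀ n → .{{NonZero n}} → n ∣ n !
n∣n! (suc n) = m∣m*n (n !)

-- `p` divides `p !`, the product of the binomial coefficient with `k !` and `(p ∸ k) !`, but
-- neither of these two factorials, whose factors all lie below `p`.
prime∣C : ∀ {p k} → Prime p → 0 ℕ.< k → k ℕ.< p → p ∣ p C k
prime∣C {p} {k} pr 0<k k<p with euclidsLemma (p C k) (k ! ℕ.* (p ∸ k) !) pr p∣
  where
  instance _ = k ℕ.!* (p ∸ k) !≢0
  p!≡ : p ! ≡ (p C k) ℕ.* (k ! ℕ.* (p ∸ k) !)
  p!≡ = ≡.trans (≡.sym (m/n*n≡m (k![n∸k]!∣n! (ℕ.<⇒≤ k<p))))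
          (≡.cong (ℕ._* (k ! ℕ.* (p ∸ k) !)) (≡.sym (nCk≡n!/k![n-k]! (ℕ.<⇒≤ k<p))))
  p∣ : p ∣ (p C k) ℕ.* (k ! ℕ.* (p ∸ k) !)
  p∣ = ≡.subst (p ∣_) p!≡ (n∣n! p {{prime⇒nonZero pr}})
... | inj₁ p∣C = p∣C
... | inj₂ p∣k![p∸k]! with euclidsLemma (k !) ((p ∸ k) !) pr p∣k![p∸k]!
...   | inj₁ d = contradiction d (prime∤! pr k k<p)
...   | inj₂ d = contradiction d (prime∤! pr (p ∸ k) (ℕ.∸-monoʳ-< 0<k (ℕ.<⇒≤ k<p)))

-- A single equation, so that it passes at once to an extension ring; for prime `p` and 1 ≠ 0 it
-- determines the characteristic.
_HasCharacteristic_ : ∀ {c ℓ} → CommutativeRing c ℓ → ℕ → Set ℓ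
R HasCharacteristic p = p ⋅ 1# ≈ 0#
  where
  open CommutativeRing R
  open Algebra.Properties.Semiring.Mult semiring using () renaming (_×_ to _⋅_)

IsIntegral : ∀ {c ℓ} → CommutativeRing c ℓ → Set (c ⊔ ℓ)
IsIntegral R = ∀ x y → x * y ≈ 0# → x ≈ 0# ⊎ y ≈ 0#
  where open CommutativeRing R

module Frobenius {c ℓ} (R : CommutativeRing c ℓ) {p : ℕ} (pr : Prime p) (char : R HasCharacteristic p) where

  open CommutativeRing R hiding (zero)
  open Algebra.Properties.Semiring.Mult semiring renaming (_×_ to _⋅_)
  open Algebra.Properties.Semiring.Exp semiring

  open Algebra.Properties.Semiring.Sum semiring
  open Algebra.Properties.CommutativeSemiring.Binomial commutativeSemiring
  open Relation.Binary.Reasoning.Setoid setoid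

  char-⋅ : ∀ m x → p ∣ m → m ⋅ x ≈ 0#
  char-⋅ m x (divides j ≡.refl) = begin
    (j ℕ.* p) ⋅ x           ≈⟨ ×-congʳ (j ℕ.* p) (*-identityˡ x) ⟨
    (j ℕ.* p) ⋅ (1# * x)    ≈⟨ ×-assoc-* (j ℕ.* p) 1# x ⟨
    (j ℕ.* p) ⋅ 1# * x      ≈⟨ *-congʳ (×1-homo-* j p) ⟩
    j ⋅ 1# * p ⋅ 1# * x     ≈⟨ *-congʳ (*-congˡ char) ⟩
    j ⋅ 1# * 0# * x         ≈⟨ *-congʳ (zeroʳ _) ⟩
    0# * x                  ≈⟨ zeroˡ x ⟩
    0#                      ∎

  private
    -- The exponent is in successor form so that the binomial sum over `Fin` can shed both end
    -- terms; every coefficient in between is divisible by `p`.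
    frobenius-suc : ∀ p′ → p ≡ suc p′ → ∀ x y → (x + y) ^ suc p′ ≈ x ^ suc p′ + y ^ suc p′
    frobenius-suc p′ p≡ x y = begin
      (x + y) ^ suc p′          ≈⟨ theorem (suc p′) x y ⟩
      sum t                     ≈⟨ +-congˡ (sum-init-last (λ i → t (suc i))) ⟩
      t zero + (sum (λ i → t (suc (Fin.inject₁ i))) + t (fromℕ (suc p′)))
        ≈⟨ +-congˡ (+-congʳ (trans (sum-cong-≋ middle) (sum-replicate-zero p′))) ⟩
      t zero + (0# + t (fromℕ (suc p′)))
        ≈⟨ +-cong first (trans (+-identityˡ _) last) ⟩
      y ^ suc p′ + x ^ suc p′   ≈⟨ +-comm _ _ ⟩
      x ^ suc p′ + y ^ suc p′   ∎
      where
      t = binomialTerm x y (suc p′)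
      first : t zero ≈ y ^ suc p′
      first = trans (×-homo-1 _) (*-identityˡ _)
      last : t (fromℕ (suc p′)) ≈ x ^ suc p′
      last = begin
        (suc p′ C toℕ (fromℕ (suc p′))) ⋅ (x ^ toℕ (fromℕ (suc p′)) * y ^ (suc p′ ∸ toℕ (fromℕ (suc p′))))
          ≡⟨ ≡.cong (λ j → (suc p′ C j) ⋅ (x ^ j * y ^ (suc p′ ∸ j))) (Fin.toℕ-fromℕ (suc p′)) ⟩
        (suc p′ C suc p′) ⋅ (x ^ suc p′ * y ^ (suc p′ ∸ suc p′))
          ≡⟨ ≡.cong₂ (λ i j → i ⋅ (x ^ suc p′ * y ^ j)) (nCn≡1 (suc p′)) (ℕ.n∸n≡0 p′) ⟩
        1 ⋅ (x ^ suc p′ * 1#) ≈⟨ trans (×-homo-1 _) (*-identityʳ _) ⟩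
        x ^ suc p′            ∎
      middle : ∀ i → t (suc (Fin.inject₁ i)) ≈ 0#
      middle i = char-⋅ (suc p′ C suc (toℕ (Fin.inject₁ i))) _
        (≡.subst (λ n → p ∣ n C suc (toℕ (Fin.inject₁ i))) p≡ (prime∣C pr (s≤s z≤n)
          (≡.subst₂ (λ j n → suc j ℕ.< n) (≡.sym (Fin.toℕ-inject₁ i)) (≡.sym p≡) (s≤s (Fin.toℕ<n i)))))

  frobenius : ∀ x y → (x + y) ^ p ≈ x ^ p + y ^ p
  frobenius x y = ≡.subst (λ n → (x + y) ^ n ≈ x ^ n + y ^ n) (ℕ.suc-pred p)
    (frobenius-suc (ℕ.pred p) (≡.sym (ℕ.suc-pred p)) x y)
    where instance _ = prime⇒nonZero pr

  frobenius^ : ∀ j x y → (x + y) ^ (p ℕ.^ j) ≈ x ^ (p ℕ.^ j) + y ^ (p ℕ.^ j)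
  frobenius^ zero    x y = trans (*-identityʳ _) (sym (+-cong (*-identityʳ _) (*-identityʳ _)))
  frobenius^ (suc j) x y = begin
    (x + y) ^ (p ℕ.* p ℕ.^ j)                     ≈⟨ ^-assocʳ (x + y) p (p ℕ.^ j) ⟨
    ((x + y) ^ p) ^ (p ℕ.^ j)                     ≈⟨ ^-congˡ (p ℕ.^ j) (frobenius x y) ⟩
    (x ^ p + y ^ p) ^ (p ℕ.^ j)                   ≈⟨ frobenius^ j _ _ ⟩
    (x ^ p) ^ (p ℕ.^ j) + (y ^ p) ^ (p ℕ.^ j)     ≈⟨ +-cong (^-assocʳ x p _) (^-assocʳ y p _) ⟩
    x ^ (p ℕ.* p ℕ.^ j) + y ^ (p ℕ.* p ℕ.^ j)     ∎

-- Counting roots over an integral domain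

module Roots {c ℓ} (R : CommutativeRing c ℓ) (integral : IsIntegral R) where

  open CommutativeRing R hiding (zero)
  open Algebra.Properties.Ring ring using (x∙y⁻¹≈ε⇒x≈y)
  open Algebra.Properties.Semiring.Exp semiring
  open IntegerSolver R using (solve; _:=_; _:+_; _:*_; :-_; con)
  open Relation.Binary.Reasoning.Setoid setoid

  evalᵥ : ∀ {n} → Vec Carrier n → Carrier → Carrier
  evalᵥ []      x = 0#
  evalᵥ (a ∷ f) x = a + x * evalᵥ f x

  infixl 7 _÷_
  -- Synthetic division by X - r: the coefficients of the quotient are the Horner values of the
  -- tails at `r`.
  _÷_ : ∀ {n} → Vec Carrier (suc n) → Carrier → Vec Carrier n
  (a ∷ [])        ÷ r = []
  (a ∷ f@(_ ∷ _)) ÷ r = evalᵥ f r ∷ (f ÷ r)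

  ÷-correct : ∀ {n} (f : Vec Carrier (suc n)) r x → evalᵥ f x ≈ (x - r) * evalᵥ (f ÷ r) x + evalᵥ f r
  ÷-correct (a ∷ [])        r x =
    solve 3 (λ a r x → a :+ x :* con (+ 0) := (x :+ :- r) :* con (+ 0) :+ (a :+ r :* con (+ 0))) refl a r x
  ÷-correct (a ∷ f@(_ ∷ _)) r x = begin
    a + x * evalᵥ f x   ≈⟨ +-congˡ (*-congˡ (÷-correct f r x)) ⟩
    a + x * ((x - r) * evalᵥ (f ÷ r) x + evalᵥ f r)
      ≈⟨ solve 5 (λ a r x g v → a :+ x :* ((x :+ :- r) :* g :+ v) :=
                  (x :+ :- r) :* (v :+ x :* g) :+ (a :+ r :* v)) refl a r x (evalᵥ (f ÷ r) x) (evalᵥ f r) ⟩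
    (x - r) * (evalᵥ f r + x * evalᵥ (f ÷ r) x) + (a + r * evalᵥ f r) ∎

  last-÷ : ∀ {n} (f : Vec Carrier (suc (suc n))) r → Vec.last (f ÷ r) ≈ Vec.last f
  last-÷ (a ∷ b ∷ [])    r = trans (+-congˡ (zeroʳ r)) (+-identityʳ b)
  last-÷ (a ∷ b ∷ c ∷ f) r = last-÷ (b ∷ c ∷ f) r

  -- Division by X - r for one root r keeps the leading coefficient, and since there are no zero
  -- divisors the other roots are roots of the quotient. At degree 0 the leading coefficient is
  -- itself the value at a root.
  too-many-roots : ∀ {n} (f : Vec Carrier (suc n)) (ρ : Fin (suc n) → Carrier) →
    (∀ {i j} → ρ i ≈ ρ j → i ≡ j) → (∀ i → evalᵥ f (ρ i) ≈ 0#) → Vec.last f ≈ 0#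
  too-many-roots {zero}  (a ∷ [])  ρ ρ-inj roots = begin
    a                   ≈⟨ +-identityʳ a ⟨
    a + 0#              ≈⟨ +-congˡ (zeroʳ (ρ zero)) ⟨
    a + ρ zero * 0#     ≈⟨ roots zero ⟩
    0#                  ∎
  too-many-roots {suc n} f         ρ ρ-inj roots =
    trans (sym (last-÷ f (ρ zero)))
      (too-many-roots (f ÷ ρ zero) (λ i → ρ (suc i)) (λ e → Fin.suc-injective (ρ-inj e)) quotient-root)
    where
    quotient-root : ∀ i → evalᵥ (f ÷ ρ zero) (ρ (suc i)) ≈ 0#
    quotient-root i with integral (ρ (suc i) - ρ zero) (evalᵥ (f ÷ ρ zero) (ρ (suc i))) (begin
      (ρ (suc i) - ρ zero) * evalᵥ (f ÷ ρ zero) (ρ (suc i))                   ≈⟨ +-identityʳ _ ⟨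
      (ρ (suc i) - ρ zero) * evalᵥ (f ÷ ρ zero) (ρ (suc i)) + 0#              ≈⟨ +-congˡ (roots zero) ⟨
      (ρ (suc i) - ρ zero) * evalᵥ (f ÷ ρ zero) (ρ (suc i)) + evalᵥ f (ρ zero)
        ≈⟨ ÷-correct f (ρ zero) (ρ (suc i)) ⟨
      evalᵥ f (ρ (suc i))                                                     ≈⟨ roots (suc i) ⟩
      0#                                                                      ∎)
    ... | inj₂ e = e
    ... | inj₁ e with () ← ρ-inj (x∙y⁻¹≈ε⇒x≈y (ρ (suc i)) (ρ zero) e)

  monomial : ∀ n → Vec Carrier (suc n)
  monomial zero    = 1# ∷ []
  monomial (suc n) = 0# ∷ monomial n

  evalᵥ-monomial : ∀ n x → evalᵥ (monomial n) x ≈ x ^ n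
  evalᵥ-monomial zero    x = trans (+-congˡ (zeroʳ x)) (+-identityʳ 1#)
  evalᵥ-monomial (suc n) x = trans (+-identityˡ _) (*-congˡ (evalᵥ-monomial n x))

  last-monomial : ∀ n → Vec.last (monomial n) ≡ 1#
  last-monomial zero          = ≡.refl
  last-monomial (suc zero)    = ≡.refl
  last-monomial (suc (suc n)) = last-monomial (suc n)

  -- X^(s+2) - X has leading coefficient 1, which too many fixed points would force to be 0. The
  -- exponent is at least 2 so that the leading term stays apart from - X.
  fixed-points-≤ : ¬ (0# ≈ 1#) → ∀ s {m} (ρ : Fin m → Carrier) →
    (∀ {i j} → ρ i ≈ ρ j → i ≡ j) → (∀ i → ρ i ^ suc (suc s) ≈ ρ i) → m ℕ.≤ suc (suc s)
  fixed-points-≤ 0≉1 s {m} ρ ρ-inj fixed with m ℕ.≤? suc (suc s)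
  ... | yes m≤ = m≤
  ... | no  m≰ = contradiction (trans (sym (too-many-roots f (λ i → ρ (Fin.inject≤ i m>))
                   (λ e → Fin.inject≤-injective m> m> _ _ (ρ-inj e)) roots)) last-f) 0≉1
    where
    m> = ℕ.≰⇒> m≰
    f : Vec Carrier (suc (suc (suc s)))
    f = 0# ∷ - 1# ∷ monomial s
    last-∷∷ : ∀ a b {n} (g : Vec Carrier (suc n)) → Vec.last (a ∷ b ∷ g) ≡ Vec.last g
    last-∷∷ a b (_ ∷ _) = ≡.refl
    last-f : Vec.last f ≈ 1#
    last-f = reflexive (≡.trans (last-∷∷ 0# (- 1#) (monomial s)) (last-monomial s))
    roots : ∀ i → evalᵥ f (ρ (Fin.inject≤ i m>)) ≈ 0#
    roots i = begin
      0# + x * (- 1# + x * evalᵥ (monomial s) x)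
        ≈⟨ +-congˡ (*-congˡ (+-congˡ (*-congˡ (evalᵥ-monomial s x)))) ⟩
      0# + x * (- 1# + x * x ^ s)
        ≈⟨ solve 2 (λ x y → con (+ 0) :+ x :* (:- con (+ 1) :+ x :* y) := x :* (x :* y) :+ :- x) refl x (x ^ s) ⟩
      x ^ suc (suc s) - x   ≈⟨ +-congʳ (fixed _) ⟩
      x - x                 ≈⟨ -‿inverseʳ x ⟩
      0#                    ∎
      where x = ρ (Fin.inject≤ i m>)

-- Quadratic ring extensions

-- R[ξ] with ξ² + s ξ + t = 0; the pair (a , b) stands for a + b ξ.
module QuadraticExtension {c ℓ} (R : CommutativeRing c ℓ) (s t : CommutativeRing.Carrier R) where

  open CommutativeRing R hiding (zero)
  open IntegerSolver R using (solve; _:=_; _:+_; _:*_; :-_; con)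
  open AbelianGroup (DirectProduct.abelianGroup +-abelianGroup +-abelianGroup) public using ()
    renaming (Carrier to E; _≈_ to _≈ₑ_; isAbelianGroup to +ₑ-isAbelianGroup)

  infixl 7 _*ₑ_
  _*ₑ_ : E → E → E
  (a , b) *ₑ (c , d) = a * c - t * (b * d) , (a * d + b * c) - s * (b * d)

  extension : CommutativeRing c ℓ
  extension = record
    { Carrier = E
    ; _≈_ = _≈ₑ_
    ; _*_ = _*ₑ_
    ; 1# = 1# , 0#
    ; isCommutativeRing = record
      { isRing = record
        { +-isAbelianGroup = +ₑ-isAbelianGroup
        ; *-cong = λ { (a≈ , b≈) (c≈ , d≈) →
            +-cong (*-cong a≈ c≈) (-‿cong (*-congˡ (*-cong b≈ d≈))) ,
            +-cong (+-cong (*-cong a≈ d≈) (*-cong b≈ c≈)) (-‿cong (*-congˡ (*-cong b≈ d≈))) }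
        ; *-assoc = λ { (a , b) (c , d) (e , f) →
            solve 8 (λ s t a b c d e f →
              (a :* c :+ :- (t :* (b :* d))) :* e :+ :- (t :* ((a :* d :+ b :* c :+ :- (s :* (b :* d))) :* f)) :=
              a :* (c :* e :+ :- (t :* (d :* f))) :+ :- (t :* (b :* (c :* f :+ d :* e :+ :- (s :* (d :* f))))))
              refl s t a b c d e f ,
            solve 8 (λ s t a b c d e f →
              ((a :* c :+ :- (t :* (b :* d))) :* f :+ (a :* d :+ b :* c :+ :- (s :* (b :* d))) :* e)
                :+ :- (s :* ((a :* d :+ b :* c :+ :- (s :* (b :* d))) :* f)) :=
              (a :* (c :* f :+ d :* e :+ :- (s :* (d :* f))) :+ b :* (c :* e :+ :- (t :* (d :* f))))
                :+ :- (s :* (b :* (c :* f :+ d :* e :+ :- (s :* (d :* f))))))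
              refl s t a b c d e f }
        ; *-identity =
            (λ { (a , b) →
              solve 3 (λ t a b → con (+ 1) :* a :+ :- (t :* (con (+ 0) :* b)) := a) refl t a b ,
              solve 3 (λ s a b → (con (+ 1) :* b :+ con (+ 0) :* a) :+ :- (s :* (con (+ 0) :* b)) := b) refl s a b }) ,
            (λ { (a , b) →
              solve 3 (λ t a b → a :* con (+ 1) :+ :- (t :* (b :* con (+ 0))) := a) refl t a b ,
              solve 3 (λ s a b → (a :* con (+ 0) :+ b :* con (+ 1)) :+ :- (s :* (b :* con (+ 0))) := b) refl s a b })
        ; distrib =
            (λ { (a , b) (c , d) (e , f) →
              solve 7 (λ t a b c d e f → a :* (c :+ e) :+ :- (t :* (b :* (d :+ f))) :=
                (a :* c :+ :- (t :* (b :* d))) :+ (a :* e :+ :- (t :* (b :* f)))) refl t a b c d e f ,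
              solve 7 (λ s a b c d e f → (a :* (d :+ f) :+ b :* (c :+ e)) :+ :- (s :* (b :* (d :+ f))) :=
                ((a :* d :+ b :* c) :+ :- (s :* (b :* d))) :+ ((a :* f :+ b :* e) :+ :- (s :* (b :* f))))
                refl s a b c d e f }) ,
            (λ { (a , b) (c , d) (e , f) →
              solve 7 (λ t a b c d e f → (c :+ e) :* a :+ :- (t :* ((d :+ f) :* b)) :=
                (c :* a :+ :- (t :* (d :* b))) :+ (e :* a :+ :- (t :* (f :* b)))) refl t a b c d e f ,
              solve 7 (λ s a b c d e f → ((c :+ e) :* b :+ (d :+ f) :* a) :+ :- (s :* ((d :+ f) :* b)) :=
                ((c :* b :+ d :* a) :+ :- (s :* (d :* b))) :+ ((e :* b :+ f :* a) :+ :- (s :* (f :* b))))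
                refl s a b c d e f })
        }
      ; *-comm = λ { (a , b) (c , d) →
          solve 5 (λ t a b c d → a :* c :+ :- (t :* (b :* d)) := c :* a :+ :- (t :* (d :* b))) refl t a b c d ,
          solve 5 (λ s a b c d → (a :* d :+ b :* c) :+ :- (s :* (b :* d)) := (c :* b :+ d :* a) :+ :- (s :* (d :* b)))
            refl s a b c d }
      }
    }

  embed : Carrier → E
  embed a = a , 0#

  ξ : E
  ξ = 0# , 1#

  private
    module E = CommutativeRing extension
    module ^ = Algebra.Properties.Semiring.Exp semiring
    module ^ₑ = Algebra.Properties.Semiring.Exp E.semiring
    module × = Algebra.Properties.Semiring.Mult semiring
    module ×ₑ = Algebra.Properties.Semiring.Mult E.semiring

  embed-* : ∀ a b → embed (a * b) ≈ₑ embed a *ₑ embed b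
  embed-* a b =
    solve 3 (λ t a b → a :* b := a :* b :+ :- (t :* (con (+ 0) :* con (+ 0)))) refl t a b ,
    solve 3 (λ s a b → con (+ 0) := (a :* con (+ 0) :+ con (+ 0) :* b) :+ :- (s :* (con (+ 0) :* con (+ 0)))) refl s a b

  embed-^ : ∀ a n → embed a ^ₑ.^ n ≈ₑ embed (a ^.^ n)
  embed-^ a ℕ.zero  = refl , refl
  embed-^ a (suc n) = E.trans (E.*-congˡ {embed a} (embed-^ a n)) (E.sym (embed-* a (a ^.^ n)))

  embed-× : ∀ n → n ×ₑ.× E.1# ≈ₑ embed (n ×.× 1#)
  embed-× ℕ.zero  = refl , refl
  embed-× (suc n) = E.trans (E.+-congˡ {E.1#} (embed-× n)) (refl , +-identityʳ 0#)

  ξ-root : (ξ *ₑ ξ E.+ embed s *ₑ ξ) E.+ embed t ≈ₑ E.0#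
  ξ-root =
    solve 2 (λ s t → ((con (+ 0) :* con (+ 0) :+ :- (t :* (con (+ 1) :* con (+ 1))))
                        :+ (s :* con (+ 0) :+ :- (t :* (con (+ 0) :* con (+ 1))))) :+ t := con (+ 0)) refl s t ,
    solve 2 (λ s t → (((con (+ 0) :* con (+ 1) :+ con (+ 1) :* con (+ 0)) :+ :- (s :* (con (+ 1) :* con (+ 1))))
                        :+ ((s :* con (+ 1) :+ con (+ 0) :* con (+ 0)) :+ :- (s :* (con (+ 0) :* con (+ 1)))))
                        :+ con (+ 0) := con (+ 0)) refl s t

-- Finite fields: Fermat's theorem, characteristic, power sums

-- A missed value could be punched out of the codomain, leaving an injection into a smaller `Fin`.
injective⇒surjective : ∀ {n} {f : Fin n → Fin n} → Injective _≡_ _≡_ f → ∀ y → ∃[ x ] f x ≡ y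
injective⇒surjective {suc n} {f} f-inj y with Fin.any? (λ x → f x Fin.≟ y)
... | yes hit = hit
... | no miss = contradiction (Fin.injective⇒≤ {f = λ x → Fin.punchOut (y≢f x)}
    λ {i} {j} e → f-inj (Fin.punchOut-injective (y≢f i) (y≢f j) e)) ℕ.1+n≰n
  where
  y≢f : ∀ x → y ≢ f x
  y≢f x e = miss (x , ≡.sym e)

injective⇒permutation : ∀ {n} (f : Fin n → Fin n) → Injective _≡_ _≡_ f → Permutation′ n
injective⇒permutation f f-inj = permutation f (λ y → proj₁ (surj y)) (λ y → proj₂ (surj y))
  (λ x → f-inj (proj₂ (surj (f x))))
  where surj = injective⇒surjective f-inj

module FiniteFieldProperties {c ℓ n} (F : FiniteField c ℓ n) where
  open FiniteField F hiding (zero)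
  open Algebra.Properties.Ring ring using (x∙y⁻¹≈ε⇒x≈y; +-cancelʳ)
  open Algebra.Properties.Semiring.Exp semiring hiding (_^_)
  open Algebra.Properties.CommutativeSemiring.Exp commutativeSemiring using (^-distrib-*)
  open Algebra.Properties.Semiring.Mult semiring using (×1-homo-*) renaming (_×_ to _⋅_)
  open IntegerSolver commutativeRing using (solve; _:=_; _:+_; _:*_; :-_; con)
  open Relation.Binary.Reasoning.Setoid setoid

  index : Carrier → Fin n
  index = Inverse.to order

  elem : Fin n → Carrier
  elem = Inverse.from order

  elem-index : ∀ x → elem (index x) ≈ x
  elem-index = Inverse.strictlyInverseʳ order

  index-elem : ∀ i → index (elem i) ≡ i
  index-elem = Inverse.strictlyInverseˡ order

  index-injective : ∀ {x y} → index x ≡ index y → x ≈ y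
  index-injective {x} {y} e = trans (sym (elem-index x)) (trans (Inverse.from-cong order e) (elem-index y))

  elem-injective : ∀ {i j} → elem i ≈ elem j → i ≡ j
  elem-injective {i} {j} e = ≡.trans (≡.sym (index-elem i)) (≡.trans (Inverse.to-cong order e) (index-elem j))

  infix 4 _≟_
  _≟_ : ∀ x y → Dec (x ≈ y)
  x ≟ y = map′ index-injective (Inverse.to-cong order) (index x Fin.≟ index y)

  all? : ∀ {p} {P : Carrier → Set p} → (∀ {x y} → x ≈ y → P x → P y) → (∀ x → Dec (P x)) →
    (∀ x → P x) ⊎ (∃[ x ] ¬ P x)
  all? {P = P} resp P? with Fin.all? (λ i → P? (elem i))
  ... | yes all = inj₁ λ x → resp (elem-index x) (all (index x))
  ... | no ¬all = let i , ¬Pi = Fin.¬∀⟶∃¬ n (λ i → P (elem i)) (λ i → P? (elem i)) ¬all in inj₂ (elem i , ¬Pi)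

  infix 9 _⁻¹
  -- Total, with default value 0 at 0, so that inverses can be written down before their argument is
  -- known to be nonzero.
  _⁻¹ : Carrier → Carrier
  x ⁻¹ with x ≟ 0#
  ... | yes _  = 0#
  ... | no x≉0 = proj₁ (invertible x x≉0)

  *-inverseʳ : ∀ {x} → ¬ x ≈ 0# → x * x ⁻¹ ≈ 1#
  *-inverseʳ {x} x≉0 with x ≟ 0#
  ... | yes x≈0 = contradiction x≈0 x≉0
  ... | no x≉0  = proj₂ (proj₂ (invertible x x≉0))

  *-inverseˡ : ∀ {x} → ¬ x ≈ 0# → x ⁻¹ * x ≈ 1#
  *-inverseˡ x≉0 = trans (*-comm _ _) (*-inverseʳ x≉0)

  1≉0 : ¬ 1# ≈ 0#
  1≉0 e = 0≉1 (sym e)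

  x*y≈0⇒y≈0 : ∀ {x y} → ¬ x ≈ 0# → x * y ≈ 0# → y ≈ 0#
  x*y≈0⇒y≈0 {x} {y} x≉0 xy≈0 = begin
    y                 ≈⟨ *-identityˡ y ⟨
    1# * y            ≈⟨ *-congʳ (*-inverseˡ x≉0) ⟨
    x ⁻¹ * x * y      ≈⟨ *-assoc _ _ _ ⟩
    x ⁻¹ * (x * y)    ≈⟨ *-congˡ xy≈0 ⟩
    x ⁻¹ * 0#         ≈⟨ zeroʳ _ ⟩
    0#                ∎

  integral : ∀ x y → x * y ≈ 0# → x ≈ 0# ⊎ y ≈ 0#
  integral x y xy≈0 with x ≟ 0#
  ... | yes x≈0 = inj₁ x≈0
  ... | no  x≉0 = inj₂ (x*y≈0⇒y≈0 x≉0 xy≈0)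

  *-nonzero : ∀ {x y} → ¬ x ≈ 0# → ¬ y ≈ 0# → ¬ x * y ≈ 0#
  *-nonzero x≉0 y≉0 e = y≉0 (x*y≈0⇒y≈0 x≉0 e)

  *-nonzeroˡ : ∀ {x y} → ¬ x * y ≈ 0# → ¬ x ≈ 0#
  *-nonzeroˡ xy≉0 x≈0 = xy≉0 (trans (*-congʳ x≈0) (zeroˡ _))

  *-nonzeroʳ : ∀ {x y} → ¬ x * y ≈ 0# → ¬ y ≈ 0#
  *-nonzeroʳ xy≉0 y≈0 = xy≉0 (trans (*-congˡ y≈0) (zeroʳ _))

  *-cancelˡ : ∀ {x y z} → ¬ x ≈ 0# → x * y ≈ x * z → y ≈ z
  *-cancelˡ {x} {y} {z} x≉0 e = x∙y⁻¹≈ε⇒x≈y y z (x*y≈0⇒y≈0 x≉0 (begin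
    x * (y - z)     ≈⟨ solve 3 (λ x y z → x :* (y :+ :- z) := x :* y :+ :- (x :* z)) refl x y z ⟩
    x * y - x * z   ≈⟨ +-congʳ e ⟩
    x * z - x * z   ≈⟨ -‿inverseʳ _ ⟩
    0#              ∎))

  ^-nonzero : ∀ {x} m → ¬ x ≈ 0# → ¬ x ^ m ≈ 0#
  ^-nonzero ℕ.zero  x≉0 = 1≉0
  ^-nonzero (suc m) x≉0 = *-nonzero x≉0 (^-nonzero m x≉0)

  0^ : ∀ m → .{{NonZero m}} → 0# ^ m ≈ 0#
  0^ (suc m) = zeroˡ _

  1^ : ∀ m → 1# ^ m ≈ 1#
  1^ ℕ.zero  = refl
  1^ (suc m) = trans (*-identityˡ _) (1^ m)

  ^-∣ : ∀ {x} {d m} → d ∣ m → x ^ d ≈ 1# → x ^ m ≈ 1#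
  ^-∣ {x} {d} (divides j ≡.refl) x^d≈1 = begin
    x ^ (j ℕ.* d)   ≈⟨ ^-congʳ x (ℕ.*-comm j d) ⟩
    x ^ (d ℕ.* j)   ≈⟨ ^-assocʳ x d j ⟨
    (x ^ d) ^ j     ≈⟨ ^-congˡ j x^d≈1 ⟩
    1# ^ j          ≈⟨ 1^ j ⟩
    1#              ∎

  module Fold {a b} (M : CommutativeMonoid a b) where
    private module M = CommutativeMonoid M
    open Algebra.Properties.CommutativeMonoid.Sum M public

    fold : (Carrier → M.Carrier) → M.Carrier
    fold φ = sum (λ i → φ (elem i))

    fold-cong : ∀ {φ ψ} → (∀ x → φ x M.≈ ψ x) → fold φ M.≈ fold ψ
    fold-cong φ≈ψ = sum-cong-≋ (λ i → φ≈ψ (elem i))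

    -- An injective self-map of a finite carrier is a permutation, which a commutative fold does not
    -- see; `φ-cong` absorbs the passage to enumerated representatives.
    fold-reindex : ∀ φ (g : Carrier → Carrier) → (∀ {x y} → x ≈ y → φ x M.≈ φ y) →
      (∀ {x y} → g x ≈ g y → x ≈ y) → fold (λ x → φ (g x)) M.≈ fold φ
    fold-reindex φ g φ-cong g-inj = M.trans
      (sum-cong-≋ (λ i → φ-cong (sym (elem-index (g (elem i))))))
      (M.sym (sum-permute (λ i → φ (elem i)) (injective⇒permutation (λ i → index (g (elem i)))
        (λ e → elem-injective (g-inj (index-injective e))))))

    sum-single : ∀ {m} (t : Fin m → M.Carrier) j → (∀ i → i ≢ j → t i M.≈ M.ε) → sum t M.≈ t j
    sum-single {suc m} t zero    rest = M.trans
      (M.∙-congˡ (M.trans (sum-cong-≋ (λ i → rest (suc i) λ ())) (sum-replicate-zero m))) (M.identityʳ _)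
    sum-single {suc m} t (suc j) rest = M.trans
      (M.∙-cong (rest zero λ ()) (sum-single (λ i → t (suc i)) j (λ i i≢j → rest (suc i) (i≢j ∘ Fin.suc-injective))))
      (M.identityˡ _)

    fold-single : ∀ φ y → (∀ {x y} → x ≈ y → φ x M.≈ φ y) → (∀ x → ¬ x ≈ y → φ x M.≈ M.ε) → fold φ M.≈ φ y
    fold-single φ y φ-cong rest = M.trans
      (sum-single (λ i → φ (elem i)) (index y) (λ i i≢ → rest (elem i) (λ e →
        i≢ (≡.trans (≡.sym (index-elem i)) (Inverse.to-cong order e)))))
      (φ-cong (elem-index y))

  module Σ = Fold +-commutativeMonoid
  module Π = Fold *-commutativeMonoid
  open Algebra.Properties.Semiring.Sum semiring using (*-distribˡ-sum)

  instance
    order-nonZero : NonZero n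
    order-nonZero = Fin.nonZeroIndex (index 0#)

  suc-pred-order : suc (n ∸ 1) ≡ n
  suc-pred-order = ℕ.m+[n∸m]≡n (ℕ.>-nonZero⁻¹ n)

  -- Multiplication by y permutes the elements e i; compare their products with
  -- 0 replaced by 1.
  module _ {m} (e : Fin m → Carrier) (e-injective : ∀ {i j} → e i ≈ e j → i ≡ j) (o : Fin m) (e-o : e o ≈ 0#)
    (y : Carrier) (y≉0 : ¬ y ≈ 0#) (closed : ∀ i → ∃[ j ] e j ≈ y * e i) where
    private
      σ : Fin m → Fin m
      σ i = proj₁ (closed i)
      σ-injective : Injective _≡_ _≡_ σ
      σ-injective {i} {j} σi≡σj = e-injective (*-cancelˡ y≉0 (begin
        y * e i   ≈⟨ proj₂ (closed i) ⟨
        e (σ i)   ≡⟨ ≡.cong e σi≡σj ⟩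
        e (σ j)   ≈⟨ proj₂ (closed j) ⟩
        y * e j   ∎))
      ψ χ : Carrier → Carrier
      ψ x with x ≟ 0#
      ... | yes _ = 1#
      ... | no  _ = x
      χ x with x ≟ 0#
      ... | yes _ = y
      ... | no  _ = 1#
      ψ-cong : ∀ {x x′} → x ≈ x′ → ψ x ≈ ψ x′
      ψ-cong {x} {x′} e with x ≟ 0# | x′ ≟ 0#
      ... | yes _ | yes _ = refl
      ... | yes z | no ¬z = contradiction (trans (sym e) z) ¬z
      ... | no ¬z | yes z = contradiction (trans e z) ¬z
      ... | no _  | no _  = e
      ψ-nonzero : ∀ x → ¬ ψ x ≈ 0#
      ψ-nonzero x with x ≟ 0#
      ... | yes _ = 1≉0
      ... | no ¬z = ¬z
      χ-rest : ∀ x → ¬ x ≈ 0# → χ x ≈ 1#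
      χ-rest x ¬z with x ≟ 0#
      ... | yes z = contradiction z ¬z
      ... | no _  = refl
      χ-zero : ∀ {x} → x ≈ 0# → χ x ≈ y
      χ-zero {x} z with x ≟ 0#
      ... | yes _ = refl
      ... | no ¬z = contradiction z ¬z
      -- Behind `ψ`, multiplication by `y` loses its factor `y` at 0 and nowhere else; `χ` puts it
      -- back. In the product over all `e i` this leaves one `y` on the right of `^-closed`, whose
      -- exponent counts 0 as well.
      split : ∀ x → ψ x * y ≈ ψ (y * x) * χ x
      split x with x ≟ 0# | y * x ≟ 0#
      ... | yes _ | yes _ = refl
      ... | yes z | no ¬z = contradiction (trans (*-congˡ z) (zeroʳ y)) ¬z
      ... | no ¬z | yes z = contradiction (x*y≈0⇒y≈0 y≉0 z) ¬z
      ... | no _  | no _  = trans (*-comm x y) (sym (*-identityʳ _))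
      Π-nonzero : ∀ {m} {t : Fin m → Carrier} → (∀ i → ¬ t i ≈ 0#) → ¬ Π.sum t ≈ 0#
      Π-nonzero {ℕ.zero} _  = 1≉0
      Π-nonzero {suc m}  nz = *-nonzero (nz zero) (Π-nonzero (λ i → nz (suc i)))

    ^-closed : y ^ m ≈ y
    ^-closed = *-cancelˡ (Π-nonzero (λ i → ψ-nonzero (e i))) (begin
      Π.sum (λ i → ψ (e i)) * y ^ m                           ≈⟨ *-congˡ (Π.sum-replicate m) ⟨
      Π.sum (λ i → ψ (e i)) * Π.sum {m} (λ _ → y)             ≈⟨ Π.∑-distrib-+ (λ i → ψ (e i)) (λ _ → y) ⟨
      Π.sum (λ i → ψ (e i) * y)                               ≈⟨ Π.sum-cong-≋ (λ i →
        trans (split (e i)) (*-congʳ (ψ-cong (sym (proj₂ (closed i)))))) ⟩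
      Π.sum (λ i → ψ (e (σ i)) * χ (e i))
        ≈⟨ Π.∑-distrib-+ (λ i → ψ (e (σ i))) (λ i → χ (e i)) ⟩
      Π.sum (λ i → ψ (e (σ i))) * Π.sum (λ i → χ (e i))
        ≈⟨ *-cong (sym (Π.sum-permute (λ i → ψ (e i)) (injective⇒permutation σ σ-injective)))
             (Π.sum-single (λ i → χ (e i)) o (λ i i≢o → χ-rest (e i) (λ z → i≢o (e-injective (trans z (sym e-o)))))) ⟩
      Π.sum (λ i → ψ (e i)) * χ (e o)                         ≈⟨ *-congˡ (χ-zero e-o) ⟩
      Π.sum (λ i → ψ (e i)) * y                               ∎)

  ^-order : ∀ y → y ^ n ≈ y
  ^-order y with y ≟ 0#
  ... | yes y≈0 = begin
    y ^ n   ≈⟨ ^-congˡ n y≈0 ⟩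
    0# ^ n  ≈⟨ 0^ n ⟩
    0#      ≈⟨ y≈0 ⟨
    y       ∎
  ... | no y≉0 = ^-closed elem elem-injective (index 0#) (elem-index 0#) y y≉0
    (λ i → index (y * elem i) , elem-index (y * elem i))

  ^-pred-order : ∀ {y} → ¬ y ≈ 0# → y ^ (n ∸ 1) ≈ 1#
  ^-pred-order {y} y≉0 = *-cancelˡ y≉0 (begin
    y * y ^ (n ∸ 1)   ≈⟨ ^-congʳ y suc-pred-order ⟩
    y ^ n             ≈⟨ ^-order y ⟩
    y                 ≈⟨ *-identityʳ y ⟨
    y * 1#            ∎)

  -- Translation by 1 permutes the field, so the sum of all 1 + x equals the sum of all x, and the
  -- difference is `n ⋅ 1#`.
  order⋅1≈0 : n ⋅ 1# ≈ 0#
  order⋅1≈0 = +-cancelʳ (Σ.fold (λ x → x)) _ _ (begin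
    n ⋅ 1# + Σ.fold (λ x → x)               ≈⟨ +-congʳ (Σ.sum-replicate n) ⟨
    Σ.fold (λ _ → 1#) + Σ.fold (λ x → x)    ≈⟨ Σ.∑-distrib-+ (λ _ → 1#) elem ⟨
    Σ.fold (λ x → 1# + x)                   ≈⟨ Σ.fold-reindex (λ x → x) (λ x → 1# + x) (λ e → e) cancel ⟩
    Σ.fold (λ x → x)                        ≈⟨ +-identityˡ _ ⟨
    0# + Σ.fold (λ x → x)                   ∎)
    where
    cancel : ∀ {x y} → 1# + x ≈ 1# + y → x ≈ y
    cancel {x} {y} e = +-cancelʳ 1# x y (trans (+-comm _ _) (trans e (+-comm _ _)))

  -- `n ⋅ 1#` is the j-th power of `p ⋅ 1#`, and a field has no nonzero nilpotents.
  root⋅1≈0 : ∀ {p} j → p ℕ.^ j ≡ n → p ⋅ 1# ≈ 0#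
  root⋅1≈0 {p} j p^j≡n with (p ⋅ 1#) ≟ 0#
  ... | yes e = e
  ... | no ¬e = contradiction order⋅1≈0 (λ e → ^-nonzero j ¬e (begin
    (p ⋅ 1#) ^ j      ≈⟨ ^-⋅1 j ⟨
    (p ℕ.^ j) ⋅ 1#    ≡⟨ ≡.cong (_⋅ 1#) p^j≡n ⟩
    n ⋅ 1#            ≈⟨ e ⟩
    0#                ∎))
    where
    ^-⋅1 : ∀ j → (p ℕ.^ j) ⋅ 1# ≈ (p ⋅ 1#) ^ j
    ^-⋅1 ℕ.zero  = +-identityʳ 1#
    ^-⋅1 (suc j) = trans (×1-homo-* p (p ℕ.^ j)) (*-congˡ (^-⋅1 j))

  open Roots commutativeRing integral using (fixed-points-≤)

  -- X^(s+1) - X has at most s + 1 roots, so some element is not one. This stands in for a generator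
  -- of the multiplicative group wherever an element of large enough order is wanted.
  ∃-^≉1 : ∀ s → .{{NonZero s}} → suc s ℕ.< n → ∃[ y ] (¬ y ≈ 0#) × (¬ y ^ s ≈ 1#)
  ∃-^≉1 (suc s) s< with all? {P = λ y → y ^ suc (suc s) ≈ y}
      (λ {x} {y} e f → trans (^-congˡ (suc (suc s)) (sym e)) (trans f e)) (λ y → y ^ suc (suc s) ≟ y)
  ... | inj₁ all      = contradiction (fixed-points-≤ 0≉1 s elem elem-injective (λ i → all (elem i))) (ℕ.<⇒≱ s<)
  ... | inj₂ (y , ¬e) = y ,
    (λ y≈0 → ¬e (trans (^-congˡ (suc (suc s)) y≈0) (trans (0^ (suc (suc s))) (sym y≈0)))) ,
    (λ e → ¬e (trans (*-congˡ e) (*-identityʳ y)))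

  powerSum : ℕ → Carrier
  powerSum s = Σ.fold (_^ s)

  instance
    pred-order-nonZero : NonZero (n ∸ 1)
    pred-order-nonZero = ℕ.>-nonZero (ℕ.m<n⇒0<n∸m {1} {n} (Fin.injective⇒≤ {m = 2} {f = λ { zero → index 0# ; (suc zero) → index 1# }}
      λ { {zero}     {zero}     _ → ≡.refl
        ; {zero}     {suc zero} e → contradiction (index-injective e) 0≉1
        ; {suc zero} {zero}     e → contradiction (index-injective e) 1≉0
        ; {suc zero} {suc zero} _ → ≡.refl }))

  -- Away from 0 every summand is 1, and adding the indicator function of 0 makes it 1 everywhere.
  -- So the power sum plus 1 is `n ⋅ 1#`, that is 0. For s = 0 the summand at 0 would already be 1.
  powerSum-∣ : ∀ s → .{{NonZero s}} → n ∸ 1 ∣ s → ¬ powerSum s ≈ 0#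
  powerSum-∣ s n-1∣s ps≈0 = 1≉0 (begin
    1#                            ≈⟨ χ-0 ⟨
    χ 0#                          ≈⟨ Σ.fold-single χ 0# χ-cong χ-rest ⟨
    Σ.fold χ                      ≈⟨ +-identityˡ _ ⟨
    0# + Σ.fold χ                 ≈⟨ +-congʳ ps≈0 ⟨
    Σ.fold (_^ s) + Σ.fold χ      ≈⟨ Σ.∑-distrib-+ (λ i → elem i ^ s) (λ i → χ (elem i)) ⟨
    Σ.fold (λ x → x ^ s + χ x)    ≈⟨ Σ.fold-cong complement ⟩
    Σ.fold (λ _ → 1#)             ≈⟨ Σ.sum-replicate n ⟩
    n ⋅ 1#                        ≈⟨ order⋅1≈0 ⟩
    0#                            ∎)
    where
    χ : Carrier → Carrier
    χ x with x ≟ 0#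
    ... | yes _ = 1#
    ... | no  _ = 0#
    χ-cong : ∀ {x x′} → x ≈ x′ → χ x ≈ χ x′
    χ-cong {x} {x′} e with x ≟ 0# | x′ ≟ 0#
    ... | yes _ | yes _ = refl
    ... | yes z | no ¬z = contradiction (trans (sym e) z) ¬z
    ... | no ¬z | yes z = contradiction (trans e z) ¬z
    ... | no _  | no _  = refl
    χ-rest : ∀ x → ¬ x ≈ 0# → χ x ≈ 0#
    χ-rest x ¬z with x ≟ 0#
    ... | yes z = contradiction z ¬z
    ... | no _  = refl
    χ-0 : χ 0# ≈ 1#
    χ-0 with 0# ≟ 0#
    ... | yes _ = refl
    ... | no ¬z = contradiction refl ¬z
    complement : ∀ x → x ^ s + χ x ≈ 1#
    complement x with x ≟ 0#
    ... | yes x≈0 = trans (+-congʳ (trans (^-congˡ s x≈0) (0^ s))) (+-identityˡ 1#)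
    ... | no x≉0  = trans (+-identityʳ _) (^-∣ n-1∣s (^-pred-order x≉0))

  -- Rescaling the variable by y multiplies the sum by y^s without changing it. A y with y^s ≠ 1 is
  -- found after reducing s modulo n - 1, which makes the exponent small enough for `∃-^≉1`.
  powerSum-∤ : ∀ s → ¬ n ∸ 1 ∣ s → powerSum s ≈ 0#
  powerSum-∤ s n-1∤s = [_,_]′ (λ e → contradiction e y^s-1≉0) (λ e → e) (integral _ _ (begin
    (y ^ s - 1#) * powerSum s                 ≈⟨ solve 2 (λ a b → (a :+ :- con (+ 1)) :* b := a :* b :+ :- b)
                                                    refl (y ^ s) (powerSum s) ⟩
    y ^ s * powerSum s - powerSum s           ≈⟨ +-congʳ (*-distribˡ-sum (y ^ s) (λ i → elem i ^ s)) ⟩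
    Σ.fold (λ x → y ^ s * x ^ s) - powerSum s ≈⟨ +-congʳ (Σ.fold-cong (λ x → sym (^-distrib-* y x s))) ⟩
    Σ.fold (λ x → (y * x) ^ s) - powerSum s
      ≈⟨ +-congʳ (Σ.fold-reindex (_^ s) (y *_) (^-congˡ s) (*-cancelˡ y≉0)) ⟩
    powerSum s - powerSum s                   ≈⟨ -‿inverseʳ _ ⟩
    0#                                        ∎))
    where
    s′ = s % (n ∸ 1)
    instance
      s′≢0 : NonZero s′
      s′≢0 = ℕ.≢-nonZero λ e → n-1∤s (m%n≡0⇒n∣m s (n ∸ 1) e)
    s′< : suc s′ ℕ.< n
    s′< = ≡.subst (suc s′ ℕ.<_) suc-pred-order (s≤s (m%n<n s (n ∸ 1)))
    y = proj₁ (∃-^≉1 s′ s′<)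
    y≉0 = proj₁ (proj₂ (∃-^≉1 s′ s′<))
    y^s≈y^s′ : y ^ s ≈ y ^ s′
    y^s≈y^s′ = begin
      y ^ s                                       ≈⟨ ^-congʳ y (m≡m%n+[m/n]*n s (n ∸ 1)) ⟩
      y ^ (s′ ℕ.+ s ℕ./ (n ∸ 1) ℕ.* (n ∸ 1))      ≈⟨ ^-homo-* y s′ _ ⟩
      y ^ s′ * y ^ (s ℕ./ (n ∸ 1) ℕ.* (n ∸ 1))    ≈⟨ *-congˡ (^-∣ (n∣m*n (s ℕ./ (n ∸ 1))) (^-pred-order y≉0)) ⟩
      y ^ s′ * 1#                                 ≈⟨ *-identityʳ _ ⟩
      y ^ s′                                      ∎
    y^s-1≉0 : ¬ y ^ s - 1# ≈ 0#
    y^s-1≉0 e = proj₂ (proj₂ (∃-^≉1 s′ s′<)) (trans (sym y^s≈y^s′) (x∙y⁻¹≈ε⇒x≈y _ _ e))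

-- Conjugation and quadratic equations in the field of order q²

module ConjugateRoot {c ℓ} (R : CommutativeRing c ℓ) (integral : IsIntegral R)
  {p : ℕ} (pr : Prime p) (char : R HasCharacteristic p) (k : ℕ) where

  open CommutativeRing R hiding (zero)
  open Algebra.Properties.Semiring.Exp semiring

  private
    q : ℕ
    q = p ℕ.^ k

  open Algebra.Properties.Ring ring using (x∙y⁻¹≈ε⇒x≈y)
  open Algebra.Properties.CommutativeSemiring.Exp commutativeSemiring using (^-distrib-*)
  open Frobenius R pr char using (frobenius^)
  open IntegerSolver R using (solve; _:=_; _:+_; _:*_; :-_)
  open Relation.Binary.Reasoning.Setoid setoid

  -- The coefficients are fixed by the q-th power, so `η` is again a root and is ξ or - s - ξ; in
  -- both cases the q-th power takes it back to ξ. Only an integral domain is assumed, because the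
  -- root in question lives in the extension F[ξ].
  root-^q² : ∀ s t ξ → s ^ q ≈ s → t ^ q ≈ t → ξ * ξ + s * ξ + t ≈ 0# → ξ ^ (q ℕ.* q) ≈ ξ
  root-^q² s t ξ s-fixed t-fixed ξ-root = trans (sym (^-assocʳ ξ q q)) η^q≈ξ
    where
    0^q : 0# ^ q ≈ 0#
    0^q with q | ℕ.m^n≢0 p k {{prime⇒nonZero pr}}
    ... | suc j | _ = zeroˡ _

    η = ξ ^ q

    η-root : η * η + s * η + t ≈ 0#
    η-root = begin
      η * η + s * η + t                         ≈⟨ +-cong (+-congˡ (*-congʳ s-fixed)) t-fixed ⟨
      η * η + s ^ q * η + t ^ q                 ≈⟨ +-congʳ (+-cong (^-distrib-* ξ ξ q) (^-distrib-* s ξ q)) ⟨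
      (ξ * ξ) ^ q + (s * ξ) ^ q + t ^ q         ≈⟨ +-congʳ (frobenius^ k (ξ * ξ) (s * ξ)) ⟨
      (ξ * ξ + s * ξ) ^ q + t ^ q               ≈⟨ frobenius^ k (ξ * ξ + s * ξ) t ⟨
      (ξ * ξ + s * ξ + t) ^ q                   ≈⟨ ^-congˡ q ξ-root ⟩
      0# ^ q                                    ≈⟨ 0^q ⟩
      0#                                        ∎

    η^q≈ξ : η ^ q ≈ ξ
    η^q≈ξ with integral (η - ξ) (η + ξ + s) (begin
      (η - ξ) * (η + ξ + s)
        ≈⟨ solve 4 (λ η ξ s t → (η :+ :- ξ) :* (η :+ ξ :+ s) :=
             (η :* η :+ s :* η :+ t) :+ :- (ξ :* ξ :+ s :* ξ :+ t)) refl η ξ s t ⟩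
      (η * η + s * η + t) - (ξ * ξ + s * ξ + t)   ≈⟨ +-cong η-root (-‿cong ξ-root) ⟩
      0# - 0#                                     ≈⟨ -‿inverseʳ 0# ⟩
      0#                                          ∎)
    ... | inj₁ e = trans (^-congˡ q η≈ξ) η≈ξ
      where η≈ξ = x∙y⁻¹≈ε⇒x≈y η ξ e
    ... | inj₂ e = x∙y⁻¹≈ε⇒x≈y (η ^ q) ξ (begin
      η ^ q - ξ
        ≈⟨ solve 4 (λ b η ξ s → b :+ :- ξ := (b :+ η :+ s) :+ :- (η :+ ξ :+ s)) refl (η ^ q) η ξ s ⟩
      (η ^ q + η + s) - (η + ξ + s)               ≈⟨ +-cong conjugate (-‿cong e) ⟩
      0# - 0#                                     ≈⟨ -‿inverseʳ 0# ⟩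
      0#                                          ∎)
      where
      conjugate : η ^ q + η + s ≈ 0#
      conjugate = begin
        η ^ q + η + s           ≈⟨ +-congˡ s-fixed ⟨
        η ^ q + ξ ^ q + s ^ q   ≈⟨ +-congʳ (frobenius^ k η ξ) ⟨
        (η + ξ) ^ q + s ^ q     ≈⟨ frobenius^ k (η + ξ) s ⟨
        (η + ξ + s) ^ q         ≈⟨ ^-congˡ q e ⟩
        0# ^ q                  ≈⟨ 0^q ⟩
        0#                      ∎

module QuadraticField {u v} (p k ℓ : ℕ) (pr : Prime p) .{{_ : NonZero k}} .{{_ : NonZero ℓ}}
  (F : FiniteField u v ((p ℕ.^ k) ℕ.^ 2)) where

  q Q n : ℕ
  q = p ℕ.^ k
  Q = p ℕ.^ ℓ
  n = q ℕ.^ 2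

  open FiniteField F hiding (zero)
  open FiniteFieldProperties F
  open Algebra.Properties.Ring ring using (x∙y⁻¹≈ε⇒x≈y; +-inverseʳ-unique)
  open Algebra.Properties.Semiring.Exp semiring hiding (_^_)
  open Algebra.Properties.CommutativeSemiring.Exp commutativeSemiring using (^-distrib-*)
  open Algebra.Properties.Semiring.Mult semiring using () renaming (_×_ to _⋅_)
  open Relation.Binary.Reasoning.Setoid setoid

  n≡q*q : n ≡ q ℕ.* q
  n≡q*q = ≡.cong (q ℕ.*_) (ℕ.*-identityʳ q)

  p>1 : 1 ℕ.< p
  p>1 = ℕ.nonTrivial⇒n>1 p {{prime⇒nonTrivial pr}}

  private
    p^>1 : ∀ j → .{{NonZero j}} → 1 ℕ.< p ℕ.^ j
    p^>1 (suc j) = ℕ.<-≤-trans p>1 (ℕ.m≤m*n p (p ℕ.^ j) {{ℕ.m^n≢0 p j {{prime⇒nonZero pr}}}})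

  q>1 : 1 ℕ.< q
  q>1 = p^>1 k

  Q>1 : 1 ℕ.< Q
  Q>1 = p^>1 ℓ

  instance
    q-nonZero : NonZero q
    q-nonZero = ℕ.>-nonZero (ℕ.<-trans (s≤s z≤n) q>1)
    Q-nonZero : NonZero Q
    Q-nonZero = ℕ.>-nonZero (ℕ.<-trans (s≤s z≤n) Q>1)
    q-1-nonZero : NonZero (q ∸ 1)
    q-1-nonZero = ℕ.>-nonZero (ℕ.m<n⇒0<n∸m q>1)

  suc-pred-q : suc (q ∸ 1) ≡ q
  suc-pred-q = ℕ.m+[n∸m]≡n (ℕ.<⇒≤ q>1)

  n-1≡ : n ∸ 1 ≡ (q ∸ 1) ℕ.* (q ℕ.+ 1)
  n-1≡ = ≡.trans (≡.cong (_∸ 1) (≡.trans n≡q*q (≡.sym (≡.cong₂ ℕ._*_ suc-pred-q suc-pred-q)))) (≡.trans (expand (q ∸ 1))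
    (≡.cong (λ j → (q ∸ 1) ℕ.* (j ℕ.+ 1)) suc-pred-q))
    where
    open ℕSolver.+-*-Solver
    expand : ∀ j → suc j ℕ.* suc j ∸ 1 ≡ j ℕ.* (suc j ℕ.+ 1)
    expand = solve 1 (λ j → j :+ j :* (con 1 :+ j) := j :* (con 1 :+ j :+ con 1)) ≡.refl

  p⋅1≈0 : p ⋅ 1# ≈ 0#
  p⋅1≈0 = root⋅1≈0 (k ℕ.* 2) (≡.sym (ℕ.^-*-assoc p k 2))

  module Power (j : ℕ) where
    open Frobenius commutativeRing pr p⋅1≈0 using (frobenius^)

    frob : Carrier → Carrier
    frob x = x ^ (p ℕ.^ j)

    instance
      p^j-nonZero : NonZero (p ℕ.^ j)
      p^j-nonZero = ℕ.m^n≢0 p j {{prime⇒nonZero pr}}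

    frob-cong : ∀ {x y} → x ≈ y → frob x ≈ frob y
    frob-cong = ^-congˡ (p ℕ.^ j)

    frob-+ : ∀ x y → frob (x + y) ≈ frob x + frob y
    frob-+ = frobenius^ j

    frob-* : ∀ x y → frob (x * y) ≈ frob x * frob y
    frob-* x y = ^-distrib-* x y (p ℕ.^ j)

    frob-0 : frob 0# ≈ 0#
    frob-0 = 0^ (p ℕ.^ j)

    frob-1 : frob 1# ≈ 1#
    frob-1 = 1^ (p ℕ.^ j)

    frob-neg : ∀ x → frob (- x) ≈ - frob x
    frob-neg x = +-inverseʳ-unique (frob x) (frob (- x))
      (trans (sym (frob-+ x (- x))) (trans (frob-cong (-‿inverseʳ x)) frob-0))

    frob-nonzero : ∀ {x} → ¬ x ≈ 0# → ¬ frob x ≈ 0#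
    frob-nonzero = ^-nonzero (p ℕ.^ j)

    frob-injective : ∀ {x y} → frob x ≈ frob y → x ≈ y
    frob-injective {x} {y} e with (x - y) ≟ 0#
    ... | yes x-y≈0 = x∙y⁻¹≈ε⇒x≈y x y x-y≈0
    ... | no  x-y≉0 = contradiction (begin
      frob (x - y)            ≈⟨ frob-+ x (- y) ⟩
      frob x + frob (- y)     ≈⟨ +-cong e (frob-neg y) ⟩
      frob y - frob y         ≈⟨ -‿inverseʳ _ ⟩
      0#                      ∎) (frob-nonzero x-y≉0)

    frob-surjective : ∀ y → ∃[ x ] frob x ≈ y
    frob-surjective y =
      let i , e = injective⇒surjective {f = λ i → index (frob (elem i))}
            (λ e → elem-injective (frob-injective (index-injective e))) (index y)
      in elem i , index-injective e

  open Power k public using () renaming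
    ( frob to bar; frob-cong to bar-cong; frob-+ to bar-+; frob-* to bar-*; frob-0 to bar-0; frob-1 to bar-1
    ; frob-neg to bar-neg; frob-nonzero to bar-nonzero )
  open Power ℓ public using () renaming
    ( frob to φ; frob-cong to φ-cong; frob-+ to φ-+; frob-* to φ-*; frob-0 to φ-0; frob-1 to φ-1
    ; frob-neg to φ-neg; frob-nonzero to φ-nonzero; frob-injective to φ-injective; frob-surjective to φ-surjective )

  bar-bar : ∀ x → bar (bar x) ≈ x
  bar-bar x = begin
    (x ^ q) ^ q     ≈⟨ ^-assocʳ x q q ⟩
    x ^ (q ℕ.* q)   ≡⟨ ≡.cong (x ^_) n≡q*q ⟨
    x ^ n           ≈⟨ ^-order x ⟩
    x               ∎

  φ-bar : ∀ x → φ (bar x) ≈ bar (φ x)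
  φ-bar x = trans (^-assocʳ x q Q) (trans (^-congʳ x (ℕ.*-comm q Q)) (sym (^-assocʳ x Q q)))

  conjugation : Involution commutativeRing
  conjugation = record
    { bar = bar ; bar-cong = bar-cong ; bar-+ = bar-+ ; bar-* = bar-* ; bar-neg = bar-neg
    ; bar-0 = bar-0 ; bar-1 = bar-1 ; bar-bar = bar-bar }

  open InvolutionSolver commutativeRing conjugation public
    using (solve; _≣_; _⊕_; _⊝_; _⊗_; ⊝_; ⋆; 𝟘; 𝟙)

  private
    θ-spec : ∃[ y ] (¬ y ≈ 0#) × (¬ y ^ (q ∸ 1) ≈ 1#)
    θ-spec = ∃-^≉1 (q ∸ 1) (≡.subst (ℕ._< n) (≡.sym suc-pred-q) (≡.subst (q ℕ.<_) (≡.sym n≡q*q) (ℕ.m<m*n q q q>1)))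

  -- An element outside the fixed field K, so that 1 and `θ` form a K-basis of F. Arguments that
  -- need two independent lines test on these two.
  θ : Carrier
  θ = proj₁ θ-spec

  barθ≉θ : ¬ bar θ ≈ θ
  barθ≉θ e = proj₂ (proj₂ θ-spec) (*-cancelˡ (proj₁ (proj₂ θ-spec)) (begin
    θ * θ ^ (q ∸ 1)     ≈⟨ ^-congʳ θ suc-pred-q ⟩
    θ ^ q               ≈⟨ e ⟩
    θ                   ≈⟨ *-identityʳ θ ⟨
    θ * 1#              ∎))

  -- If X² + s X + t had no root in F, then F[ξ] would be an integral domain in
  -- which ξ and all elements of F are fixed by the n-th power map.
  module NoRoot (s t : Carrier) (bar-s : bar s ≈ s) (bar-t : bar t ≈ t)
    (noRoot : ∀ x → ¬ x * x + s * x + t ≈ 0#) where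

    open QuadraticExtension commutativeRing s t
    private module E = CommutativeRing extension
    open Algebra.Properties.Semiring.Exp E.semiring using () renaming (_^_ to _^ₑ_)

    -- The quadratic form is the norm of a + b ξ; if it vanished with b ≠ 0, then - a / b would be a
    -- root.
    norm-zero : ∀ a b → a * a - s * a * b + t * b * b ≈ 0# → a ≈ 0# × b ≈ 0#
    norm-zero a b e with b ≟ 0#
    ... | yes b≈0 = [_,_]′ (λ z → z , b≈0) (λ z → z , b≈0) (integral a a (begin
      a * a                             ≈⟨ solve 3 (λ s t a → a ⊗ a ≣ a ⊗ a ⊝ s ⊗ a ⊗ 𝟘 ⊕ t ⊗ 𝟘 ⊗ 𝟘) refl s t a ⟩
      a * a - s * a * 0# + t * 0# * 0#
        ≈⟨ +-cong (+-congˡ (-‿cong (*-congˡ (sym b≈0)))) (*-cong (*-congˡ (sym b≈0)) (sym b≈0)) ⟩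
      a * a - s * a * b + t * b * b     ≈⟨ e ⟩
      0#                                ∎))
    ... | no b≉0 = contradiction (begin
      x * x + s * x + t
        ≈⟨ solve 4 (λ s t a c → (⊝ a ⊗ c) ⊗ (⊝ a ⊗ c) ⊕ s ⊗ (⊝ a ⊗ c) ⊕ t ≣
                      a ⊗ a ⊗ c ⊗ c ⊝ s ⊗ a ⊗ c ⊗ 𝟙 ⊕ t ⊗ 𝟙 ⊗ 𝟙) refl s t a c ⟩
      a * a * c * c - s * a * c * 1# + t * 1# * 1#
        ≈⟨ +-cong (+-congˡ (-‿cong (*-congˡ (sym bc≈1)))) (*-cong (*-congˡ (sym bc≈1)) (sym bc≈1)) ⟩
      a * a * c * c - s * a * c * (b * c) + t * (b * c) * (b * c)
        ≈⟨ solve 5 (λ s t a b c → a ⊗ a ⊗ c ⊗ c ⊝ s ⊗ a ⊗ c ⊗ (b ⊗ c) ⊕ t ⊗ (b ⊗ c) ⊗ (b ⊗ c) ≣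
                      (a ⊗ a ⊝ s ⊗ a ⊗ b ⊕ t ⊗ b ⊗ b) ⊗ (c ⊗ c)) refl s t a b c ⟩
      (a * a - s * a * b + t * b * b) * (c * c)   ≈⟨ *-congʳ e ⟩
      0# * (c * c)                                ≈⟨ zeroˡ _ ⟩
      0#                                          ∎) (noRoot x)
      where
      c = b ⁻¹
      x = - a * c
      bc≈1 = *-inverseʳ b≉0

    -- Multiplying the product by the conjugate (a - s b) - b ξ of the first factor leaves the norm
    -- times c + d ξ, and the norm vanishes only together with a and b.
    integralₑ : ∀ x y → x *ₑ y ≈ₑ E.0# → x ≈ₑ E.0# ⊎ y ≈ₑ E.0#
    integralₑ (a , b) (c , d) (e , f) with (a * a - s * a * b + t * b * b) ≟ 0#
    ... | yes N≈0 = inj₁ (norm-zero a b N≈0)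
    ... | no  N≉0 = inj₂
      ( x*y≈0⇒y≈0 N≉0 (begin
          (a * a - s * a * b + t * b * b) * c
            ≈⟨ solve 6 (λ s t a b c d → (a ⊗ a ⊝ s ⊗ a ⊗ b ⊕ t ⊗ b ⊗ b) ⊗ c ≣
                 (a ⊝ s ⊗ b) ⊗ (a ⊗ c ⊝ t ⊗ (b ⊗ d)) ⊕ t ⊗ b ⊗ (a ⊗ d ⊕ b ⊗ c ⊝ s ⊗ (b ⊗ d))) refl s t a b c d ⟩
          (a - s * b) * (a * c - t * (b * d)) + t * b * (a * d + b * c - s * (b * d))
            ≈⟨ +-cong (trans (*-congˡ e) (zeroʳ _)) (trans (*-congˡ f) (zeroʳ _)) ⟩
          0# + 0#   ≈⟨ +-identityˡ 0# ⟩
          0#        ∎)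
      , x*y≈0⇒y≈0 N≉0 (begin
          (a * a - s * a * b + t * b * b) * d
            ≈⟨ solve 6 (λ s t a b c d → (a ⊗ a ⊝ s ⊗ a ⊗ b ⊕ t ⊗ b ⊗ b) ⊗ d ≣
                 a ⊗ (a ⊗ d ⊕ b ⊗ c ⊝ s ⊗ (b ⊗ d)) ⊝ b ⊗ (a ⊗ c ⊝ t ⊗ (b ⊗ d))) refl s t a b c d ⟩
          a * (a * d + b * c - s * (b * d)) - b * (a * c - t * (b * d))
            ≈⟨ +-cong (trans (*-congˡ f) (zeroʳ _)) (-‿cong (trans (*-congˡ e) (zeroʳ _))) ⟩
          0# - 0#   ≈⟨ -‿inverseʳ 0# ⟩
          0#        ∎) )

    embed-fixed : ∀ {a} m → a ^ m ≈ a → embed a ^ₑ m ≈ₑ embed a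
    embed-fixed {a} m e = E.trans (embed-^ a m) (e , refl)

    ξ^n≈ξ : ξ ^ₑ (q ℕ.* q) ≈ₑ ξ
    ξ^n≈ξ = ConjugateRoot.root-^q² extension integralₑ pr (E.trans (embed-× p) (p⋅1≈0 , refl)) k
      (embed s) (embed t) ξ (embed-fixed q bar-s) (embed-fixed q bar-t) ξ-root

    points : Fin (suc n) → E
    points zero    = ξ
    points (suc i) = embed (elem i)

    points-injective : ∀ {i j} → points i ≈ₑ points j → i ≡ j
    points-injective {zero}  {zero}  _       = ≡.refl
    points-injective {zero}  {suc j} (_ , e) = contradiction e 1≉0
    points-injective {suc i} {zero}  (_ , e) = contradiction e 0≉1
    points-injective {suc i} {suc j} (e , _) = ≡.cong suc (elem-injective e)

    points-fixed : ∀ i → points i ^ₑ n ≈ₑ points i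
    points-fixed zero    = ≡.subst (λ m → ξ ^ₑ m ≈ₑ ξ) (≡.sym n≡q*q) ξ^n≈ξ
    points-fixed (suc i) = embed-fixed n (^-order (elem i))

    absurd : ⊥
    absurd = ℕ.1+n≰n (≡.subst (suc n ℕ.≤_) n≡ (fixed-points-≤ (λ e → 0≉1 (proj₁ e)) (n ∸ 2) points points-injective
      λ i → ≡.subst (λ m → points i ^ₑ m ≈ₑ points i) (≡.sym n≡) (points-fixed i)))
      where
      open Roots extension integralₑ using (fixed-points-≤)
      n≡ : suc (suc (n ∸ 2)) ≡ n
      n≡ = ℕ.m+[n∸m]≡n (ℕ.≤-trans q>1 (ℕ.≤-trans (ℕ.m≤m*n q q) (ℕ.≤-reflexive (≡.sym n≡q*q))))

  quadratic-root : ∀ s t → bar s ≈ s → bar t ≈ t → ∃[ x ] x * x + s * x + t ≈ 0#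
  quadratic-root s t bar-s bar-t with all? {P = λ x → ¬ x * x + s * x + t ≈ 0#}
      (λ e f g → f (trans (+-congʳ (+-cong (*-cong e e) (*-congˡ e))) g))
      (λ x → ¬? (x * x + s * x + t ≟ 0#))
  ... | inj₁ noRoot   = contradiction (NoRoot.absurd s t bar-s bar-t noRoot) λ ()
  ... | inj₂ (x , ¬¬) = x , decidable-stable (x * x + s * x + t ≟ 0#) ¬¬

-- The fixed field of conjugation is the subfield of order q

lookup-injective : ∀ {a} {A : Set a} {xs : List A} → Unique xs →
  ∀ i j → List.lookup xs i ≡ List.lookup xs j → i ≡ j
lookup-injective (_  ∷ _) zero    zero    _ = ≡.refl
lookup-injective (x∉ ∷ _) zero    (suc j) e = contradiction e (All.lookup x∉ (∈-lookup j))
lookup-injective (x∉ ∷ _) (suc i) zero    e = contradiction (≡.sym e) (All.lookup x∉ (∈-lookup i))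
lookup-injective (_  ∷ u) (suc i) (suc j) e = ≡.cong suc (lookup-injective u i j e)

module FixedField {u v} (p k ℓ : ℕ) (pr : Prime p) .{{_ : NonZero k}} .{{_ : NonZero ℓ}}
  (F : FiniteField u v ((p ℕ.^ k) ℕ.^ 2)) where

  open QuadraticField p k ℓ pr F
  open FiniteField F hiding (zero)
  open FiniteFieldProperties F
  open Algebra.Properties.Ring ring using (x∙y⁻¹≈ε⇒x≈y)
  open Algebra.Properties.Semiring.Exp semiring hiding (_^_)
  open Roots commutativeRing integral using (fixed-points-≤)
  open Subsets F
  open Relation.Binary.Reasoning.Setoid setoid

  fixed? : ∀ i → Dec (bar (elem i) ≈ elem i)
  fixed? i = bar (elem i) ≟ elem i

  fixedIndices : List (Fin n)
  fixedIndices = List.filter fixed? (List.allFin n)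

  m : ℕ
  m = List.length fixedIndices

  fixed : Fin m → Carrier
  fixed i = elem (List.lookup fixedIndices i)

  fixed-injective : ∀ {i j} → fixed i ≈ fixed j → i ≡ j
  fixed-injective e = lookup-injective (Unique.filter⁺ fixed? (Unique.allFin⁺ n)) _ _ (elem-injective e)

  fixed-fixed : ∀ i → bar (fixed i) ≈ fixed i
  fixed-fixed i = proj₂ (∈-filter⁻ fixed? {xs = List.allFin n} (∈-lookup {xs = fixedIndices} i))

  fixed-surjective : ∀ {x} → bar x ≈ x → ∃[ i ] fixed i ≈ x
  fixed-surjective {x} e = Any.index x∈ , trans (reflexive (≡.cong elem (≡.sym (lookup-index x∈)))) (elem-index x)
    where
    x∈ : index x Membership.∈ fixedIndices
    x∈ = ∈-filter⁺ fixed? (∈-allFin (index x)) (trans (bar-cong (elem-index x)) (trans e (sym (elem-index x))))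

  m≤q : m ℕ.≤ q
  m≤q = ≡.subst (m ℕ.≤_) q≡ (fixed-points-≤ 0≉1 (q ∸ 2) fixed fixed-injective
    λ i → ≡.subst (λ j → fixed i ^ j ≈ fixed i) (≡.sym q≡) (fixed-fixed i))
    where
    q≡ : suc (suc (q ∸ 2)) ≡ q
    q≡ = ℕ.m+[n∸m]≡n q>1

  Tr : Carrier → Carrier
  Tr x = x + bar x

  Tr-fixed : ∀ x → bar (Tr x) ≈ Tr x
  Tr-fixed = solve 1 (λ x → ⋆ (x ⊕ ⋆ x) ≣ x ⊕ ⋆ x) refl

  -- The two traces are linear equations in (x , x̄) with determinant θ̄ - θ, so they determine x.
  Tr-injective : ∀ {x y} → Tr x ≈ Tr y → Tr (θ * x) ≈ Tr (θ * y) → x ≈ y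
  Tr-injective {x} {y} e f = x∙y⁻¹≈ε⇒x≈y x y (x*y≈0⇒y≈0 (λ z → barθ≉θ (x∙y⁻¹≈ε⇒x≈y (bar θ) θ z)) (begin
    (bar θ - θ) * (x - y)
      ≈⟨ solve 3 (λ θ x y → (⋆ θ ⊝ θ) ⊗ (x ⊝ y) ≣
           ⋆ θ ⊗ ((x ⊕ ⋆ x) ⊝ (y ⊕ ⋆ y)) ⊝ ((θ ⊗ x ⊕ ⋆ (θ ⊗ x)) ⊝ (θ ⊗ y ⊕ ⋆ (θ ⊗ y)))) refl θ x y ⟩
    bar θ * (Tr x - Tr y) - (Tr (θ * x) - Tr (θ * y))
      ≈⟨ +-cong (*-congˡ (+-congʳ e)) (-‿cong (+-congʳ f)) ⟩
    bar θ * (Tr y - Tr y) - (Tr (θ * y) - Tr (θ * y))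
      ≈⟨ solve 3 (λ θ a b → θ ⊗ (a ⊝ a) ⊝ (b ⊝ b) ≣ 𝟘) refl (bar θ) (Tr y) (Tr (θ * y)) ⟩
    0# ∎))

  -- The traces of x and of θ x are fixed elements that together determine x, so the q² elements of
  -- F inject into pairs of fixed elements.
  q≤m : q ℕ.≤ m
  q≤m with q ℕ.≤? m
  ... | yes q≤m = q≤m
  ... | no  q≰m = contradiction (ℕ.<-≤-trans (ℕ.*-mono-< m<q m<q)
      (ℕ.≤-trans (ℕ.≤-reflexive (≡.sym n≡q*q)) (Fin.injective⇒≤ {f = code} code-injective))) (ℕ.<-irrefl ≡.refl)
    where
    m<q = ℕ.≰⇒> q≰m
    code₁ code₂ : Fin n → Fin m
    code₁ i = proj₁ (fixed-surjective (Tr-fixed (elem i)))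
    code₂ i = proj₁ (fixed-surjective (Tr-fixed (θ * elem i)))
    code : Fin n → Fin (m ℕ.* m)
    code i = Fin.combine (code₁ i) (code₂ i)
    code-injective : Injective _≡_ _≡_ code
    code-injective {i} {j} e =
      let e₁ , e₂ = Fin.combine-injective (code₁ i) (code₂ i) (code₁ j) (code₂ j) e in
      elem-injective (Tr-injective
        (trans (sym (proj₂ (fixed-surjective (Tr-fixed (elem i)))))
          (trans (reflexive (≡.cong fixed e₁)) (proj₂ (fixed-surjective (Tr-fixed (elem j))))))
        (trans (sym (proj₂ (fixed-surjective (Tr-fixed (θ * elem i)))))
          (trans (reflexive (≡.cong fixed e₂)) (proj₂ (fixed-surjective (Tr-fixed (θ * elem j)))))))

  fixedSubfield : SubfieldOfOrder m
  fixedSubfield = record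
    { element    = fixed
    ; injective  = fixed-injective
    ; 0-member   = fixed-surjective bar-0
    ; 1-member   = fixed-surjective bar-1
    ; +-closed   = λ x∈ y∈ → fixed-surjective (trans (bar-+ _ _) (+-cong (member x∈) (member y∈)))
    ; neg-closed = λ x∈ → fixed-surjective (trans (bar-neg _) (-‿cong (member x∈)))
    ; *-closed   = λ x∈ y∈ → fixed-surjective (trans (bar-* _ _) (*-cong (member x∈) (member y∈)))
    ; inv-closed = λ {x} {y} x∈ xy≈1 → fixed-surjective (*-cancelˡ
        (*-nonzeroˡ {x} {y} (λ z → 1≉0 (trans (sym xy≈1) z))) (begin
          x * bar y       ≈⟨ *-congʳ (member x∈) ⟨
          bar x * bar y   ≈⟨ bar-* x y ⟨
          bar (x * y)     ≈⟨ bar-cong xy≈1 ⟩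
          bar 1#          ≈⟨ bar-1 ⟩
          1#              ≈⟨ xy≈1 ⟨
          x * y           ∎))
    }
    where
    member : ∀ {x} → ∃[ i ] fixed i ≈ x → bar x ≈ x
    member (i , e) = trans (bar-cong (sym e)) (trans (fixed-fixed i) e)

  bar-fixed⇒∈𝔽 : ∀ {x} → bar x ≈ x → 𝔽 q x
  bar-fixed⇒∈𝔽 {x} e = ≡.subst (λ j → 𝔽 j x) (ℕ.≤-antisym m≤q q≤m) (fixedSubfield , fixed-surjective e)

  -- `𝔽` offers an arbitrary subfield with q elements. Multiplication by a nonzero member permutes
  -- that subfield, and `^-closed` applied to its enumeration gives x^q = x.
  ∈𝔽⇒bar-fixed : ∀ {x} → 𝔽 q x → bar x ≈ x
  ∈𝔽⇒bar-fixed {x} (S , x∈) with x ≟ 0#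
  ... | yes x≈0 = trans (bar-cong x≈0) (trans bar-0 (sym x≈0))
  ... | no  x≉0 = let o , e-o = S.0-member in
    ^-closed S.element S.injective o e-o x x≉0 (λ i → S.*-closed x∈ (i , refl))
    where module S = SubfieldOfOrder S

-- Roots of unity in characteristic 2 and the conditions on `ord₂`

-- An even cofactor could give up a further 2, against the maximality of `ord₂ m`.
odd-part : ∀ m .{{_ : NonZero m}} → ∃[ j ] m ≡ suc (2 ℕ.* j) ℕ.* 2 ℕ.^ ord₂ m
odd-part m with ord₂-∣ m
... | divides c m≡ with c ℕ.% 2 in c%2 | m≡m%n+[m/n]*n c 2 | m%n<n c 2
...   | 0           | c≡ | _                = contradiction (ord₂-largest m (suc (ord₂ m)) (divides (c ℕ./ 2)
        (≡.trans m≡ (≡.trans (≡.cong (ℕ._* 2 ℕ.^ ord₂ m) c≡) (ℕ.*-assoc (c ℕ./ 2) 2 _))))) ℕ.1+n≰n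
...   | 1           | c≡ | _                = c ℕ./ 2 ,
        ≡.trans m≡ (≡.cong (ℕ._* 2 ℕ.^ ord₂ m) (≡.trans c≡ (≡.cong suc (ℕ.*-comm (c ℕ./ 2) 2))))
...   | suc (suc _) | _  | s≤s (s≤s ())

2^-∣ : ∀ {i j} → i ℕ.≤ j → 2 ℕ.^ i ∣ 2 ℕ.^ j
2^-∣ {i} {j} i≤j = divides (2 ℕ.^ (j ∸ i))
  (≡.trans (≡.cong (2 ℕ.^_) (≡.sym (ℕ.m∸n+n≡m i≤j))) (ℕ.^-distribˡ-+-* 2 (j ∸ i) i))

[1+x]^c : ∀ x c → ∃[ w ] suc x ℕ.^ c ≡ suc (w ℕ.* x)
[1+x]^c x ℕ.zero  = 0 , ≡.refl
[1+x]^c x (suc c) with [1+x]^c x c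
... | w , e = w ℕ.+ 1 ℕ.+ w ℕ.* x , ≡.trans (≡.cong (suc x ℕ.*_) e)
  (solve 2 (λ x w → (con 1 :+ x) :* (con 1 :+ w :* x) := con 1 :+ (w :+ con 1 :+ w :* x) :* x) ≡.refl x w)
  where open ℕSolver.+-*-Solver

-- 2 m + 1 is the odd part of i.
common-multiple : ∀ i j .{{_ : NonZero i}} {d} → d ℕ.* 2 ℕ.^ ord₂ i ∣ j →
  ∃[ m ] ∃[ c ] suc (2 ℕ.* m) ℕ.* j ≡ c ℕ.* d ℕ.* i
common-multiple i j {d} (divides c j≡) with odd-part i
... | m , i≡ = m , c , (begin
  suc (2 ℕ.* m) ℕ.* j                                   ≡⟨ ≡.cong (suc (2 ℕ.* m) ℕ.*_) j≡ ⟩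
  suc (2 ℕ.* m) ℕ.* (c ℕ.* (d ℕ.* 2 ℕ.^ ord₂ i))        ≡⟨ rearrange (suc (2 ℕ.* m)) c d (2 ℕ.^ ord₂ i) ⟩
  c ℕ.* d ℕ.* (suc (2 ℕ.* m) ℕ.* 2 ℕ.^ ord₂ i)          ≡⟨ ≡.cong (c ℕ.* d ℕ.*_) i≡ ⟨
  c ℕ.* d ℕ.* i                                         ∎)
  where
  open ≡.≡-Reasoning
  open ℕSolver.+-*-Solver
  rearrange : ∀ s c d o → s ℕ.* (c ℕ.* (d ℕ.* o)) ≡ c ℕ.* d ℕ.* (s ℕ.* o)
  rearrange = solve 4 (λ s c d o → s :* (c :* (d :* o)) := c :* d :* (s :* o)) ≡.refl

-- With N = 2^2^i, the left side is (N²)^c, which is 1 modulo N² - 1 and so modulo the Fermat number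
-- N + 1.
fermat∣ : ∀ c i → ∃[ s ] (2 ℕ.^ (c ℕ.* 2 ℕ.^ i)) ℕ.^ 2 ≡ suc (s ℕ.* suc (2 ℕ.^ (2 ℕ.^ i)))
fermat∣ c i = w ℕ.* x , (begin
  (2 ℕ.^ (c ℕ.* 2 ℕ.^ i)) ℕ.^ 2           ≡⟨ ≡.cong (λ j → (2 ℕ.^ j) ℕ.^ 2) (ℕ.*-comm c (2 ℕ.^ i)) ⟩
  (2 ℕ.^ (2 ℕ.^ i ℕ.* c)) ℕ.^ 2           ≡⟨ ≡.cong (ℕ._^ 2) (ℕ.^-*-assoc 2 (2 ℕ.^ i) c) ⟨
  (N ℕ.^ c) ℕ.^ 2                         ≡⟨ ℕ.^-*-assoc N c 2 ⟩
  N ℕ.^ (c ℕ.* 2)                         ≡⟨ ≡.cong (N ℕ.^_) (ℕ.*-comm c 2) ⟩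
  N ℕ.^ (2 ℕ.* c)                         ≡⟨ ℕ.^-*-assoc N 2 c ⟨
  (N ℕ.^ 2) ℕ.^ c                         ≡⟨ ≡.cong (ℕ._^ c) N²≡ ⟩
  suc (x ℕ.* suc N) ℕ.^ c                 ≡⟨ proj₂ ([1+x]^c (x ℕ.* suc N) c) ⟩
  suc (w ℕ.* (x ℕ.* suc N))               ≡⟨ ≡.cong suc (ℕ.*-assoc w x (suc N)) ⟨
  suc (w ℕ.* x ℕ.* suc N)                 ∎)
  where
  open ≡.≡-Reasoning
  open ℕSolver.+-*-Solver
  N x w : ℕ
  N = 2 ℕ.^ (2 ℕ.^ i)
  x = ℕ.pred N
  w = proj₁ ([1+x]^c (x ℕ.* suc N) c)
  N²≡ : N ℕ.^ 2 ≡ suc (x ℕ.* suc N)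
  N²≡ = ≡.subst (λ j → j ℕ.^ 2 ≡ suc (x ℕ.* suc j)) (ℕ.suc-pred N {{ℕ.m^n≢0 2 (2 ℕ.^ i)}})
    (solve 1 (λ x → (con 1 :+ x) :* ((con 1 :+ x) :* con 1) := con 1 :+ x :* (con 1 :+ (con 1 :+ x))) ≡.refl x)

m+m≡2*m : ∀ c i → c ℕ.* (i ℕ.+ i) ≡ 2 ℕ.* c ℕ.* i
m+m≡2*m = solve 2 (λ c i → c :* (i :+ i) := con 2 :* c :* i) ≡.refl
  where open ℕSolver.+-*-Solver

module TwoPowers {u v} (k ℓ : ℕ) .{{_ : NonZero k}} .{{_ : NonZero ℓ}}
  (F : FiniteField u v ((2 ℕ.^ k) ℕ.^ 2)) where

  open FiniteField F hiding (zero)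
  open FiniteFieldProperties F
  open Algebra.Properties.Ring ring using (x∙y⁻¹≈ε⇒x≈y)
  open Algebra.Properties.Semiring.Exp semiring hiding (_^_)
  open Algebra.Properties.CommutativeSemiring.Exp commutativeSemiring using (^-distrib-*)
  open QuadraticField 2 k ℓ prime[2] F using (n; p⋅1≈0)
  open IntegerSolver commutativeRing using (solve; _:=_; _:+_; _:*_; :-_; con)
  open Relation.Binary.Reasoning.Setoid setoid

  -- For nonzero `z` these say that the order of `z` divides 2^i - 1 or 2^i + 1. When exponents `i`
  -- are added, they combine like the signs + and -; this sign rule replaces gcd computations with
  -- the numbers 2^i ± 1.
  Fixes Inverts : ℕ → Carrier → Set _
  Fixes   i z = z ^ (2 ℕ.^ i) ≈ z
  Inverts i z = z ^ (2 ℕ.^ i) * z ≈ 1#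

  private
    ^2^-+ : ∀ z i j → z ^ (2 ℕ.^ (i ℕ.+ j)) ≈ (z ^ (2 ℕ.^ i)) ^ (2 ℕ.^ j)
    ^2^-+ z i j = trans (^-congʳ z (ℕ.^-distribˡ-+-* 2 i j)) (sym (^-assocʳ z (2 ℕ.^ i) (2 ℕ.^ j)))

    apply : ∀ j {x y} → x * y ≈ 1# → x ^ (2 ℕ.^ j) * y ^ (2 ℕ.^ j) ≈ 1#
    apply j {x} {y} e = trans (sym (^-distrib-* x y (2 ℕ.^ j))) (trans (^-congˡ (2 ℕ.^ j) e) (1^ (2 ℕ.^ j)))

  fixes-+ : ∀ {z} i j → Fixes i z → Fixes j z → Fixes (i ℕ.+ j) z
  fixes-+ {z} i j e f = trans (^2^-+ z i j) (trans (^-congˡ (2 ℕ.^ j) e) f)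

  inverts-+-fixes : ∀ {z} i j → Inverts i z → Fixes j z → Inverts (i ℕ.+ j) z
  inverts-+-fixes {z} i j e f = trans (*-cong (^2^-+ z i j) (sym f)) (apply j e)

  inverts-+ : ∀ {z} i j → Inverts i z → Inverts j z → Fixes (i ℕ.+ j) z
  inverts-+ {z} i j e f = begin
    z ^ (2 ℕ.^ (i ℕ.+ j))               ≈⟨ ^2^-+ z i j ⟩
    w                                   ≈⟨ *-identityʳ w ⟨
    w * 1#                              ≈⟨ *-congˡ f ⟨
    w * (z ^ (2 ℕ.^ j) * z)             ≈⟨ *-assoc _ _ _ ⟨
    w * z ^ (2 ℕ.^ j) * z               ≈⟨ *-congʳ (apply j e) ⟩
    1# * z                              ≈⟨ *-identityˡ z ⟩
    z                                   ∎
    where w = (z ^ (2 ℕ.^ i)) ^ (2 ℕ.^ j)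

  fixes-* : ∀ {z} c i → Fixes i z → Fixes (c ℕ.* i) z
  fixes-* ℕ.zero  i e = *-identityʳ _
  fixes-* (suc c) i e = fixes-+ i (c ℕ.* i) e (fixes-* c i e)

  inverts-even : ∀ {z} c i → Inverts i z → Fixes (2 ℕ.* c ℕ.* i) z
  inverts-even {z} c i e = ≡.subst (λ j → Fixes j z) (m+m≡2*m c i) (fixes-* c (i ℕ.+ i) (inverts-+ i i e e))

  inverts-odd : ∀ {z} c i → Inverts i z → Inverts (suc (2 ℕ.* c) ℕ.* i) z
  inverts-odd c i e = inverts-+-fixes i (2 ℕ.* c ℕ.* i) e (inverts-even c i e)

  -- Such a `z` satisfies z² = 1, and in characteristic 2 this reads (z - 1)² = 0.
  fixed-inverted⇒1 : ∀ {z} i → Fixes i z → Inverts i z → z ≈ 1#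
  fixed-inverted⇒1 {z} i e f = [_,_]′ done done (integral (z - 1#) (z - 1#) (begin
    (z - 1#) * (z - 1#)
      ≈⟨ solve 1 (λ z → (z :+ :- con (+ 1)) :* (z :+ :- con (+ 1)) :=
           (z :* z :+ :- con (+ 1)) :+ (con (+ 1) :+ (con (+ 1) :+ con (+ 0))) :* (con (+ 1) :+ :- z)) refl z ⟩
    (z * z - 1#) + (1# + (1# + 0#)) * (1# - z)
      ≈⟨ +-cong (+-congʳ (trans (*-congʳ (sym e)) f)) (*-congʳ p⋅1≈0) ⟩
    (1# - 1#) + 0# * (1# - z)
      ≈⟨ solve 1 (λ z → (con (+ 1) :+ :- con (+ 1)) :+ con (+ 0) :* (con (+ 1) :+ :- z) := con (+ 0)) refl z ⟩
    0# ∎))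
    where
    done : z - 1# ≈ 0# → z ≈ 1#
    done = x∙y⁻¹≈ε⇒x≈y z 1#

  -- Under the inequality, some odd multiple of `j` is a multiple of `i`. At that common exponent
  -- `z` is inverted as well as fixed.
  fixes-inverts⇒1 : ∀ {z} i j .{{_ : NonZero i}} .{{_ : NonZero j}} → ord₂ i ℕ.≤ ord₂ j →
    Fixes i z → Inverts j z → z ≈ 1#
  fixes-inverts⇒1 {z} i j i≤j e f =
    let m , c , eq = common-multiple i j {1}
          (≡.subst (_∣ j) (≡.sym (ℕ.*-identityˡ _)) (∣-trans (2^-∣ i≤j) (ord₂-∣ j)))
    in fixed-inverted⇒1 (c ℕ.* 1 ℕ.* i) (fixes-* (c ℕ.* 1) i e)
    (≡.subst (λ x → Inverts x z) eq (inverts-odd m j f))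

  -- The strict inequality makes an odd multiple of `j` an even multiple of `i`, and two inversions
  -- at `i` amount to fixing.
  inverts-inverts⇒1 : ∀ {z} i j .{{_ : NonZero i}} .{{_ : NonZero j}} → ord₂ i ℕ.< ord₂ j →
    Inverts i z → Inverts j z → z ≈ 1#
  inverts-inverts⇒1 {z} i j i<j e f =
    let m , c , eq = common-multiple i j {2} (∣-trans (2^-∣ i<j) (ord₂-∣ j))
    in fixed-inverted⇒1 (c ℕ.* 2 ℕ.* i)
    (≡.subst (λ x → Fixes (x ℕ.* i) z) (ℕ.*-comm 2 c) (inverts-even c i e))
    (≡.subst (λ x → Inverts x z) eq (inverts-odd m j f))

  -- A root of unity whose order divides the Fermat number 2^2^i + 1, which
  -- divides 2^2k − 1.
  ∃-inverts : ∀ i → 2 ℕ.^ i ∣ k → ∃[ t ] (¬ t ≈ 1#) × Inverts (2 ℕ.^ i) t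
  ∃-inverts i (divides c k≡) with fermat∣ c i
  ... | s , n≡′ = y ^ s , y^s≉1 , (begin
    (y ^ s) ^ N * y ^ s     ≈⟨ *-comm _ _ ⟩
    (y ^ s) ^ suc N         ≈⟨ ^-assocʳ y s (suc N) ⟩
    y ^ (s ℕ.* suc N)       ≡⟨ ≡.cong (y ^_) sD≡ ⟩
    y ^ (n ∸ 1)             ≈⟨ ^-pred-order y≉0 ⟩
    1#                      ∎)
    where
    N : ℕ
    N = 2 ℕ.^ (2 ℕ.^ i)
    n≡ : n ≡ suc (s ℕ.* suc N)
    n≡ = ≡.trans (≡.cong (λ j → (2 ℕ.^ j) ℕ.^ 2) k≡) n≡′
    sD≡ : s ℕ.* suc N ≡ n ∸ 1
    sD≡ = ≡.cong (_∸ 1) (≡.sym n≡)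
    instance
      s≢0 : NonZero s
      s≢0 = ℕ.≢-nonZero λ s≡0 → ℕ.≢-nonZero⁻¹ (n ∸ 1) (≡.trans (≡.sym sD≡) (≡.cong (ℕ._* suc N) s≡0))
    s< : suc s ℕ.< n
    s< = ≡.subst (suc s ℕ.<_) (≡.sym n≡) (s≤s (ℕ.m<m*n s (suc N) (s≤s (ℕ.>-nonZero⁻¹ N {{ℕ.m^n≢0 2 (2 ℕ.^ i)}}))))
    y = proj₁ (∃-^≉1 s s<)
    y≉0 = proj₁ (proj₂ (∃-^≉1 s s<))
    y^s≉1 = proj₂ (proj₂ (∃-^≉1 s s<))

  private
    transfer-odd : ∀ {t} j .{{_ : NonZero j}} → Inverts (2 ℕ.^ ord₂ j) t → Inverts j t
    transfer-odd {t} j e with odd-part j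
    ... | m , j≡ = ≡.subst (λ x → Inverts x t) (≡.sym j≡) (inverts-odd m (2 ℕ.^ ord₂ j) e)

    transfer-even : ∀ {t} i j .{{_ : NonZero j}} → i ℕ.< ord₂ j → Inverts (2 ℕ.^ i) t → Fixes j t
    transfer-even {t} i j i< e with ∣-trans (2^-∣ i<) (ord₂-∣ j)
    ... | divides c j≡ = ≡.subst (λ x → Fixes x t)
      (≡.sym (≡.trans j≡ (≡.trans (≡.sym (ℕ.*-assoc c 2 (2 ℕ.^ i))) (≡.cong (ℕ._* 2 ℕ.^ i) (ℕ.*-comm c 2)))))
      (inverts-even c (2 ℕ.^ i) e)

  -- If `ord₂ ℓ` were smaller, a nontrivial t inverted at 2^ord₂ ℓ would be inverted at the odd
  -- multiple `ℓ` and fixed at the even multiple `k`. The next two lemmas use such a root of unity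
  -- at 2^ord₂ k.
  ord₂-≤ : (∀ t → Fixes k t → Inverts ℓ t → t ≈ 1#) → ord₂ k ℕ.≤ ord₂ ℓ
  ord₂-≤ trivial with ord₂ k ℕ.≤? ord₂ ℓ
  ... | yes k≤ℓ = k≤ℓ
  ... | no  k≰ℓ =
    let t , t≉1 , e = ∃-inverts (ord₂ ℓ) (∣-trans (2^-∣ (ℕ.<⇒≤ (ℕ.≰⇒> k≰ℓ))) (ord₂-∣ k))
    in contradiction (trivial t (transfer-even (ord₂ ℓ) k (ℕ.≰⇒> k≰ℓ) e) (transfer-odd ℓ e)) t≉1

  ord₂-≢ : (∀ t → Inverts k t → Inverts ℓ t → t ≈ 1#) → ord₂ k ≢ ord₂ ℓ
  ord₂-≢ trivial k≡ℓ =
    let t , t≉1 , e = ∃-inverts (ord₂ k) (ord₂-∣ k)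
    in t≉1 (trivial t (transfer-odd k e) (transfer-odd ℓ (≡.subst (λ i → Inverts (2 ℕ.^ i) t) k≡ℓ e)))

  ord₂-≥ : (∀ t → Inverts k t → Fixes ℓ t → t ≈ 1#) → ord₂ k ℕ.≥ ord₂ ℓ
  ord₂-≥ trivial with ord₂ ℓ ℕ.≤? ord₂ k
  ... | yes ℓ≤k = ℓ≤k
  ... | no  ℓ≰k =
    let t , t≉1 , e = ∃-inverts (ord₂ k) (ord₂-∣ k)
    in contradiction (trivial t (transfer-odd k e) (transfer-even (ord₂ k) ℓ (ℕ.≰⇒> ℓ≰k) e)) t≉1

-- K-linear maps of F and Hermite's power sum

residue-unique : ∀ {d i j c} → i ℕ.< d → j ℕ.< d → d ∣ i ℕ.+ c → d ∣ j ℕ.+ c → i ≡ j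
residue-unique {d} {i} {j} {c} i<d j<d d∣i d∣j = [_,_]′ (λ i≤j → go i≤j j<d d∣i d∣j) (λ j≤i → ≡.sym (go j≤i i<d d∣j d∣i)) (ℕ.≤-total i j)
  where
  go : ∀ {i j} → i ℕ.≤ j → j ℕ.< d → d ∣ i ℕ.+ c → d ∣ j ℕ.+ c → i ≡ j
  go {i} {j} i≤j j<d d∣i d∣j with j ∸ i in j∸i≡ | ∣m+n∣m⇒∣n {d} {i ℕ.+ c} {j ∸ i}
      (≡.subst (d ∣_) (≡.sym (≡.trans (ℕ.+-comm (i ℕ.+ c) (j ∸ i))
        (≡.trans (≡.sym (ℕ.+-assoc (j ∸ i) i c)) (≡.cong (ℕ._+ c) (ℕ.m∸n+n≡m i≤j))))) d∣j) d∣i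
  ... | 0     | _  = ℕ.≤-antisym i≤j (ℕ.m∸n≡0⇒m≤n j∸i≡)
  ... | suc e | d∣ = contradiction (∣⇒≤ d∣) (ℕ.<⇒≱ (ℕ.≤-<-trans (≡.subst (ℕ._≤ j) j∸i≡ (ℕ.m∸n≤m j i)) j<d))

-- p^k + 1 is prime to p, so the factors p can be cancelled one by one until it would have to divide
-- 1.
p^k+1∤p^ℓ : ∀ {p} → Prime p → ∀ k ℓ → .{{NonZero k}} → ¬ p ℕ.^ k ℕ.+ 1 ∣ p ℕ.^ ℓ
p^k+1∤p^ℓ {p} pr k@(suc k′) ℓ d = ℕ.<⇒≢ (ℕ.+-monoˡ-≤ 1 (ℕ.m^n>0 p {{prime⇒nonZero pr}} k)) (≡.sym (∣1⇒≡1 (go ℓ d)))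
  where
  coprime : Coprime (p ℕ.^ k ℕ.+ 1) p
  coprime (i∣q+1 , i∣p) = ∣1⇒≡1 (∣m+n∣m⇒∣n i∣q+1 (∣-trans i∣p (m∣m*n (p ℕ.^ k′))))
  go : ∀ ℓ → p ℕ.^ k ℕ.+ 1 ∣ p ℕ.^ ℓ → p ℕ.^ k ℕ.+ 1 ∣ 1
  go ℕ.zero  d = d
  go (suc ℓ) d = go ℓ (coprime-divisor coprime d)

module LinearMaps {u v} (p k ℓ : ℕ) (pr : Prime p) .{{_ : NonZero k}} .{{_ : NonZero ℓ}}
  (F : FiniteField u v ((p ℕ.^ k) ℕ.^ 2)) where

  open QuadraticField p k ℓ pr F
  open FiniteField F hiding (zero)
  open FiniteFieldProperties F
  open Algebra.Properties.Ring ring using (x∙y⁻¹≈ε⇒x≈y)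
  open Algebra.Properties.Semiring.Exp semiring hiding (_^_)
  open Algebra.Properties.CommutativeSemiring.Exp commutativeSemiring using (^-distrib-*)
  open Algebra.Properties.Semiring.Sum semiring using (*-distribˡ-sum; *-distribʳ-sum)
  open Relation.Binary.Reasoning.Setoid setoid

  N : Carrier → Carrier
  N x = x * bar x

  -- Every K-linear map of F has this form, and its determinant is `N w₁ - N w₂`. Hence
  -- `¬ N w₁ ≈ N w₂` is the condition of bijectivity throughout.
  lin : Carrier → Carrier → Carrier → Carrier
  lin w₁ w₂ x = w₁ * x + w₂ * bar x

  cross : Carrier → Carrier → Carrier
  cross x y = x * bar y - bar x * y

  -- For x and y nonzero: equality in F*/K*, where K is the fixed field of bar.
  infix 4 _∼_
  _∼_ : Carrier → Carrier → Set v
  x ∼ y = cross x y ≈ 0#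

  x-y≉0 : ∀ {x y} → ¬ x ≈ y → ¬ x - y ≈ 0#
  x-y≉0 {x} {y} x≉y e = x≉y (x∙y⁻¹≈ε⇒x≈y x y e)

  lin-cong : ∀ {w₁ w₂ x y} → x ≈ y → lin w₁ w₂ x ≈ lin w₁ w₂ y
  lin-cong e = +-cong (*-congˡ e) (*-congˡ (bar-cong e))

  cross-cong : ∀ {x x′ y y′} → x ≈ x′ → y ≈ y′ → cross x y ≈ cross x′ y′
  cross-cong e f = +-cong (*-cong e (bar-cong f)) (-‿cong (*-cong (bar-cong e) f))

  -- `cross` is an alternating K-bilinear form on the K-plane F, so a linear map multiplies it by
  -- its determinant.
  cross-lin : ∀ w₁ w₂ x y → cross (lin w₁ w₂ x) (lin w₁ w₂ y) ≈ (N w₁ - N w₂) * cross x y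
  cross-lin = solve 4 (λ w₁ w₂ x y →
    (w₁ ⊗ x ⊕ w₂ ⊗ ⋆ x) ⊗ ⋆ (w₁ ⊗ y ⊕ w₂ ⊗ ⋆ y) ⊝ ⋆ (w₁ ⊗ x ⊕ w₂ ⊗ ⋆ x) ⊗ (w₁ ⊗ y ⊕ w₂ ⊗ ⋆ y) ≣
    (w₁ ⊗ ⋆ w₁ ⊝ w₂ ⊗ ⋆ w₂) ⊗ (x ⊗ ⋆ y ⊝ ⋆ x ⊗ y)) refl

  ∼-lin : ∀ w₁ w₂ {x y} → x ∼ y → lin w₁ w₂ x ∼ lin w₁ w₂ y
  ∼-lin w₁ w₂ x∼y = trans (cross-lin w₁ w₂ _ _) (trans (*-congˡ x∼y) (zeroʳ _))

  lin-∼ : ∀ {w₁ w₂ x y} → ¬ N w₁ ≈ N w₂ → lin w₁ w₂ x ∼ lin w₁ w₂ y → x ∼ y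
  lin-∼ w≉ e = x*y≈0⇒y≈0 (x-y≉0 w≉) (trans (sym (cross-lin _ _ _ _)) e)

  -- The lines of 1 and of `θ` meet only in 0. As 0 is related to everything by `∼`, this is how
  -- injectivity up to `∼` yields that a map vanishes at 0 alone.
  ∼⇒0 : ∀ {x} → x ∼ 1# → x ∼ θ → x ≈ 0#
  ∼⇒0 {x} e f = x*y≈0⇒y≈0 (x-y≉0 barθ≉θ) (begin
    (bar θ - θ) * x             ≈⟨ solve 2 (λ x θ → (⋆ θ ⊝ θ) ⊗ x ≣
                                     (x ⊗ ⋆ θ ⊝ ⋆ x ⊗ θ) ⊝ θ ⊗ (x ⊗ ⋆ 𝟙 ⊝ ⋆ x ⊗ 𝟙)) refl x θ ⟩
    cross x θ - θ * cross x 1#  ≈⟨ +-cong f (-‿cong (trans (*-congˡ e) (zeroʳ θ))) ⟩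
    0# - 0#                     ≈⟨ -‿inverseʳ 0# ⟩
    0#                          ∎)

  0∼ : ∀ {x} y → x ≈ 0# → x ∼ y
  0∼ y x≈0 = trans (cross-cong x≈0 refl) (solve 1 (λ y → 𝟘 ⊗ ⋆ y ⊝ ⋆ 𝟘 ⊗ y ≣ 𝟘) refl y)

  lin-0 : ∀ {w₁ w₂ x} → ¬ N w₁ ≈ N w₂ → lin w₁ w₂ x ≈ 0# → x ≈ 0#
  lin-0 w≉ e = ∼⇒0 (lin-∼ w≉ (0∼ _ e)) (lin-∼ w≉ (0∼ _ e))

  lin-injective : ∀ {w₁ w₂ x y} → ¬ N w₁ ≈ N w₂ → lin w₁ w₂ x ≈ lin w₁ w₂ y → x ≈ y
  lin-injective {w₁} {w₂} {x} {y} w≉ e = x∙y⁻¹≈ε⇒x≈y x y (lin-0 w≉ (begin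
    lin w₁ w₂ (x - y)             ≈⟨ solve 4 (λ w₁ w₂ x y → w₁ ⊗ (x ⊝ y) ⊕ w₂ ⊗ ⋆ (x ⊝ y) ≣
                                       (w₁ ⊗ x ⊕ w₂ ⊗ ⋆ x) ⊝ (w₁ ⊗ y ⊕ w₂ ⊗ ⋆ y)) refl w₁ w₂ x y ⟩
    lin w₁ w₂ x - lin w₁ w₂ y     ≈⟨ +-congʳ e ⟩
    lin w₁ w₂ y - lin w₁ w₂ y     ≈⟨ -‿inverseʳ _ ⟩
    0#                            ∎))

  lin-surjective : ∀ {w₁ w₂} → ¬ N w₁ ≈ N w₂ → ∀ y → ∃[ x ] lin w₁ w₂ x ≈ y
  lin-surjective {w₁} {w₂} w≉ y =
    let i , e = injective⇒surjective {f = λ i → index (lin w₁ w₂ (elem i))}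
          (λ e → elem-injective (lin-injective w≉ (index-injective e))) (index y)
    in elem i , index-injective e

  private
    kernel-element : ∀ w₁ w₂ y → lin w₁ w₂ (w₂ * y - bar w₁ * bar y) ≈ (N w₂ - N w₁) * bar y
    kernel-element = solve 3 (λ w₁ w₂ y →
      w₁ ⊗ (w₂ ⊗ y ⊝ ⋆ w₁ ⊗ ⋆ y) ⊕ w₂ ⊗ ⋆ (w₂ ⊗ y ⊝ ⋆ w₁ ⊗ ⋆ y) ≣ (w₂ ⊗ ⋆ w₂ ⊝ w₁ ⊗ ⋆ w₁) ⊗ ⋆ y) refl

    kernel-zero : ∀ {w₁ w₂} y → N w₁ ≈ N w₂ → lin w₁ w₂ (w₂ * y - bar w₁ * bar y) ≈ 0#
    kernel-zero {w₁} {w₂} y e = trans (kernel-element w₁ w₂ y)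
      (trans (*-congʳ (trans (+-congˡ (-‿cong e)) (-‿inverseʳ _))) (zeroˡ _))

  -- The candidates are values of the adjugate map, which `lin w₁ w₂` sends to multiples of the
  -- determinant. If the adjugate kills both 1 and `θ`, then `w₁` and `w₂` are 0 and any element
  -- serves.
  lin-kernel : ∀ w₁ w₂ → N w₁ ≈ N w₂ → ∃[ x ] (¬ x ≈ 0#) × lin w₁ w₂ x ≈ 0#
  lin-kernel w₁ w₂ e with w₂ * 1# - bar w₁ * bar 1# ≟ 0# | w₂ * θ - bar w₁ * bar θ ≟ 0#
  ... | no ≉0  | _      = _ , ≉0 , kernel-zero 1# e
  ... | yes _  | no ≉0  = _ , ≉0 , kernel-zero θ e
  ... | yes e₁ | yes eθ = 1# , 1≉0 , (begin
    w₁ * 1# + w₂ * bar 1#         ≈⟨ +-cong (*-congʳ w₁≈0) (*-congʳ w₂≈0) ⟩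
    0# * 1# + 0# * bar 1#         ≈⟨ +-cong (zeroˡ _) (zeroˡ _) ⟩
    0# + 0#                       ≈⟨ +-identityˡ 0# ⟩
    0#                            ∎)
    where
    barw₁≈0 : bar w₁ ≈ 0#
    barw₁≈0 = x*y≈0⇒y≈0 (x-y≉0 barθ≉θ) (begin
      (bar θ - θ) * bar w₁        ≈⟨ solve 3 (λ w₁ w₂ θ → (⋆ θ ⊝ θ) ⊗ ⋆ w₁ ≣
                                       θ ⊗ (w₂ ⊗ 𝟙 ⊝ ⋆ w₁ ⊗ ⋆ 𝟙) ⊝ (w₂ ⊗ θ ⊝ ⋆ w₁ ⊗ ⋆ θ)) refl w₁ w₂ θ ⟩
      θ * (w₂ * 1# - bar w₁ * bar 1#) - (w₂ * θ - bar w₁ * bar θ)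
        ≈⟨ +-cong (trans (*-congˡ e₁) (zeroʳ θ)) (-‿cong eθ) ⟩
      0# - 0#                     ≈⟨ -‿inverseʳ 0# ⟩
      0#                          ∎)
    w₁≈0 : w₁ ≈ 0#
    w₁≈0 = trans (sym (bar-bar w₁)) (trans (bar-cong barw₁≈0) bar-0)
    w₂≈0 : w₂ ≈ 0#
    w₂≈0 = begin
      w₂
        ≈⟨ solve 2 (λ w₁ w₂ → w₂ ≣ (w₂ ⊗ 𝟙 ⊝ ⋆ w₁ ⊗ ⋆ 𝟙) ⊕ ⋆ w₁) refl w₁ w₂ ⟩
      (w₂ * 1# - bar w₁ * bar 1#) + bar w₁          ≈⟨ +-cong e₁ barw₁≈0 ⟩
      0# + 0#                                       ≈⟨ +-identityˡ 0# ⟩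
      0#                                            ∎

  geometric : ∀ m A B → (A - B) * Σ.sum {m} (λ i → A ^ (m ∸ suc (toℕ i)) * B ^ toℕ i) ≈ A ^ m - B ^ m
  geometric ℕ.zero  A B = trans (zeroʳ _) (sym (-‿inverseʳ 1#))
  geometric (suc m) A B = begin
    (A - B) * (A ^ m * 1# + Σ.sum {m} (λ i → A ^ (m ∸ suc (toℕ i)) * (B * B ^ toℕ i)))
      ≈⟨ *-congˡ (+-congˡ shift) ⟩
    (A - B) * (A ^ m * 1# + B * Σ.sum t)
      ≈⟨ solve 4 (λ A B a s → (A ⊝ B) ⊗ (a ⊗ 𝟙 ⊕ B ⊗ s) ≣ A ⊗ a ⊝ B ⊗ a ⊕ B ⊗ ((A ⊝ B) ⊗ s)) refl A B (A ^ m) (Σ.sum t) ⟩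
    A * A ^ m - B * A ^ m + B * ((A - B) * Σ.sum t)   ≈⟨ +-congˡ (*-congˡ (geometric m A B)) ⟩
    A * A ^ m - B * A ^ m + B * (A ^ m - B ^ m)
      ≈⟨ solve 4 (λ A B a c → A ⊗ a ⊝ B ⊗ a ⊕ B ⊗ (a ⊝ c) ≣ A ⊗ a ⊝ B ⊗ c) refl A B (A ^ m) (B ^ m) ⟩
    A * A ^ m - B * B ^ m                             ∎
    where
    t : Fin m → Carrier
    t i = A ^ (m ∸ suc (toℕ i)) * B ^ toℕ i
    shift : Σ.sum {m} (λ i → A ^ (m ∸ suc (toℕ i)) * (B * B ^ toℕ i)) ≈ B * Σ.sum t
    shift = trans
      (Σ.sum-cong-≋ {m} (λ i → solve 3 (λ a c d → a ⊗ (c ⊗ d) ≣ c ⊗ (a ⊗ d)) refl (A ^ (m ∸ suc (toℕ i))) B (B ^ toℕ i)))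
      (sym (*-distribˡ-sum B t))

  -- Expanding (g₁ s + g₂ s̄)^(q−1) = (A^q − B^q) / (A − B) with A = g₁ s and B = − g₂ s̄
  -- writes the sum over s as a combination of power sums, of which just one is
  -- nonzero.
  module Hermite (g₁ g₂ : Carrier) (g-0 : ∀ s → lin g₁ g₂ s ≈ 0# → s ≈ 0#) where
    κ : Fin q → Carrier
    κ i = g₁ ^ (q ∸ suc (toℕ i)) * (- g₂) ^ toℕ i

    -- The exponent of s in the i-th term: q - 1 - i from A, q i from B and Q (q - 1) from φ s. In
    -- this factored form, divisibility by q² - 1 becomes divisibility of i + 1 + Q by q + 1.
    ε : Fin q → ℕ
    ε i = (q ∸ 1) ℕ.* (suc (toℕ i) ℕ.+ Q)

    ε-correct : ∀ (i : Fin q) → (q ∸ suc (toℕ i)) ℕ.+ q ℕ.* toℕ i ℕ.+ Q ℕ.* (q ∸ 1) ≡ ε i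
    ε-correct i = ≡.trans (≡.cong (λ j → (q ∸ suc (toℕ i)) ℕ.+ j ℕ.* toℕ i ℕ.+ Q ℕ.* (q ∸ 1)) (≡.sym suc-pred-q))
      (≡.trans (rearrange (q ∸ suc (toℕ i)) (toℕ i) Q (q ∸ 1)) (≡.trans (≡.cong (λ j → j ℕ.+ (toℕ i ℕ.+ Q) ℕ.* (q ∸ 1)) split)
        (ℕ.*-comm (suc (toℕ i) ℕ.+ Q) (q ∸ 1))))
      where
      rearrange : ∀ r i Q j → r ℕ.+ suc j ℕ.* i ℕ.+ Q ℕ.* j ≡ (r ℕ.+ i) ℕ.+ (i ℕ.+ Q) ℕ.* j
      rearrange = S.solve 4 (λ r i Q j → r S.:+ (S.con 1 S.:+ j) S.:* i S.:+ Q S.:* j S.:=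
                                        (r S.:+ i) S.:+ (i S.:+ Q) S.:* j) ≡.refl
        where module S = ℕSolver.+-*-Solver
      split : (q ∸ suc (toℕ i)) ℕ.+ toℕ i ≡ q ∸ 1
      split = ≡.trans (≡.cong (ℕ._+ toℕ i) (≡.sym (ℕ.∸-+-assoc q 1 (toℕ i))))
        (ℕ.m∸n+n≡m (ℕ.<⇒≤pred (Fin.toℕ<n i)))

    instance
      ε-nonZero : ∀ {i} → NonZero (ε i)
      ε-nonZero {i} = ℕ.m*n≢0 (q ∸ 1) (suc (toℕ i) ℕ.+ Q)

    expand : ∀ s → (lin g₁ g₂ s * φ s) ^ (q ∸ 1) ≈ Σ.sum (λ i → κ i * s ^ ε i)
    expand s with s ≟ 0#
    -- The quotient formula divides by g₁ s + g₂ s̄, so s = 0 is treated apart; there both sides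
    -- vanish because no exponent is 0.
    ... | yes s≈0 = begin
      (lin g₁ g₂ s * φ s) ^ (q ∸ 1)   ≈⟨ ^-congˡ (q ∸ 1) (trans (*-congˡ (trans (φ-cong s≈0) φ-0)) (zeroʳ _)) ⟩
      0# ^ (q ∸ 1)                    ≈⟨ 0^ (q ∸ 1) ⟩
      0#                              ≈⟨ Σ.sum-replicate-zero q ⟨
      Σ.sum {q} (λ _ → 0#)
        ≈⟨ Σ.sum-cong-≋ (λ i → trans (*-congˡ (trans (^-congˡ (ε i) s≈0) (0^ (ε i)))) (zeroʳ _)) ⟨
      Σ.sum (λ i → κ i * s ^ ε i)     ∎
    ... | no s≉0 = begin
      (lin g₁ g₂ s * φ s) ^ (q ∸ 1)             ≈⟨ ^-distrib-* _ _ (q ∸ 1) ⟩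
      lin g₁ g₂ s ^ (q ∸ 1) * φ s ^ (q ∸ 1)     ≈⟨ *-cong power (^-assocʳ s Q (q ∸ 1)) ⟩
      Σ.sum t * s ^ (Q ℕ.* (q ∸ 1))             ≈⟨ *-distribʳ-sum (s ^ (Q ℕ.* (q ∸ 1))) t ⟩
      Σ.sum (λ i → t i * s ^ (Q ℕ.* (q ∸ 1)))   ≈⟨ Σ.sum-cong-≋ term ⟩
      Σ.sum (λ i → κ i * s ^ ε i)               ∎
      where
      A B : Carrier
      A = g₁ * s
      B = - g₂ * bar s
      t : Fin q → Carrier
      t i = A ^ (q ∸ suc (toℕ i)) * B ^ toℕ i
      lin≈ : lin g₁ g₂ s ≈ A - B
      lin≈ = solve 3 (λ g₁ g₂ s → g₁ ⊗ s ⊕ g₂ ⊗ ⋆ s ≣ g₁ ⊗ s ⊝ ((⊝ g₂) ⊗ ⋆ s)) refl g₁ g₂ s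
      power : lin g₁ g₂ s ^ (q ∸ 1) ≈ Σ.sum t
      power = *-cancelˡ (λ e → s≉0 (g-0 s e)) (begin
        lin g₁ g₂ s * lin g₁ g₂ s ^ (q ∸ 1)   ≈⟨ ^-congʳ (lin g₁ g₂ s) suc-pred-q ⟩
        bar (lin g₁ g₂ s)                     ≈⟨ bar-cong lin≈ ⟩
        bar (A - B)                           ≈⟨ trans (bar-+ A (- B)) (+-congˡ (bar-neg B)) ⟩
        A ^ q - B ^ q                         ≈⟨ geometric q A B ⟨
        (A - B) * Σ.sum t                     ≈⟨ *-congʳ lin≈ ⟨
        lin g₁ g₂ s * Σ.sum t                 ∎)
      term : ∀ i → t i * s ^ (Q ℕ.* (q ∸ 1)) ≈ κ i * s ^ ε i
      term i = begin
        A ^ (q ∸ suc (toℕ i)) * B ^ toℕ i * s ^ (Q ℕ.* (q ∸ 1))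
          ≈⟨ *-congʳ (*-cong (^-distrib-* g₁ s (q ∸ suc (toℕ i)))
               (trans (^-distrib-* (- g₂) (bar s) (toℕ i)) (*-congˡ (^-assocʳ s q (toℕ i))))) ⟩
        (g₁ ^ (q ∸ suc (toℕ i)) * s ^ (q ∸ suc (toℕ i))) * ((- g₂) ^ toℕ i * s ^ (q ℕ.* toℕ i)) * s ^ (Q ℕ.* (q ∸ 1))
          ≈⟨ solve 5 (λ a x b y z → (a ⊗ x) ⊗ (b ⊗ y) ⊗ z ≣ a ⊗ b ⊗ (x ⊗ y ⊗ z)) refl _ _ _ _ _ ⟩
        κ i * (s ^ (q ∸ suc (toℕ i)) * s ^ (q ℕ.* toℕ i) * s ^ (Q ℕ.* (q ∸ 1)))
          ≈⟨ *-congˡ (trans (^-homo-* s (q ∸ suc (toℕ i) ℕ.+ q ℕ.* toℕ i) (Q ℕ.* (q ∸ 1)))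
               (*-congʳ (^-homo-* s (q ∸ suc (toℕ i)) (q ℕ.* toℕ i)))) ⟨
        κ i * s ^ (q ∸ suc (toℕ i) ℕ.+ q ℕ.* toℕ i ℕ.+ Q ℕ.* (q ∸ 1))
          ≡⟨ ≡.cong (λ j → κ i * s ^ j) (ε-correct i) ⟩
        κ i * s ^ ε i   ∎

    -- The unique i < q with q + 1 ∣ i + 1 + Q.
    r : ℕ
    r = Q % suc q

    r≤q : r ℕ.≤ q
    r≤q = ℕ.s≤s⁻¹ (m%n<n Q (suc q))

    -- For `r` = 0 the required residue class would be i = q, just outside the range of summation.
    r>0 : 0 ℕ.< r
    r>0 = ℕ.n≢0⇒n>0 λ r≡0 → p^k+1∤p^ℓ pr k ℓ (≡.subst (_∣ Q) (ℕ.+-comm 1 q) (m%n≡0⇒n∣m Q (suc q) r≡0))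

    q∸r<q : q ∸ r ℕ.< q
    q∸r<q = ℕ.∸-monoʳ-< r>0 r≤q

    i₀ : Fin q
    i₀ = Fin.fromℕ< q∸r<q

    ∣i₀ : q ℕ.+ 1 ∣ suc (toℕ i₀) ℕ.+ Q
    ∣i₀ = ≡.subst₂ _∣_ (ℕ.+-comm 1 q) (≡.sym (≡.trans (≡.cong (λ j → suc j ℕ.+ Q) (Fin.toℕ-fromℕ< q∸r<q)) (≡.trans
      (≡.cong (suc (q ∸ r) ℕ.+_) (m≡m%n+[m/n]*n Q (suc q)))
      (≡.trans (≡.sym (ℕ.+-assoc (suc (q ∸ r)) r _)) (≡.cong (λ j → suc j ℕ.+ Q ℕ./ suc q ℕ.* suc q) (ℕ.m∸n+n≡m r≤q))))))
      (n∣m*n (suc (Q ℕ./ suc q)))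

    ∣⇒∣ε : ∀ i → q ℕ.+ 1 ∣ suc (toℕ i) ℕ.+ Q → n ∸ 1 ∣ ε i
    ∣⇒∣ε i d = ≡.subst (_∣ ε i) (≡.sym n-1≡) (*-monoʳ-∣ (q ∸ 1) d)

    ∣ε⇒∣ : ∀ i → n ∸ 1 ∣ ε i → q ℕ.+ 1 ∣ suc (toℕ i) ℕ.+ Q
    ∣ε⇒∣ i d = *-cancelˡ-∣ (q ∸ 1) (≡.subst (_∣ ε i) n-1≡ d)

    ∣ε⇒≡i₀ : ∀ i → n ∸ 1 ∣ ε i → i ≡ i₀
    ∣ε⇒≡i₀ i d = Fin.toℕ-injective (ℕ.suc-injective (residue-unique (bound i) (bound i₀) (∣ε⇒∣ i d) ∣i₀))
      where
      bound : ∀ (i : Fin q) → suc (toℕ i) ℕ.< q ℕ.+ 1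
      bound i = ≡.subst (suc (toℕ i) ℕ.<_) (ℕ.+-comm 1 q) (s≤s (Fin.toℕ<n i))

    sum≈ : Σ.fold (λ s → (lin g₁ g₂ s * φ s) ^ (q ∸ 1)) ≈ κ i₀ * powerSum (ε i₀)
    sum≈ = begin
      Σ.fold (λ s → (lin g₁ g₂ s * φ s) ^ (q ∸ 1))        ≈⟨ Σ.fold-cong expand ⟩
      Σ.fold (λ s → Σ.sum (λ i → κ i * s ^ ε i))          ≈⟨ Σ.∑-comm (λ j i → κ i * elem j ^ ε i) ⟩
      Σ.sum (λ i → Σ.fold (λ s → κ i * s ^ ε i))
        ≈⟨ Σ.sum-cong-≋ (λ i → *-distribˡ-sum (κ i) (λ j → elem j ^ ε i)) ⟨
      Σ.sum (λ i → κ i * powerSum (ε i))                  ≈⟨ Σ.sum-single (λ i → κ i * powerSum (ε i)) i₀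
                                                              (λ i i≢i₀ → trans (*-congˡ (powerSum-∤ (ε i) (i≢i₀ ∘ ∣ε⇒≡i₀ i))) (zeroʳ _)) ⟩
      κ i₀ * powerSum (ε i₀)                              ∎

    hermite : Σ.fold (λ s → (lin g₁ g₂ s * φ s) ^ (q ∸ 1)) ≈ 0# → g₁ ≈ 0# ⊎ g₂ ≈ 0#
    hermite e with g₁ ≟ 0# | g₂ ≟ 0#
    ... | yes g₁≈0 | _        = inj₁ g₁≈0
    ... | no _     | yes g₂≈0 = inj₂ g₂≈0
    ... | no g₁≉0  | no g₂≉0  = contradiction (trans (sym sum≈) e) (*-nonzero
      (*-nonzero (^-nonzero (q ∸ suc (toℕ i₀)) g₁≉0) (^-nonzero (toℕ i₀) -g₂≉0))
      (powerSum-∣ (ε i₀) (∣⇒∣ε i₀ ∣i₀)))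
      where
      -g₂≉0 : ¬ - g₂ ≈ 0#
      -g₂≉0 z = g₂≉0 (trans (solve 1 (λ g → g ≣ ⊝ (⊝ g)) refl g₂) (trans (-‿cong z) (solve 0 (⊝ 𝟘 ≣ 𝟘) refl)))

-- The bilinear form behind f and the three shapes of its twists

module Form {u v} (p k ℓ : ℕ) (pr : Prime p) .{{_ : NonZero k}} .{{_ : NonZero ℓ}}
  (F : FiniteField u v ((p ℕ.^ k) ℕ.^ 2)) (a b c d : FiniteField.Carrier F) where

  open FiniteField F hiding (zero)
  open QuadraticField p k ℓ pr F
  open FiniteFieldProperties F
  open LinearMaps p k ℓ pr F
  open Algebra.Properties.Ring ring using (x∙y⁻¹≈ε⇒x≈y)
  open Algebra.Properties.Semiring.Exp semiring hiding (_^_)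
  open Relation.Binary.Reasoning.Setoid setoid

  f : Carrier → Carrier
  f x = a * (bar x * bar (φ x)) + b * (x * bar (φ x)) + c * (bar x * φ x) + d * (x * φ x)

  f-0 : ∀ {x} → x ≈ 0# → f x ≈ 0#
  f-0 {x} x≈0 = begin
    f x   ≈⟨ +-cong (+-cong (+-cong (*-congˡ (*-congʳ (bar-cong x≈0))) (*-congˡ (*-congʳ x≈0)))
               (*-congˡ (*-congʳ (bar-cong x≈0)))) (*-congˡ (*-congʳ x≈0)) ⟩
    a * (bar 0# * bar (φ x)) + b * (0# * bar (φ x)) + c * (bar 0# * φ x) + d * (0# * φ x)
          ≈⟨ solve 5 (λ a b c d X → a ⊗ (⋆ 𝟘 ⊗ ⋆ X) ⊕ b ⊗ (𝟘 ⊗ ⋆ X) ⊕ c ⊗ (⋆ 𝟘 ⊗ X) ⊕ d ⊗ (𝟘 ⊗ X) ≣ 𝟘) refl a b c d (φ x) ⟩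
    0#    ∎

  -- f + z f̄ as the product of the linear forms u₁ x + u₂ x̄ and v₁ φ x + v₂ φ x̄.
  record Factor (z u₁ u₂ v₁ v₂ : Carrier) : Set v where
    constructor factor
    field
      m₁₁ : d + z * bar a ≈ u₁ * v₁
      m₁₂ : b + z * bar c ≈ u₁ * v₂
      m₂₁ : c + z * bar b ≈ u₂ * v₁
      m₂₂ : a + z * bar d ≈ u₂ * v₂

  twist : ∀ z x → lin 1# z (f x) ≈ (d + z * bar a) * (x * φ x) + (b + z * bar c) * (x * bar (φ x))
    + (c + z * bar b) * (bar x * φ x) + (a + z * bar d) * (bar x * bar (φ x))
  twist z x = solve 7 (λ a b c d z x X →
    let f = a ⊗ (⋆ x ⊗ ⋆ X) ⊕ b ⊗ (x ⊗ ⋆ X) ⊕ c ⊗ (⋆ x ⊗ X) ⊕ d ⊗ (x ⊗ X) in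
    𝟙 ⊗ f ⊕ z ⊗ ⋆ f ≣ (d ⊕ z ⊗ ⋆ a) ⊗ (x ⊗ X) ⊕ (b ⊕ z ⊗ ⋆ c) ⊗ (x ⊗ ⋆ X)
      ⊕ (c ⊕ z ⊗ ⋆ b) ⊗ (⋆ x ⊗ X) ⊕ (a ⊕ z ⊗ ⋆ d) ⊗ (⋆ x ⊗ ⋆ X)) refl a b c d z x (φ x)

  factor-f : ∀ {z u₁ u₂ v₁ v₂} → Factor z u₁ u₂ v₁ v₂ → ∀ x → lin 1# z (f x) ≈ lin u₁ u₂ x * lin v₁ v₂ (φ x)
  factor-f {z} {u₁} {u₂} {v₁} {v₂} (factor m₁₁ m₁₂ m₂₁ m₂₂) x = trans (twist z x) (begin
    (d + z * bar a) * (x * φ x) + (b + z * bar c) * (x * bar (φ x))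
      + (c + z * bar b) * (bar x * φ x) + (a + z * bar d) * (bar x * bar (φ x))
      ≈⟨ +-cong (+-cong (+-cong (*-congʳ m₁₁) (*-congʳ m₁₂)) (*-congʳ m₂₁)) (*-congʳ m₂₂) ⟩
    u₁ * v₁ * (x * φ x) + u₁ * v₂ * (x * bar (φ x)) + u₂ * v₁ * (bar x * φ x) + u₂ * v₂ * (bar x * bar (φ x))
      ≈⟨ solve 6 (λ u₁ u₂ v₁ v₂ x X → u₁ ⊗ v₁ ⊗ (x ⊗ X) ⊕ u₁ ⊗ v₂ ⊗ (x ⊗ ⋆ X) ⊕ u₂ ⊗ v₁ ⊗ (⋆ x ⊗ X) ⊕ u₂ ⊗ v₂ ⊗ (⋆ x ⊗ ⋆ X) ≣
           (u₁ ⊗ x ⊕ u₂ ⊗ ⋆ x) ⊗ (v₁ ⊗ X ⊕ v₂ ⊗ ⋆ X)) refl u₁ u₂ v₁ v₂ x (φ x) ⟩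
    lin u₁ u₂ x * lin v₁ v₂ (φ x) ∎)

  φ-lin : ∀ w₁ w₂ x → φ (lin w₁ w₂ x) ≈ lin (φ w₁) (φ w₂) (φ x)
  φ-lin w₁ w₂ x = trans (φ-+ _ _) (+-cong (φ-* w₁ x) (trans (φ-* w₂ (bar x)) (*-congˡ (φ-bar x))))

  factor-φ : ∀ {z u₁ u₂ w₁ w₂} → Factor z u₁ u₂ (φ w₁) (φ w₂) → ∀ x → lin 1# z (f x) ≈ lin u₁ u₂ x * φ (lin w₁ w₂ x)
  factor-φ {w₁ = w₁} {w₂} fac x = trans (factor-f fac x) (*-congˡ (sym (φ-lin w₁ w₂ x)))

  RankOne : (m₁₁ m₁₂ m₂₁ m₂₂ : Carrier) → Set (u ⊔ v)
  RankOne m₁₁ m₁₂ m₂₁ m₂₂ = ∃[ u₁ ] ∃[ u₂ ] ∃[ v₁ ] ∃[ v₂ ]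
    (m₁₁ ≈ u₁ * v₁) × (m₁₂ ≈ u₁ * v₂) × (m₂₁ ≈ u₂ * v₁) × (m₂₂ ≈ u₂ * v₂)

  -- If `m₁₁` is nonzero, the matrix is its first column times its first row, divided by `m₁₁`.
  -- Otherwise the determinant kills `m₁₂` or `m₂₁`, and with it the first row or the first column.
  rank-one : ∀ m₁₁ m₁₂ m₂₁ m₂₂ → m₁₁ * m₂₂ - m₁₂ * m₂₁ ≈ 0# → RankOne m₁₁ m₁₂ m₂₁ m₂₂
  rank-one m₁₁ m₁₂ m₂₁ m₂₂ e = cases (m₁₁ ≟ 0#)
    where
    first-row-zero : m₁₁ ≈ 0# → m₁₂ ≈ 0# → RankOne m₁₁ m₁₂ m₂₁ m₂₂
    first-row-zero m₁₁≈0 m₁₂≈0 = 0# , 1# , m₂₁ , m₂₂ ,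
      trans m₁₁≈0 (sym (zeroˡ _)) , trans m₁₂≈0 (sym (zeroˡ _)) , sym (*-identityˡ _) , sym (*-identityˡ _)
    first-column-zero : m₁₁ ≈ 0# → m₂₁ ≈ 0# → RankOne m₁₁ m₁₂ m₂₁ m₂₂
    first-column-zero m₁₁≈0 m₂₁≈0 = m₁₂ , m₂₂ , 0# , 1# ,
      trans m₁₁≈0 (sym (zeroʳ _)) , sym (*-identityʳ _) , trans m₂₁≈0 (sym (zeroʳ _)) , sym (*-identityʳ _)
    m₁₂m₂₁≈0 : m₁₁ ≈ 0# → m₁₂ * m₂₁ ≈ 0#
    m₁₂m₂₁≈0 m₁₁≈0 = begin
      m₁₂ * m₂₁                           ≈⟨ solve 3 (λ x y z → x ⊗ y ≣ 𝟘 ⊗ z ⊝ (𝟘 ⊗ z ⊝ x ⊗ y)) refl m₁₂ m₂₁ m₂₂ ⟩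
      0# * m₂₂ - (0# * m₂₂ - m₁₂ * m₂₁)   ≈⟨ +-cong (zeroˡ _) (-‿cong (+-congʳ (*-congʳ (sym m₁₁≈0)))) ⟩
      0# - (m₁₁ * m₂₂ - m₁₂ * m₂₁)        ≈⟨ +-congˡ (-‿cong e) ⟩
      0# - 0#                             ≈⟨ -‿inverseʳ 0# ⟩
      0#                                  ∎
    cases : Dec (m₁₁ ≈ 0#) → RankOne m₁₁ m₁₂ m₂₁ m₂₂
    cases (yes m₁₁≈0) = [ first-row-zero m₁₁≈0 , first-column-zero m₁₁≈0 ]′ (integral m₁₂ m₂₁ (m₁₂m₂₁≈0 m₁₁≈0))
    cases (no m₁₁≉0)  = m₁₁ , m₂₁ , 1# , i * m₁₂ ,
      sym (*-identityʳ _) ,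
      sym (trans (sym (*-assoc _ _ _)) (trans (*-congʳ mi≈1) (*-identityˡ _))) ,
      sym (*-identityʳ _) ,
      *-cancelˡ m₁₁≉0 (begin
        m₁₁ * m₂₂               ≈⟨ x∙y⁻¹≈ε⇒x≈y _ _ e ⟩
        m₁₂ * m₂₁               ≈⟨ *-identityˡ _ ⟨
        1# * (m₁₂ * m₂₁)        ≈⟨ *-congʳ mi≈1 ⟨
        m₁₁ * i * (m₁₂ * m₂₁)   ≈⟨ solve 4 (λ m i x y → m ⊗ i ⊗ (x ⊗ y) ≣ m ⊗ (y ⊗ (i ⊗ x))) refl m₁₁ i m₁₂ m₂₁ ⟩
        m₁₁ * (m₂₁ * (i * m₁₂)) ∎)
      where
      i = m₁₁ ⁻¹
      mi≈1 = *-inverseʳ m₁₁≉0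

  -- The coefficients of `det`: the outer ones are conjugate to each other and `E` lies in K, so
  -- that nonzero roots come in pairs z, 1/z̄.
  Δ E : Carrier
  Δ = a * d - b * c
  E = N a + N d - N b - N c

  -- The determinant of f + z f̄ as a bilinear form in (x , x̄) and (φ x , φ x̄).
  det : Carrier → Carrier
  det z = (d + z * bar a) * (a + z * bar d) - (b + z * bar c) * (c + z * bar b)

  det≈ : ∀ z → det z ≈ bar Δ * (z * z) + E * z + Δ
  det≈ z = solve 5 (λ a b c d z →
    (d ⊕ z ⊗ ⋆ a) ⊗ (a ⊕ z ⊗ ⋆ d) ⊝ (b ⊕ z ⊗ ⋆ c) ⊗ (c ⊕ z ⊗ ⋆ b) ≣
    ⋆ (a ⊗ d ⊝ b ⊗ c) ⊗ (z ⊗ z) ⊕ (a ⊗ ⋆ a ⊕ d ⊗ ⋆ d ⊝ b ⊗ ⋆ b ⊝ c ⊗ ⋆ c) ⊗ z ⊕ (a ⊗ d ⊝ b ⊗ c)) refl a b c d z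

  root-factor : ∀ {z} → det z ≈ 0# → ∃[ u₁ ] ∃[ u₂ ] ∃[ v₁ ] ∃[ v₂ ] Factor z u₁ u₂ v₁ v₂
  root-factor {z} r = let u₁ , u₂ , v₁ , v₂ , e₁₁ , e₁₂ , e₂₁ , e₂₂ = rank-one _ _ _ _ r
    in u₁ , u₂ , v₁ , v₂ , factor e₁₁ e₁₂ e₂₁ e₂₂

  root-0 : Δ ≈ 0# → det 0# ≈ 0#
  root-0 Δ≈0 = begin
    det 0#                                  ≈⟨ det≈ 0# ⟩
    bar Δ * (0# * 0#) + E * 0# + Δ          ≈⟨ solve 3 (λ D E Δ → D ⊗ (𝟘 ⊗ 𝟘) ⊕ E ⊗ 𝟘 ⊕ Δ ≣ Δ) refl (bar Δ) E Δ ⟩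
    Δ                                       ≈⟨ Δ≈0 ⟩
    0#                                      ∎

  -- The substitution z = κ / Δ̄ turns `det` into κ² + E κ + N Δ up to the factor Δ̄, and this
  -- quadratic has its coefficients in K.
  ∃-root : ¬ Δ ≈ 0# → ∃[ z ] det z ≈ 0#
  ∃-root Δ≉0 = i * κ , trans (det≈ (i * κ)) (x*y≈0⇒y≈0 barΔ≉0 (begin
    D * (D * (i * κ * (i * κ)) + E * (i * κ) + Δ)
      ≈⟨ solve 5 (λ D E Δ i κ → D ⊗ (D ⊗ (i ⊗ κ ⊗ (i ⊗ κ)) ⊕ E ⊗ (i ⊗ κ) ⊕ Δ) ≣
           (D ⊗ i ⊗ κ) ⊗ (D ⊗ i ⊗ κ) ⊕ E ⊗ (D ⊗ i ⊗ κ) ⊕ Δ ⊗ D) refl D E Δ i κ ⟩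
    (D * i * κ) * (D * i * κ) + E * (D * i * κ) + Δ * D
      ≈⟨ +-congʳ (+-cong (*-cong Diκ≈κ Diκ≈κ) (*-congˡ Diκ≈κ)) ⟩
    κ * κ + E * κ + N Δ     ≈⟨ κ-root ⟩
    0#                      ∎))
    where
    D i : Carrier
    D = bar Δ
    i = D ⁻¹
    barΔ≉0 = bar-nonzero Δ≉0
    κ-spec = quadratic-root E (N Δ)
      (solve 4 (λ a b c d → ⋆ (a ⊗ ⋆ a ⊕ d ⊗ ⋆ d ⊝ b ⊗ ⋆ b ⊝ c ⊗ ⋆ c) ≣
        a ⊗ ⋆ a ⊕ d ⊗ ⋆ d ⊝ b ⊗ ⋆ b ⊝ c ⊗ ⋆ c) refl a b c d)
      (solve 1 (λ x → ⋆ (x ⊗ ⋆ x) ≣ x ⊗ ⋆ x) refl Δ)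
    κ = proj₁ κ-spec
    κ-root = proj₂ κ-spec
    Diκ≈κ : D * i * κ ≈ κ
    Diκ≈κ = trans (*-congʳ (*-inverseʳ barΔ≉0)) (*-identityˡ κ)

  -- The equation s = - z s̄ prescribes the ratio of s to its conjugate, so its solutions lie on one
  -- K-line.
  twins : ∀ {z s s′} → lin 1# z s ≈ 0# → lin 1# z s′ ≈ 0# → s ∼ s′
  twins {z} {s} {s′} e e′ = begin
    s * bar s′ - bar s * s′
      ≈⟨ solve 3 (λ z s t → s ⊗ ⋆ t ⊝ ⋆ s ⊗ t ≣ (𝟙 ⊗ s ⊕ z ⊗ ⋆ s) ⊗ ⋆ t ⊝ ⋆ s ⊗ (𝟙 ⊗ t ⊕ z ⊗ ⋆ t)) refl z s s′ ⟩
    lin 1# z s * bar s′ - bar s * lin 1# z s′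
      ≈⟨ +-cong (trans (*-congʳ e) (zeroˡ _)) (-‿cong (trans (*-congˡ e′) (zeroʳ _))) ⟩
    0# - 0#                                     ≈⟨ -‿inverseʳ 0# ⟩
    0#                                          ∎

  -- `f` itself need not permute F; it only inherits injectivity on lines. `f-sum` is the trace that
  -- the permutation polynomial leaves on `f` through Hermite's criterion, and it drives the case of
  -- norm different from 1.
  module Classification
    (f-∼ : ∀ x y → f x ∼ f y → x ∼ y)
    (f-sum : ∀ z → ¬ N 1# ≈ N z → Σ.fold (λ x → lin 1# z (f x) ^ (q ∸ 1)) ≈ 0#) where

    f-zero : ∀ {x} → f x ≈ 0# → x ≈ 0#
    f-zero {x} e = ∼⇒0 (f-∼ x 1# (0∼ _ e)) (f-∼ x θ (0∼ _ e))

    module Nonsplit {z} (z-norm : ¬ N 1# ≈ N z) {u₁ u₂ w₁ w₂} (fac : Factor z u₁ u₂ (φ w₁) (φ w₂)) where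
      zero-f : ∀ {x} → lin u₁ u₂ x * φ (lin w₁ w₂ x) ≈ 0# → x ≈ 0#
      zero-f {x} e = f-zero (lin-0 z-norm (trans (factor-φ fac x) e))

      w-norm : ¬ N w₁ ≈ N w₂
      w-norm e = let x , x≉0 , wx≈0 = lin-kernel w₁ w₂ e in
        x≉0 (zero-f (trans (*-congˡ (trans (φ-cong wx≈0) φ-0)) (zeroʳ _)))

      -- The coefficients of the composite of u with the inverse of w, which is `i` times
      -- `lin (bar w₁) (- w₂)`.
      i g₁ g₂ : Carrier
      i = (N w₁ - N w₂) ⁻¹
      g₁ = i * (u₁ * bar w₁ - u₂ * bar w₂)
      g₂ = i * (w₁ * u₂ - w₂ * u₁)

      private
        Wi≈1 : (N w₁ - N w₂) * i ≈ 1#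
        Wi≈1 = *-inverseʳ (x-y≉0 w-norm)

        unit : ∀ x → (N w₁ - N w₂) * i * x ≈ x
        unit x = trans (*-congʳ Wi≈1) (*-identityˡ x)

      u₁≈ : u₁ ≈ g₁ * w₁ + g₂ * bar w₂
      u₁≈ = sym (trans (solve 5 (λ u₁ u₂ w₁ w₂ i →
        i ⊗ (u₁ ⊗ ⋆ w₁ ⊝ u₂ ⊗ ⋆ w₂) ⊗ w₁ ⊕ i ⊗ (w₁ ⊗ u₂ ⊝ w₂ ⊗ u₁) ⊗ ⋆ w₂ ≣
        (w₁ ⊗ ⋆ w₁ ⊝ w₂ ⊗ ⋆ w₂) ⊗ i ⊗ u₁) refl u₁ u₂ w₁ w₂ i) (unit u₁))

      u₂≈ : u₂ ≈ g₁ * w₂ + g₂ * bar w₁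
      u₂≈ = sym (trans (solve 5 (λ u₁ u₂ w₁ w₂ i →
        i ⊗ (u₁ ⊗ ⋆ w₁ ⊝ u₂ ⊗ ⋆ w₂) ⊗ w₂ ⊕ i ⊗ (w₁ ⊗ u₂ ⊝ w₂ ⊗ u₁) ⊗ ⋆ w₁ ≣
        (w₁ ⊗ ⋆ w₁ ⊝ w₂ ⊗ ⋆ w₂) ⊗ i ⊗ u₂) refl u₁ u₂ w₁ w₂ i) (unit u₂))

      lin-u : ∀ x → lin u₁ u₂ x ≈ lin g₁ g₂ (lin w₁ w₂ x)
      lin-u x = trans (+-cong (*-congʳ u₁≈) (*-congʳ u₂≈)) (solve 5 (λ g₁ g₂ w₁ w₂ x →
        (g₁ ⊗ w₁ ⊕ g₂ ⊗ ⋆ w₂) ⊗ x ⊕ (g₁ ⊗ w₂ ⊕ g₂ ⊗ ⋆ w₁) ⊗ ⋆ x ≣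
        g₁ ⊗ (w₁ ⊗ x ⊕ w₂ ⊗ ⋆ x) ⊕ g₂ ⊗ ⋆ (w₁ ⊗ x ⊕ w₂ ⊗ ⋆ x)) refl g₁ g₂ w₁ w₂ x)

      g-0 : ∀ s → lin g₁ g₂ s ≈ 0# → s ≈ 0#
      g-0 s e = let x , wx≈s = lin-surjective w-norm s in
        trans (sym wx≈s) (trans (lin-cong (zero-f (trans (*-congʳ (trans (lin-u x) (trans (lin-cong wx≈s) e))) (zeroˡ _))))
          (trans (+-cong (zeroʳ _) (trans (*-congˡ bar-0) (zeroʳ _))) (+-identityˡ 0#)))

      -- Since w is a bijection, s = w(x) may serve as the variable of summation; this turns `f-sum`
      -- into the hypothesis of `hermite`.
      g-split : g₁ ≈ 0# ⊎ g₂ ≈ 0#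
      g-split = Hermite.hermite g₁ g₂ g-0 (begin
        Σ.fold ψ                                    ≈⟨ Σ.fold-reindex ψ (lin w₁ w₂) ψ-cong (lin-injective w-norm) ⟨
        Σ.fold (λ x → ψ (lin w₁ w₂ x))
          ≈⟨ Σ.fold-cong (λ x → ^-congˡ (q ∸ 1) (trans (factor-φ fac x) (*-congʳ (lin-u x)))) ⟨
        Σ.fold (λ x → lin 1# z (f x) ^ (q ∸ 1))     ≈⟨ f-sum z z-norm ⟩
        0#                                          ∎)
        where
        ψ : Carrier → Carrier
        ψ s = (lin g₁ g₂ s * φ s) ^ (q ∸ 1)
        ψ-cong : ∀ {s t} → s ≈ t → ψ s ≈ ψ t
        ψ-cong e = ^-congˡ (q ∸ 1) (*-cong (lin-cong e) (φ-cong e))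

    -- f + z f̄ is g w φ(w) in shape A and g w̄ φ(w) in shape B, where w = w₁ x + w₂ x̄; in
    -- shape C it is m (x + ρ x̄) φ(x + ρ x̄) for two different z of norm 1.
    record ShapeA : Set (u ⊔ v) where
      field
        {z g w₁ w₂} : Carrier
        z-norm : ¬ N 1# ≈ N z
        w-norm : ¬ N w₁ ≈ N w₂
        fac    : Factor z (g * w₁) (g * w₂) (φ w₁) (φ w₂)

    record ShapeB : Set (u ⊔ v) where
      field
        {z g w₁ w₂} : Carrier
        z-norm : ¬ N 1# ≈ N z
        w-norm : ¬ N w₁ ≈ N w₂
        fac    : Factor z (g * bar w₂) (g * bar w₁) (φ w₁) (φ w₂)

    factor-cong : ∀ {z u₁ u₂ u₁′ u₂′ v₁ v₂} → Factor z u₁ u₂ v₁ v₂ → u₁ ≈ u₁′ → u₂ ≈ u₂′ → Factor z u₁′ u₂′ v₁ v₂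
    factor-cong (factor m₁₁ m₁₂ m₂₁ m₂₂) e₁ e₂ = factor
      (trans m₁₁ (*-congʳ e₁)) (trans m₁₂ (*-congʳ e₁)) (trans m₂₁ (*-congʳ e₂)) (trans m₂₂ (*-congʳ e₂))

    nonsplit : ∀ {z} → ¬ N 1# ≈ N z → det z ≈ 0# → ShapeA ⊎ ShapeB
    nonsplit {z} z-norm r =
      let u₁ , u₂ , v₁ , v₂ , factor e₁₁ e₁₂ e₂₁ e₂₂ = root-factor r
          w₁ , φw₁ = φ-surjective v₁
          w₂ , φw₂ = φ-surjective v₂
          fac = factor (trans e₁₁ (*-congˡ (sym φw₁))) (trans e₁₂ (*-congˡ (sym φw₂)))
                       (trans e₂₁ (*-congˡ (sym φw₁))) (trans e₂₂ (*-congˡ (sym φw₂)))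
          open Nonsplit z-norm fac
      in [ (λ g₁≈0 → inj₂ record { z-norm = z-norm ; w-norm = w-norm ; fac = factor-cong fac
             (trans u₁≈ (trans (+-congʳ (trans (*-congʳ g₁≈0) (zeroˡ _))) (+-identityˡ _)))
             (trans u₂≈ (trans (+-congʳ (trans (*-congʳ g₁≈0) (zeroˡ _))) (+-identityˡ _))) })
         , (λ g₂≈0 → inj₁ record { z-norm = z-norm ; w-norm = w-norm ; fac = factor-cong fac
             (trans u₁≈ (trans (+-congˡ (trans (*-congʳ g₂≈0) (zeroˡ _))) (+-identityʳ _)))
             (trans u₂≈ (trans (+-congˡ (trans (*-congʳ g₂≈0) (zeroˡ _))) (+-identityʳ _))) }) ]′ g-split

    module Single {z} (z-norm : N 1# ≈ N z) (e : det z ≈ 0#) where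
      m₁₁ m₁₂ m₂₁ m₂₂ : Carrier
      m₁₁ = d + z * bar a
      m₁₂ = b + z * bar c
      m₂₁ = c + z * bar b
      m₂₂ = a + z * bar d

      private
        zz̄≈1 : z * bar z ≈ 1#
        zz̄≈1 = trans (sym z-norm) (solve 0 (𝟙 ⊗ ⋆ 𝟙 ≣ 𝟙) refl)

        -- For z z̄ = 1 the map s ↦ z s̄ is an involution that fixes f + z f̄, so it exchanges
        -- opposite entries of the matrix.
        reflect : ∀ x y → z * bar (x + z * bar y) ≈ y + z * bar x
        reflect x y = begin
          z * bar (x + z * bar y)
            ≈⟨ solve 3 (λ x y z → z ⊗ ⋆ (x ⊕ z ⊗ ⋆ y) ≣ z ⊗ ⋆ z ⊗ y ⊕ z ⊗ ⋆ x) refl x y z ⟩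
          z * bar z * y + z * bar x     ≈⟨ +-congʳ (trans (*-congʳ zz̄≈1) (*-identityˡ y)) ⟩
          y + z * bar x                 ∎

      m₂₂≈ : m₂₂ ≈ z * bar m₁₁
      m₂₂≈ = sym (reflect d a)

      m₂₁≈ : m₂₁ ≈ z * bar m₁₂
      m₂₁≈ = sym (reflect b c)

      z≉0 : ¬ z ≈ 0#
      z≉0 = *-nonzeroˡ (λ zz̄≈0 → 1≉0 (trans (sym zz̄≈1) zz̄≈0))

      Nm₁₁≈Nm₁₂ : N m₁₁ ≈ N m₁₂
      Nm₁₁≈Nm₁₂ = *-cancelˡ z≉0 (begin
        z * (m₁₁ * bar m₁₁)   ≈⟨ solve 2 (λ z m → z ⊗ (m ⊗ ⋆ m) ≣ m ⊗ (z ⊗ ⋆ m)) refl z m₁₁ ⟩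
        m₁₁ * (z * bar m₁₁)   ≈⟨ *-congˡ m₂₂≈ ⟨
        m₁₁ * m₂₂             ≈⟨ x∙y⁻¹≈ε⇒x≈y _ _ e ⟩
        m₁₂ * m₂₁             ≈⟨ *-congˡ m₂₁≈ ⟩
        m₁₂ * (z * bar m₁₂)   ≈⟨ solve 2 (λ z m → m ⊗ (z ⊗ ⋆ m) ≣ z ⊗ (m ⊗ ⋆ m)) refl z m₁₂ ⟩
        z * (m₁₂ * bar m₁₂)   ∎)

      -- All four entries have the same norm or are conjugate up to z, so they would vanish
      -- together. Then f + z f̄ = 0 identically, all values of `f` lie on one K-line, and
      -- injectivity on lines fails.
      m₁₁≉0 : ¬ m₁₁ ≈ 0#
      m₁₁≉0 m₁₁≈0 = 1≉0 (∼⇒0 (always 1# 1#) (always 1# θ))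
        where
        m₁₂≈0 : m₁₂ ≈ 0#
        m₁₂≈0 = [ (λ z → z) , (λ z → trans (sym (bar-bar m₁₂)) (trans (bar-cong z) bar-0)) ]′
          (integral m₁₂ (bar m₁₂) (trans (sym Nm₁₁≈Nm₁₂) (trans (*-congʳ m₁₁≈0) (zeroˡ _))))
        z*bar≈0 : ∀ {x} → x ≈ 0# → z * bar x ≈ 0#
        z*bar≈0 x≈0 = trans (*-congˡ (trans (bar-cong x≈0) bar-0)) (zeroʳ z)
        vanish : ∀ x → lin 1# z (f x) ≈ 0#
        vanish x = begin
          lin 1# z (f x)      ≈⟨ twist z x ⟩
          m₁₁ * (x * φ x) + m₁₂ * (x * bar (φ x)) + m₂₁ * (bar x * φ x) + m₂₂ * (bar x * bar (φ x))
            ≈⟨ +-cong (+-cong (+-cong (*-congʳ m₁₁≈0) (*-congʳ m₁₂≈0))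
                 (*-congʳ (trans m₂₁≈ (z*bar≈0 m₁₂≈0)))) (*-congʳ (trans m₂₂≈ (z*bar≈0 m₁₁≈0))) ⟩
          0# * (x * φ x) + 0# * (x * bar (φ x)) + 0# * (bar x * φ x) + 0# * (bar x * bar (φ x))
            ≈⟨ solve 2 (λ x X → 𝟘 ⊗ (x ⊗ X) ⊕ 𝟘 ⊗ (x ⊗ ⋆ X) ⊕ 𝟘 ⊗ (⋆ x ⊗ X) ⊕ 𝟘 ⊗ (⋆ x ⊗ ⋆ X) ≣ 𝟘) refl x (φ x) ⟩
          0#                  ∎
        always : ∀ x y → x ∼ y
        always x y = f-∼ x y (twins (vanish x) (vanish y))

      i ρ : Carrier
      i = m₁₁ ⁻¹
      ρ = m₂₁ * i

      m₁₁i≈1 : m₁₁ * i ≈ 1#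
      m₁₁i≈1 = *-inverseʳ m₁₁≉0

      m₂₁≈m₁₁ρ : m₂₁ ≈ m₁₁ * ρ
      m₂₁≈m₁₁ρ = sym (trans (solve 3 (λ m i x → m ⊗ (x ⊗ i) ≣ m ⊗ i ⊗ x) refl m₁₁ i m₂₁) (trans (*-congʳ m₁₁i≈1) (*-identityˡ _)))

      private
        τ-spec = φ-surjective (m₁₂ * i)

      τ : Carrier
      τ = proj₁ τ-spec

      m₁₂≈m₁₁φτ : m₁₂ ≈ m₁₁ * φ τ
      m₁₂≈m₁₁φτ = sym (trans (*-congˡ (proj₂ τ-spec)) (trans (solve 3 (λ m i x → m ⊗ (x ⊗ i) ≣ m ⊗ i ⊗ x) refl m₁₁ i m₁₂)
        (trans (*-congʳ m₁₁i≈1) (*-identityˡ _))))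

      private
        N-quotient : ∀ {x y} → N x ≈ N m₁₁ → x ≈ m₁₁ * y → N 1# ≈ N y
        N-quotient {x} {y} Nx≈ x≈ = sym (*-cancelˡ (*-nonzero m₁₁≉0 (bar-nonzero m₁₁≉0)) (begin
          N m₁₁ * N y       ≈⟨ solve 2 (λ m y → m ⊗ ⋆ m ⊗ (y ⊗ ⋆ y) ≣ (m ⊗ y) ⊗ ⋆ (m ⊗ y)) refl m₁₁ y ⟩
          N (m₁₁ * y)       ≈⟨ *-cong x≈ (bar-cong x≈) ⟨
          N x               ≈⟨ Nx≈ ⟩
          N m₁₁             ≈⟨ solve 1 (λ m → m ⊗ ⋆ m ≣ m ⊗ ⋆ m ⊗ (𝟙 ⊗ ⋆ 𝟙)) refl m₁₁ ⟩
          N m₁₁ * N 1#      ∎))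

      ρ-norm : N 1# ≈ N ρ
      ρ-norm = N-quotient (begin
        m₂₁ * bar m₂₁                           ≈⟨ *-cong m₂₁≈ (bar-cong m₂₁≈) ⟩
        (z * bar m₁₂) * bar (z * bar m₁₂)
          ≈⟨ solve 2 (λ z m → (z ⊗ ⋆ m) ⊗ ⋆ (z ⊗ ⋆ m) ≣ z ⊗ ⋆ z ⊗ (m ⊗ ⋆ m)) refl z m₁₂ ⟩
        z * bar z * N m₁₂                       ≈⟨ trans (*-congʳ zz̄≈1) (*-identityˡ _) ⟩
        N m₁₂                                   ≈⟨ Nm₁₁≈Nm₁₂ ⟨
        N m₁₁                                   ∎) m₂₁≈m₁₁ρ

      τ-norm : N 1# ≈ N τ
      τ-norm = φ-injective (begin
        φ (N 1#)                ≈⟨ φ-cong (solve 0 (𝟙 ⊗ ⋆ 𝟙 ≣ 𝟙) refl) ⟩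
        φ 1#                    ≈⟨ φ-1 ⟩
        1#                      ≈⟨ solve 0 (𝟙 ⊗ ⋆ 𝟙 ≣ 𝟙) refl ⟨
        N 1#                    ≈⟨ N-quotient (sym Nm₁₁≈Nm₁₂) m₁₂≈m₁₁φτ ⟩
        φ τ * bar (φ τ)         ≈⟨ *-congˡ (φ-bar τ) ⟨
        φ τ * φ (bar τ)         ≈⟨ φ-* τ (bar τ) ⟨
        φ (N τ)                 ∎)

      m₂₂≈m₁₁ρφτ : m₂₂ ≈ m₁₁ * ρ * φ τ
      m₂₂≈m₁₁ρφτ = *-cancelˡ m₁₁≉0 (begin
        m₁₁ * m₂₂                     ≈⟨ x∙y⁻¹≈ε⇒x≈y _ _ e ⟩
        m₁₂ * m₂₁                     ≈⟨ *-cong m₁₂≈m₁₁φτ m₂₁≈m₁₁ρ ⟩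
        m₁₁ * φ τ * (m₁₁ * ρ)         ≈⟨ solve 3 (λ m r t → m ⊗ t ⊗ (m ⊗ r) ≣ m ⊗ (m ⊗ r ⊗ t)) refl m₁₁ ρ (φ τ) ⟩
        m₁₁ * (m₁₁ * ρ * φ τ)         ∎)

      fac-τ : Factor z m₁₁ (m₁₁ * ρ) (φ 1#) (φ τ)
      fac-τ = factor (sym (trans (*-congˡ φ-1) (*-identityʳ _))) m₁₂≈m₁₁φτ
        (trans m₂₁≈m₁₁ρ (sym (trans (*-congˡ φ-1) (*-identityʳ _)))) m₂₂≈m₁₁ρφτ

      x₁ : Carrier
      x₁ = proj₁ (lin-kernel 1# ρ ρ-norm)

      x₁≉0 : ¬ x₁ ≈ 0#
      x₁≉0 = proj₁ (proj₂ (lin-kernel 1# ρ ρ-norm))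

      x₁-kernel : lin 1# ρ x₁ ≈ 0#
      x₁-kernel = proj₂ (proj₂ (lin-kernel 1# ρ ρ-norm))

      f-x₁ : lin 1# z (f x₁) ≈ 0#
      f-x₁ = begin
        lin 1# z (f x₁)                                   ≈⟨ factor-φ fac-τ x₁ ⟩
        lin m₁₁ (m₁₁ * ρ) x₁ * φ (lin 1# τ x₁)            ≈⟨ *-congʳ (solve 3 (λ m r x →
          m ⊗ x ⊕ m ⊗ r ⊗ ⋆ x ≣ m ⊗ (𝟙 ⊗ x ⊕ r ⊗ ⋆ x)) refl m₁₁ ρ x₁) ⟩
        m₁₁ * lin 1# ρ x₁ * φ (lin 1# τ x₁)               ≈⟨ *-congʳ (trans (*-congˡ x₁-kernel) (zeroʳ _)) ⟩
        0# * φ (lin 1# τ x₁)                              ≈⟨ zeroˡ _ ⟩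
        0#                                                ∎

      -- Both linear factors of f + z f̄ vanish on the same line.
      τ≈ρ : τ ≈ ρ
      τ≈ρ = let x₂ , x₂≉0 , x₂-kernel = lin-kernel 1# τ τ-norm in
        x∙y⁻¹≈ε⇒x≈y τ ρ (x*y≈0⇒y≈0 (*-nonzero (bar-nonzero x₁≉0) (bar-nonzero x₂≉0)) (begin
          bar x₁ * bar x₂ * (τ - ρ)
            ≈⟨ solve 4 (λ x y r t → ⋆ x ⊗ ⋆ y ⊗ (t ⊝ r) ≣
                 (x ⊗ ⋆ y ⊝ ⋆ x ⊗ y) ⊝ (𝟙 ⊗ x ⊕ r ⊗ ⋆ x) ⊗ ⋆ y ⊕ ⋆ x ⊗ (𝟙 ⊗ y ⊕ t ⊗ ⋆ y)) refl x₁ x₂ ρ τ ⟩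
          cross x₁ x₂ - lin 1# ρ x₁ * bar x₂ + bar x₁ * lin 1# τ x₂
            ≈⟨ +-cong (+-cong (f-∼ x₁ x₂ (twins f-x₁ (trans (factor-φ fac-τ x₂)
                 (trans (*-congˡ (trans (φ-cong x₂-kernel) φ-0)) (zeroʳ _)))))
                 (-‿cong (trans (*-congʳ x₁-kernel) (zeroˡ _)))) (trans (*-congˡ x₂-kernel) (zeroʳ _)) ⟩
          0# - 0# + 0#      ≈⟨ solve 0 (𝟘 ⊝ 𝟘 ⊕ 𝟘 ≣ 𝟘) refl ⟩
          0#                ∎))

      fac : Factor z m₁₁ (m₁₁ * ρ) (φ 1#) (φ ρ)
      fac = let factor e₁₁ e₁₂ e₂₁ e₂₂ = fac-τ in
        factor e₁₁ (trans e₁₂ (*-congˡ (φ-cong τ≈ρ))) e₂₁ (trans e₂₂ (*-congˡ (φ-cong τ≈ρ)))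

      -- A double root would make f vanish on the common zero line.
      not-double : ¬ bar Δ * z + bar Δ * z + E ≈ 0#
      not-double e₂ = x₁≉0 (f-zero (trans (sym (bar-bar (f x₁))) (trans (bar-cong (x*y≈0⇒y≈0 m₁₁≉0 (begin
        m₁₁ * bar (f x₁)
          ≈⟨ solve 7 (λ a b c d m x X → m ⊗ ⋆ (a ⊗ (⋆ x ⊗ ⋆ X) ⊕ b ⊗ (x ⊗ ⋆ X) ⊕ c ⊗ (⋆ x ⊗ X) ⊕ d ⊗ (x ⊗ X)) ≣
               ⋆ a ⊗ (m ⊗ x ⊗ X) ⊕ ⋆ b ⊗ (m ⊗ ⋆ x ⊗ X) ⊕ ⋆ c ⊗ (m ⊗ x ⊗ ⋆ X) ⊕ ⋆ d ⊗ (m ⊗ ⋆ x ⊗ ⋆ X)) refl a b c d m₁₁ x₁ X ⟩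
        bar a * (m₁₁ * x₁ * X) + bar b * (m₁₁ * bar x₁ * X) + bar c * (m₁₁ * x₁ * bar X) + bar d * (m₁₁ * bar x₁ * bar X)
          ≈⟨ +-congʳ (+-cong (+-cong (*-congˡ (*-cong (*-congˡ x₁≈) X≈)) (*-congˡ (*-congˡ X≈))) (*-congˡ (*-congʳ (*-congˡ x₁≈)))) ⟩
        bar a * (m₁₁ * (- ρ * bar x₁) * (- φ ρ * bar X)) + bar b * (m₁₁ * bar x₁ * (- φ ρ * bar X))
          + bar c * (m₁₁ * (- ρ * bar x₁) * bar X) + bar d * (m₁₁ * bar x₁ * bar X)
          ≈⟨ solve 9 (λ a b c d m x X r s → a ⊗ (m ⊗ (⊝ r ⊗ x) ⊗ (⊝ s ⊗ X)) ⊕ b ⊗ (m ⊗ x ⊗ (⊝ s ⊗ X))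
               ⊕ c ⊗ (m ⊗ (⊝ r ⊗ x) ⊗ X) ⊕ d ⊗ (m ⊗ x ⊗ X) ≣
               (a ⊗ (m ⊗ r ⊗ s) ⊕ d ⊗ m ⊝ c ⊗ (m ⊗ r) ⊝ b ⊗ (m ⊗ s)) ⊗ (x ⊗ X)) refl
               (bar a) (bar b) (bar c) (bar d) m₁₁ (bar x₁) (bar X) ρ (φ ρ) ⟩
        (bar a * (m₁₁ * ρ * φ ρ) + bar d * m₁₁ - bar c * (m₁₁ * ρ) - bar b * (m₁₁ * φ ρ)) * (bar x₁ * bar X)
          ≈⟨ *-congʳ (+-cong (+-cong (+-congʳ (*-congˡ (sym (Factor.m₂₂ fac)))) (-‿cong (*-congˡ (sym m₂₁≈m₁₁ρ))))
               (-‿cong (*-congˡ (sym (Factor.m₁₂ fac))))) ⟩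
        -- The bracket is the derivative of `det` at `z`: each entry of the matrix is differentiated
        -- and multiplied by its cofactor.
        (bar a * m₂₂ + bar d * m₁₁ - bar c * m₂₁ - bar b * m₁₂) * (bar x₁ * bar X)
          ≈⟨ *-congʳ (solve 5 (λ a b c d z →
               ⋆ a ⊗ (a ⊕ z ⊗ ⋆ d) ⊕ ⋆ d ⊗ (d ⊕ z ⊗ ⋆ a) ⊝ ⋆ c ⊗ (c ⊕ z ⊗ ⋆ b) ⊝ ⋆ b ⊗ (b ⊕ z ⊗ ⋆ c) ≣
               ⋆ (a ⊗ d ⊝ b ⊗ c) ⊗ z ⊕ ⋆ (a ⊗ d ⊝ b ⊗ c) ⊗ z ⊕ (a ⊗ ⋆ a ⊕ d ⊗ ⋆ d ⊝ b ⊗ ⋆ b ⊝ c ⊗ ⋆ c)) refl a b c d z) ⟩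
        (bar Δ * z + bar Δ * z + E) * (bar x₁ * bar X)    ≈⟨ *-congʳ e₂ ⟩
        0# * (bar x₁ * bar X)                             ≈⟨ zeroˡ _ ⟩
        0#                                                ∎))) bar-0)))
        where
        X : Carrier
        X = φ x₁
        x₁≈ : x₁ ≈ - ρ * bar x₁
        x₁≈ = x∙y⁻¹≈ε⇒x≈y _ _ (trans (solve 2 (λ r x → x ⊝ (⊝ r ⊗ ⋆ x) ≣ 𝟙 ⊗ x ⊕ r ⊗ ⋆ x) refl ρ x₁) x₁-kernel)
        X≈ : X ≈ - φ ρ * bar X
        X≈ = trans (φ-cong x₁≈) (trans (φ-* (- ρ) (bar x₁)) (*-cong (φ-neg ρ) (φ-bar x₁)))

    record ShapeC : Set (u ⊔ v) where
      field
        {z₁ z₂ m₁ m₂ ρ₁ ρ₂} : Carrier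
        z₁-norm : N 1# ≈ N z₁
        z₂-norm : N 1# ≈ N z₂
        z₁≉z₂   : ¬ z₁ ≈ z₂
        m₁≉0    : ¬ m₁ ≈ 0#
        m₂≉0    : ¬ m₂ ≈ 0#
        ρ₁-norm : N 1# ≈ N ρ₁
        ρ₂-norm : N 1# ≈ N ρ₂
        ρ₁≉ρ₂   : ¬ ρ₁ ≈ ρ₂
        fac₁    : Factor z₁ m₁ (m₁ * ρ₁) (φ 1#) (φ ρ₁)
        fac₂    : Factor z₂ m₂ (m₂ * ρ₂) (φ 1#) (φ ρ₂)

    lin-zero₂ : ∀ {z₁ z₂ s} → ¬ z₁ ≈ z₂ → lin 1# z₁ s ≈ 0# → lin 1# z₂ s ≈ 0# → s ≈ 0#
    lin-zero₂ {z₁} {z₂} {s} z₁≉z₂ e₁ e₂ = x*y≈0⇒y≈0 (x-y≉0 z₁≉z₂) (begin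
      (z₁ - z₂) * s
        ≈⟨ solve 3 (λ y z s → (y ⊝ z) ⊗ s ≣ y ⊗ (𝟙 ⊗ s ⊕ z ⊗ ⋆ s) ⊝ z ⊗ (𝟙 ⊗ s ⊕ y ⊗ ⋆ s)) refl z₁ z₂ s ⟩
      z₁ * lin 1# z₂ s - z₂ * lin 1# z₁ s
        ≈⟨ +-cong (trans (*-congˡ e₂) (zeroʳ _)) (-‿cong (trans (*-congˡ e₁) (zeroʳ _))) ⟩
      0# - 0#                                     ≈⟨ -‿inverseʳ 0# ⟩
      0#                                          ∎)

    -- By Vieta the roots have product Δ / Δ̄, which is of norm 1, so the second root has norm 1
    -- too; it differs from the first by `not-double`. If both twists had the same zero line, `f`
    -- would vanish on it.
    split : ∀ {z} → ¬ Δ ≈ 0# → N 1# ≈ N z → det z ≈ 0# → ShapeC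
    split {z₁} Δ≉0 z₁-norm root₁ = record
      { z₁-norm = z₁-norm ; z₂-norm = z₂-norm ; z₁≉z₂ = z₁≉z₂
      ; m₁≉0 = S₁.m₁₁≉0 ; m₂≉0 = S₂.m₁₁≉0 ; ρ₁-norm = S₁.ρ-norm ; ρ₂-norm = S₂.ρ-norm
      ; ρ₁≉ρ₂ = ρ₁≉ρ₂ ; fac₁ = S₁.fac ; fac₂ = S₂.fac }
      where
      D j z₂ : Carrier
      D = bar Δ
      j = D ⁻¹
      z₂ = j * (- E - D * z₁)
      D≉0 = bar-nonzero Δ≉0
      Dz₂≈ : D * z₂ ≈ - E - D * z₁
      Dz₂≈ = trans (sym (*-assoc _ _ _)) (trans (*-congʳ (*-inverseʳ D≉0)) (*-identityˡ _))
      z₁z₂D≈Δ : z₁ * (D * z₂) ≈ Δ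
      z₁z₂D≈Δ = begin
        z₁ * (D * z₂)                             ≈⟨ *-congˡ Dz₂≈ ⟩
        z₁ * (- E - D * z₁)
          ≈⟨ solve 4 (λ z D E Δ → z ⊗ (⊝ E ⊝ D ⊗ z) ≣ Δ ⊝ (D ⊗ (z ⊗ z) ⊕ E ⊗ z ⊕ Δ)) refl z₁ D E Δ ⟩
        Δ - (D * (z₁ * z₁) + E * z₁ + Δ)          ≈⟨ +-congˡ (-‿cong (trans (sym (det≈ z₁)) root₁)) ⟩
        Δ - 0#                                    ≈⟨ solve 1 (λ x → x ⊝ 𝟘 ≣ x) refl Δ ⟩
        Δ                                         ∎
      z₂-norm : N 1# ≈ N z₂
      z₂-norm = sym (*-cancelˡ (*-nonzero Δ≉0 D≉0) (begin
        N Δ * N z₂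
          ≈⟨ solve 2 (λ D z → D ⊗ ⋆ D ⊗ (z ⊗ ⋆ z) ≣ 𝟙 ⊗ ⋆ 𝟙 ⊗ ((⋆ D ⊗ z) ⊗ ⋆ (⋆ D ⊗ z))) refl Δ z₂ ⟩
        N 1# * N (D * z₂)           ≈⟨ *-congʳ z₁-norm ⟩
        N z₁ * N (D * z₂)
          ≈⟨ solve 2 (λ z w → z ⊗ ⋆ z ⊗ (w ⊗ ⋆ w) ≣ (z ⊗ w) ⊗ ⋆ (z ⊗ w)) refl z₁ (D * z₂) ⟩
        N (z₁ * (D * z₂))           ≈⟨ *-cong z₁z₂D≈Δ (bar-cong z₁z₂D≈Δ) ⟩
        N Δ                         ≈⟨ solve 1 (λ x → x ⊗ ⋆ x ≣ x ⊗ ⋆ x ⊗ (𝟙 ⊗ ⋆ 𝟙)) refl Δ ⟩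
        N Δ * N 1#                  ∎))
      root₂ : det z₂ ≈ 0#
      root₂ = begin
        det z₂                                          ≈⟨ det≈ z₂ ⟩
        D * (z₂ * z₂) + E * z₂ + Δ                      ≈⟨ solve 5 (λ D E Δ y z → D ⊗ (z ⊗ z) ⊕ E ⊗ z ⊕ Δ ≣
          z ⊗ (D ⊗ z ⊝ (⊝ E ⊝ D ⊗ y)) ⊕ (Δ ⊝ y ⊗ (D ⊗ z))) refl D E Δ z₁ z₂ ⟩
        z₂ * (D * z₂ - (- E - D * z₁)) + (Δ - z₁ * (D * z₂))
          ≈⟨ +-cong (*-congˡ (+-congʳ Dz₂≈)) (+-congˡ (-‿cong z₁z₂D≈Δ)) ⟩
        z₂ * ((- E - D * z₁) - (- E - D * z₁)) + (Δ - Δ)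
          ≈⟨ solve 3 (λ z w Δ → z ⊗ (w ⊝ w) ⊕ (Δ ⊝ Δ) ≣ 𝟘) refl z₂ (- E - D * z₁) Δ ⟩
        0#                                              ∎
      module S₁ = Single z₁-norm root₁
      module S₂ = Single z₂-norm root₂
      z₁≉z₂ : ¬ z₁ ≈ z₂
      z₁≉z₂ z₁≈z₂ = S₁.not-double (begin
        D * z₁ + D * z₁ + E             ≈⟨ +-congʳ (+-congˡ (*-congˡ z₁≈z₂)) ⟩
        D * z₁ + D * z₂ + E             ≈⟨ +-congʳ (+-congˡ Dz₂≈) ⟩
        D * z₁ + (- E - D * z₁) + E     ≈⟨ solve 2 (λ w E → w ⊕ (⊝ E ⊝ w) ⊕ E ≣ 𝟘) refl (D * z₁) E ⟩
        0#                              ∎)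
      ρ₁≉ρ₂ : ¬ S₁.ρ ≈ S₂.ρ
      ρ₁≉ρ₂ ρ₁≈ρ₂ = S₁.x₁≉0 (f-zero (lin-zero₂ z₁≉z₂ S₁.f-x₁ (begin
        lin 1# z₂ (f S₁.x₁)                                       ≈⟨ factor-φ S₂.fac S₁.x₁ ⟩
        lin S₂.m₁₁ (S₂.m₁₁ * S₂.ρ) S₁.x₁ * φ (lin 1# S₂.ρ S₁.x₁)  ≈⟨ *-congˡ (trans (φ-cong (trans
          (+-congˡ (*-congʳ (sym ρ₁≈ρ₂))) S₁.x₁-kernel)) φ-0) ⟩
        lin S₂.m₁₁ (S₂.m₁₁ * S₂.ρ) S₁.x₁ * 0#                     ≈⟨ zeroʳ _ ⟩
        0#                                                        ∎)))

    -- When Δ = 0 the leading coefficient of `det` disappears, but then z = 0 is a root, and its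
    -- norm is not 1.
    classification : ShapeA ⊎ ShapeB ⊎ ShapeC
    classification = byΔ (Δ ≟ 0#)
      where
      byNorm : ∀ {z} → ¬ Δ ≈ 0# → det z ≈ 0# → Dec (N 1# ≈ N z) → ShapeA ⊎ ShapeB ⊎ ShapeC
      byNorm Δ≉0 e (yes z-norm) = inj₂ (inj₂ (split Δ≉0 z-norm e))
      byNorm Δ≉0 e (no z-norm)  = [ inj₁ , (λ s → inj₂ (inj₁ s)) ]′ (nonsplit z-norm e)
      byΔ : Dec (Δ ≈ 0#) → ShapeA ⊎ ShapeB ⊎ ShapeC
      byΔ (yes Δ≈0) = [ inj₁ , (λ s → inj₂ (inj₁ s)) ]′ (nonsplit
        (λ e → 1≉0 (trans (solve 0 (𝟙 ≣ 𝟙 ⊗ ⋆ 𝟙) refl) (trans e (zeroˡ _)))) (root-0 Δ≈0))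
      byΔ (no Δ≉0) = let z , e = ∃-root Δ≉0 in byNorm Δ≉0 e (N 1# ≟ N z)

-- Necessity: from the shapes to the three families

module NormalForms {u v} (p k ℓ : ℕ) (pr : Prime p) .{{_ : NonZero k}} .{{_ : NonZero ℓ}}
  (F : FiniteField u v ((p ℕ.^ k) ℕ.^ 2)) where

  open FiniteField F hiding (zero)
  open QuadraticField p k ℓ pr F
  open FiniteFieldProperties F
  open LinearMaps p k ℓ pr F
  open Form p k ℓ pr F using (f; module Classification; Factor; factor; factor-φ)
  open Algebra.Properties.Ring ring using (x∙y⁻¹≈ε⇒x≈y)
  open Relation.Binary.Reasoning.Setoid setoid

  -- Injectivity of t ↦ t^(Q+1) on K* and on μ (q + 1), and of t ↦ t^(Q−1) on μ (q + 1).
  Trivial₁ Trivial₂ Trivial₃ : Set (u ⊔ v)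
  Trivial₁ = ∀ t → bar t ≈ t      → φ t * t ≈ 1# → t ≈ 1#
  Trivial₂ = ∀ t → bar t * t ≈ 1# → φ t * t ≈ 1# → t ≈ 1#
  Trivial₃ = ∀ t → bar t * t ≈ 1# → φ t ≈ t      → t ≈ 1#

  -- a, b, c, d are the coefficients of δ A₀(γ X), where A₀ has the coefficients a₀, b₀, c₀, d₀.
  record Scaled (a b c d γ δ a₀ b₀ c₀ d₀ : Carrier) : Set v where
    constructor scaled
    field
      γ-norm : bar γ * γ ≈ 1#
      δ≉0    : ¬ δ ≈ 0#
      a≈ : a ≈ δ * (a₀ * (φ γ * γ))
      b≈ : b ≈ δ * (b₀ * φ γ)
      c≈ : c ≈ δ * (c₀ * γ)
      d≈ : d ≈ δ * d₀

  Normal₁ Normal₂ Normal₃ : (a b c d α β : Carrier) → Set (u ⊔ v)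
  Normal₁ a b c d α β = ∃[ γ ] ∃[ δ ] Scaled a b c d γ δ
    (φ α * α + β) (bar α * φ α + β) (bar (φ α) * α + β) (bar (φ α) * bar α + β)
  Normal₂ a b c d α β = ∃[ γ ] ∃[ δ ] Scaled a b c d γ δ
    (bar (φ α) * bar α + β) (bar (φ α) + α * β) (bar α + φ α * β) (1# + φ α * α * β)
  Normal₃ a b c d α β = ∃[ γ ] ∃[ δ ] Scaled a b c d γ δ
    (bar (φ α) + bar α * β) (bar (φ α) * α + β) (1# + bar α * φ α * β) (α + φ α * β)

  Case₁ Case₂ Case₃ : (a b c d : Carrier) → Set (u ⊔ v)
  Case₁ a b c d = ∃[ α ] ∃[ β ] (¬ bar α ≈ α) × (¬ bar β ≈ β) × Normal₁ a b c d α β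
  Case₂ a b c d = (∃[ γ ] ∃[ δ ] Scaled a b c d γ δ 1# 0# 0# 0#)
    ⊎ (∃[ α ] ∃[ β ] (¬ bar α * α ≈ 1#) × (¬ bar β * β ≈ 1#) × Normal₂ a b c d α β)
  Case₃ a b c d = (∃[ γ ] ∃[ δ ] Scaled a b c d γ δ 0# 1# 0# 0#)
    ⊎ (∃[ α ] ∃[ β ] (¬ bar α * α ≈ 1#) × (¬ bar β * β ≈ 1#) × Normal₃ a b c d α β)

  private
    N1≈1 : N 1# ≈ 1#
    N1≈1 = solve 0 (𝟙 ⊗ ⋆ 𝟙 ≣ 𝟙) refl

  ∃-η : ∀ {γ} → bar γ * γ ≈ 1# → ∃[ η ] (¬ η ≈ 0#) × bar η ≈ γ * η
  ∃-η {γ} γ-norm =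
    let Nγ≈ = trans (*-comm γ (bar γ)) (trans γ-norm (solve 0 (𝟙 ≣ ⊝ 𝟙 ⊗ ⋆ (⊝ 𝟙)) refl))
        η , η≉0 , e = lin-kernel γ (- 1#) Nγ≈
    in
    η , η≉0 , sym (x∙y⁻¹≈ε⇒x≈y _ _ (trans (solve 2 (λ g y → g ⊗ y ⊝ ⋆ y ≣ g ⊗ y ⊕ ⊝ 𝟙 ⊗ ⋆ y) refl γ η) e))

  φ-ratio : ∀ {x y} → x * y ≈ 1# → φ x * φ y ≈ 1#
  φ-ratio e = trans (sym (φ-* _ _)) (trans (φ-cong e) φ-1)

  module Necessity (a b c d : Carrier)
    (f-∼ : ∀ x y → f a b c d x ∼ f a b c d y → x ∼ y)
    (f-sum : ∀ z → ¬ N 1# ≈ N z → Σ.fold (λ x → lin 1# z (f a b c d x) ^ (q ∸ 1)) ≈ 0#) where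

    open Classification a b c d f-∼ f-sum

    private
      g : Carrier → Carrier
      g = f a b c d

    module _ {z h w₁ w₂} (z-norm : ¬ N 1# ≈ N z) (w-norm : ¬ N w₁ ≈ N w₂) (M : Carrier → Carrier)
      (M-cong : ∀ {s t} → s ≈ t → M s ≈ M t) (g≈ : ∀ x → lin 1# z (g x) ≈ h * M (lin w₁ w₂ x)) where

      -- `M` is `f` between the bijections w and s ↦ s + z s̄, up to the factor `h`; all of these
      -- respect lines.
      M-∼ : ∀ s t → M s ∼ M t → s ∼ t
      M-∼ s t e =
        let x , wx≈s = lin-surjective w-norm s
            y , wy≈t = lin-surjective w-norm t
        in trans (sym (cross-cong wx≈s wy≈t)) (∼-lin w₁ w₂ (f-∼ x y (lin-∼ z-norm (begin
          cross (lin 1# z (g x)) (lin 1# z (g y))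
            ≈⟨ cross-cong (trans (g≈ x) (*-congˡ (M-cong wx≈s))) (trans (g≈ y) (*-congˡ (M-cong wy≈t))) ⟩
          cross (h * M s) (h * M t)
            ≈⟨ solve 3 (λ h x y → (h ⊗ x) ⊗ ⋆ (h ⊗ y) ⊝ ⋆ (h ⊗ x) ⊗ (h ⊗ y) ≣
                                                               h ⊗ ⋆ h ⊗ (x ⊗ ⋆ y ⊝ ⋆ x ⊗ y)) refl h (M s) (M t) ⟩
          N h * cross (M s) (M t)                         ≈⟨ trans (*-congˡ e) (zeroʳ _) ⟩
          0#                                              ∎))))

      h≉0 : M 0# ≈ 0# → ¬ h ≈ 0#
      h≉0 M0≈0 h≈0 = let x , wx≈1 = lin-surjective w-norm 1# in
        1≉0 (trans (sym wx≈1) (trans (lin-cong (f-zero (lin-0 z-norm (trans (g≈ x) (trans (*-congʳ h≈0) (zeroˡ _))))))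
          (solve 2 (λ w w′ → w ⊗ 𝟘 ⊕ w′ ⊗ ⋆ 𝟘 ≣ 𝟘) refl w₁ w₂)))

    private
      ∼⇒ζ≈1 : ∀ {ζ η} → ¬ η ≈ 0# → bar η ≈ ζ * η → 1# ∼ η → ζ ≈ 1#
      ∼⇒ζ≈1 {ζ} {η} η≉0 η̄≈ e = *-cancelˡ η≉0 (begin
        η * ζ       ≈⟨ *-comm η ζ ⟩
        ζ * η       ≈⟨ η̄≈ ⟨
        bar η       ≈⟨ x∙y⁻¹≈ε⇒x≈y _ _ (trans (solve 1 (λ y → ⋆ y ⊝ y ≣ 𝟙 ⊗ ⋆ y ⊝ ⋆ 𝟙 ⊗ y) refl η) e) ⟩
        η           ≈⟨ *-identityʳ η ⟨
        η * 1#      ∎)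

      φ-η : ∀ {ζ η} → bar η ≈ ζ * η → bar (φ η) ≈ φ ζ * φ η
      φ-η {ζ} {η} e = trans (sym (φ-bar η)) (trans (φ-cong e) (φ-* ζ η))

    module FromA (S : ShapeA) where
      open ShapeA S renaming (g to h)

      M : Carrier → Carrier
      M s = s * φ s

      g≈ : ∀ x → lin 1# z (g x) ≈ h * M (lin w₁ w₂ x)
      g≈ x = trans (factor-φ a b c d fac x)
        (solve 5 (λ h w₁ w₂ x X → (h ⊗ w₁ ⊗ x ⊕ h ⊗ w₂ ⊗ ⋆ x) ⊗ X ≣ h ⊗ ((w₁ ⊗ x ⊕ w₂ ⊗ ⋆ x) ⊗ X)) refl h w₁ w₂ x (φ (lin w₁ w₂ x)))

      M-cong : ∀ {s t} → s ≈ t → M s ≈ M t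
      M-cong e = *-cong e (φ-cong e)

      h-nonzero : ¬ h ≈ 0#
      h-nonzero = h≉0 z-norm w-norm M M-cong g≈ (zeroˡ _)

      -- With ζ = η̄ / η, the equation ζ^(Q+1) = 1 says that η φ(η) lies in K, like the value of `M`
      -- at 1. Injectivity then puts η itself in K.
      trivial : Trivial₂
      trivial ζ ζ-norm ζ-inv = let η , η≉0 , η̄≈ = ∃-η ζ-norm in
        ∼⇒ζ≈1 η≉0 η̄≈ (M-∼ z-norm w-norm M M-cong g≈ 1# η (begin
          cross (1# * φ 1#) (η * φ η)           ≈⟨ cross-cong (trans (*-identityˡ _) φ-1) refl ⟩
          cross 1# (η * φ η)
            ≈⟨ solve 2 (λ y Y → 𝟙 ⊗ ⋆ (y ⊗ Y) ⊝ ⋆ 𝟙 ⊗ (y ⊗ Y) ≣ ⋆ y ⊗ ⋆ Y ⊝ y ⊗ Y) refl η (φ η) ⟩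
          bar η * bar (φ η) - η * φ η           ≈⟨ +-congʳ (*-cong η̄≈ (φ-η η̄≈)) ⟩
          ζ * η * (φ ζ * φ η) - η * φ η
            ≈⟨ solve 4 (λ z Z y Y → z ⊗ y ⊗ (Z ⊗ Y) ⊝ y ⊗ Y ≣ (Z ⊗ z ⊝ 𝟙) ⊗ (y ⊗ Y)) refl ζ (φ ζ) η (φ η) ⟩
          (φ ζ * ζ - 1#) * (η * φ η)            ≈⟨ *-congʳ (trans (+-congʳ ζ-inv) (-‿inverseʳ 1#)) ⟩
          0# * (η * φ η)                        ≈⟨ zeroˡ _ ⟩
          0#                                    ∎))

    module FromB (S : ShapeB) where
      open ShapeB S renaming (g to h)

      M : Carrier → Carrier
      M s = bar s * φ s

      g≈ : ∀ x → lin 1# z (g x) ≈ h * M (lin w₁ w₂ x)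
      g≈ x = trans (factor-φ a b c d fac x)
        (solve 5 (λ h w₁ w₂ x X → (h ⊗ ⋆ w₂ ⊗ x ⊕ h ⊗ ⋆ w₁ ⊗ ⋆ x) ⊗ X ≣ h ⊗ (⋆ (w₁ ⊗ x ⊕ w₂ ⊗ ⋆ x) ⊗ X)) refl h w₁ w₂ x (φ (lin w₁ w₂ x)))

      M-cong : ∀ {s t} → s ≈ t → M s ≈ M t
      M-cong e = *-cong (bar-cong e) (φ-cong e)

      h-nonzero : ¬ h ≈ 0#
      h-nonzero = h≉0 z-norm w-norm M M-cong g≈ (trans (*-congʳ bar-0) (zeroˡ _))

      -- With ζ = η̄ / η, the quotient of η̄ φ(η) by its conjugate is ζ / φ(ζ), so φ(ζ) = ζ puts
      -- `M η` on the line of `M 1#`.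
      trivial : Trivial₃
      trivial ζ ζ-norm ζ-fix = let η , η≉0 , η̄≈ = ∃-η ζ-norm in
        ∼⇒ζ≈1 η≉0 η̄≈ (M-∼ z-norm w-norm M M-cong g≈ 1# η (begin
          cross (bar 1# * φ 1#) (bar η * φ η)   ≈⟨ cross-cong (trans (*-cong bar-1 φ-1) (*-identityˡ _)) refl ⟩
          cross 1# (bar η * φ η)
            ≈⟨ solve 2 (λ y Y → 𝟙 ⊗ ⋆ (⋆ y ⊗ Y) ⊝ ⋆ 𝟙 ⊗ (⋆ y ⊗ Y) ≣ y ⊗ ⋆ Y ⊝ ⋆ y ⊗ Y) refl η (φ η) ⟩
          η * bar (φ η) - bar η * φ η           ≈⟨ +-cong (*-congˡ (φ-η η̄≈)) (-‿cong (*-congʳ η̄≈)) ⟩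
          η * (φ ζ * φ η) - ζ * η * φ η
            ≈⟨ solve 4 (λ z Z y Y → y ⊗ (Z ⊗ Y) ⊝ z ⊗ y ⊗ Y ≣ (Z ⊝ z) ⊗ (y ⊗ Y)) refl ζ (φ ζ) η (φ η) ⟩
          (φ ζ - ζ) * (η * φ η)                 ≈⟨ *-congʳ (trans (+-congʳ ζ-fix) (-‿inverseʳ ζ)) ⟩
          0# * (η * φ η)                        ≈⟨ zeroˡ _ ⟩
          0#                                    ∎))

    module FromC (S : ShapeC) where
      open ShapeC S

      private
        kernel₁ = lin-kernel 1# ρ₁ ρ₁-norm
        kernel₂ = lin-kernel 1# ρ₂ ρ₂-norm
        y₁ y₂ : Carrier
        y₁ = proj₁ kernel₁
        y₂ = proj₁ kernel₂
        y₁≉0 = proj₁ (proj₂ kernel₁)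
        y₂≉0 = proj₁ (proj₂ kernel₂)
        L₁y₁≈0 = proj₂ (proj₂ kernel₁)
        L₂y₂≈0 = proj₂ (proj₂ kernel₂)

        cross-y≉0 : ¬ cross y₁ y₂ ≈ 0#
        cross-y≉0 e = *-nonzero (*-nonzero (bar-nonzero y₁≉0) (bar-nonzero y₂≉0)) (x-y≉0 ρ₁≉ρ₂) (begin
          bar y₁ * bar y₂ * (ρ₁ - ρ₂)
            ≈⟨ solve 4 (λ x y r t → ⋆ x ⊗ ⋆ y ⊗ (r ⊝ t) ≣
                 (𝟙 ⊗ x ⊕ r ⊗ ⋆ x) ⊗ ⋆ y ⊝ ⋆ x ⊗ (𝟙 ⊗ y ⊕ t ⊗ ⋆ y) ⊝ (x ⊗ ⋆ y ⊝ ⋆ x ⊗ y)) refl y₁ y₂ ρ₁ ρ₂ ⟩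
          lin 1# ρ₁ y₁ * bar y₂ - bar y₁ * lin 1# ρ₂ y₂ - cross y₁ y₂
            ≈⟨ +-cong (+-cong (trans (*-congʳ L₁y₁≈0) (zeroˡ _)) (-‿cong (trans (*-congˡ L₂y₂≈0) (zeroʳ _)))) (-‿cong e) ⟩
          0# - 0# - 0#      ≈⟨ solve 0 (𝟘 ⊝ 𝟘 ⊝ 𝟘 ≣ 𝟘) refl ⟩
          0#                ∎)

        square : ∀ {z m ρ} → Factor a b c d z m (m * ρ) (φ 1#) (φ ρ) → ∀ x → lin 1# z (g x) ≈ m * (lin 1# ρ x * φ (lin 1# ρ x))
        square {z} {m} {ρ} fac x = trans (factor-φ a b c d fac x)
          (solve 4 (λ m r x X → (m ⊗ x ⊕ m ⊗ r ⊗ ⋆ x) ⊗ X ≣ m ⊗ ((𝟙 ⊗ x ⊕ r ⊗ ⋆ x) ⊗ X)) refl m ρ x (φ (lin 1# ρ x)))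

      -- Let y₁ and y₂ span the zero lines of the two linear forms. Passing from y₁ + y₂ to y₁ + t
      -- y₂ multiplies the first form by t and keeps the second. As t^(Q+1) = 1, both twists of f
      -- are unchanged, hence so is f, and injectivity on lines leaves only t = 1.
      trivial : Trivial₁
      trivial t t-fix t-inv = x∙y⁻¹≈ε⇒x≈y t 1# (x*y≈0⇒y≈0 cross-y≉0 (begin
        cross y₁ y₂ * (t - 1#)
          ≈⟨ solve 3 (λ x y t → (x ⊗ ⋆ y ⊝ ⋆ x ⊗ y) ⊗ (t ⊝ 𝟙) ≣
               ((x ⊕ y) ⊗ (⋆ x ⊕ t ⊗ ⋆ y) ⊝ ⋆ (x ⊕ y) ⊗ (x ⊕ t ⊗ y))) refl y₁ y₂ t ⟩
        (y₁ + y₂) * (bar y₁ + t * bar y₂) - bar (y₁ + y₂) * (y₁ + t * y₂)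
          ≈⟨ +-congʳ (*-congˡ (trans (bar-+ _ _) (+-congˡ (trans (bar-* t y₂) (*-congʳ t-fix))))) ⟨
        cross (y₁ + y₂) (y₁ + t * y₂)
          ≈⟨ f-∼ _ _ (trans (cross-cong refl (sym g-equal)) (-‿inverseʳ′ (g (y₁ + y₂)))) ⟩
        0#  ∎))
        where
        -‿inverseʳ′ : ∀ s → cross s s ≈ 0#
        -‿inverseʳ′ = solve 1 (λ s → s ⊗ ⋆ s ⊝ ⋆ s ⊗ s ≣ 𝟘) refl
        x x′ : Carrier
        x = y₁ + y₂
        x′ = y₁ + t * y₂
        L₁x L₂x : Carrier
        L₁x = lin 1# ρ₁ x
        L₂x = lin 1# ρ₂ x
        L-x′ : ∀ ρ → lin 1# ρ x′ ≈ lin 1# ρ y₁ + t * lin 1# ρ y₂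
        L-x′ ρ = begin
          1# * (y₁ + t * y₂) + ρ * bar (y₁ + t * y₂)
            ≈⟨ +-congˡ (*-congˡ (trans (bar-+ _ _) (+-congˡ (trans (bar-* t y₂) (*-congʳ t-fix))))) ⟩
          1# * (y₁ + t * y₂) + ρ * (bar y₁ + t * bar y₂)
            ≈⟨ solve 4 (λ x y t r → 𝟙 ⊗ (x ⊕ t ⊗ y) ⊕ r ⊗ (⋆ x ⊕ t ⊗ ⋆ y) ≣ (𝟙 ⊗ x ⊕ r ⊗ ⋆ x) ⊕ t ⊗ (𝟙 ⊗ y ⊕ r ⊗ ⋆ y)) refl y₁ y₂ t ρ ⟩
          lin 1# ρ y₁ + t * lin 1# ρ y₂ ∎
        L-x : ∀ ρ → lin 1# ρ x ≈ lin 1# ρ y₁ + lin 1# ρ y₂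
        L-x ρ = solve 3 (λ x y r → 𝟙 ⊗ (x ⊕ y) ⊕ r ⊗ ⋆ (x ⊕ y) ≣ (𝟙 ⊗ x ⊕ r ⊗ ⋆ x) ⊕ (𝟙 ⊗ y ⊕ r ⊗ ⋆ y)) refl y₁ y₂ ρ
        L₁x′≈ : lin 1# ρ₁ x′ ≈ t * L₁x
        L₁x′≈ = trans (L-x′ ρ₁) (trans (+-congʳ L₁y₁≈0) (trans (+-identityˡ _)
          (*-congˡ (sym (trans (L-x ρ₁) (trans (+-congʳ L₁y₁≈0) (+-identityˡ _)))))))
        L₂x′≈ : lin 1# ρ₂ x′ ≈ L₂x
        L₂x′≈ = trans (L-x′ ρ₂) (trans (+-congˡ (trans (*-congˡ L₂y₂≈0) (zeroʳ t)))
          (sym (trans (L-x ρ₂) (+-congˡ L₂y₂≈0))))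
        g₁ : lin 1# z₁ (g x′) ≈ lin 1# z₁ (g x)
        g₁ = begin
          lin 1# z₁ (g x′)                              ≈⟨ square fac₁ x′ ⟩
          m₁ * (lin 1# ρ₁ x′ * φ (lin 1# ρ₁ x′))
            ≈⟨ *-congˡ (*-cong L₁x′≈ (trans (φ-cong L₁x′≈) (φ-* t L₁x))) ⟩
          m₁ * (t * L₁x * (φ t * φ L₁x))
            ≈⟨ solve 5 (λ m t T l L → m ⊗ (t ⊗ l ⊗ (T ⊗ L)) ≣ T ⊗ t ⊗ (m ⊗ (l ⊗ L))) refl m₁ t (φ t) L₁x (φ L₁x) ⟩
          φ t * t * (m₁ * (L₁x * φ L₁x))                ≈⟨ trans (*-congʳ t-inv) (*-identityˡ _) ⟩
          m₁ * (L₁x * φ L₁x)                            ≈⟨ square fac₁ x ⟨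
          lin 1# z₁ (g x)                               ∎
        g₂ : lin 1# z₂ (g x′) ≈ lin 1# z₂ (g x)
        g₂ = trans (square fac₂ x′) (trans (*-congˡ (*-cong L₂x′≈ (φ-cong L₂x′≈))) (sym (square fac₂ x)))
        lin-difference : ∀ {z} → lin 1# z (g x′) ≈ lin 1# z (g x) → lin 1# z (g x′ - g x) ≈ 0#
        lin-difference {z} e = trans (solve 3 (λ z s t → 𝟙 ⊗ (s ⊝ t) ⊕ z ⊗ ⋆ (s ⊝ t) ≣ (𝟙 ⊗ s ⊕ z ⊗ ⋆ s) ⊝ (𝟙 ⊗ t ⊕ z ⊗ ⋆ t)) refl z (g x′) (g x))
          (trans (+-congʳ e) (-‿inverseʳ _))
        g-equal : g x ≈ g x′
        g-equal = sym (x∙y⁻¹≈ε⇒x≈y _ _ (lin-zero₂ z₁≉z₂ (lin-difference g₁) (lin-difference g₂)))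

    -- Each coefficient occurs in one entry and its conjugate, times z, in the opposite entry.
    -- Subtracting z times the conjugate of that opposite entry eliminates the partner and leaves
    -- the factor 1 - z z̄.
    untwist : ∀ {z u₁ u₂ v₁ v₂} → Factor a b c d z u₁ u₂ v₁ v₂ → let D = N 1# - N z in
      (D * a ≈ u₂ * v₂ - z * bar (u₁ * v₁)) × (D * b ≈ u₁ * v₂ - z * bar (u₂ * v₁)) ×
      (D * c ≈ u₂ * v₁ - z * bar (u₁ * v₂)) × (D * d ≈ u₁ * v₁ - z * bar (u₂ * v₂))
    untwist {z} (factor m₁₁ m₁₂ m₂₁ m₂₂) = combine a d m₂₂ m₁₁ , combine b c m₁₂ m₂₁ , combine c b m₂₁ m₁₂ , combine d a m₁₁ m₂₂
      where
      combine : ∀ x y {r s} → x + z * bar y ≈ r → y + z * bar x ≈ s → (N 1# - N z) * x ≈ r - z * bar s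
      combine x y {r} {s} e₁ e₂ = trans (solve 3 (λ z x y → (𝟙 ⊗ ⋆ 𝟙 ⊝ z ⊗ ⋆ z) ⊗ x ≣ (x ⊕ z ⊗ ⋆ y) ⊝ z ⊗ ⋆ (y ⊕ z ⊗ ⋆ x)) refl z x y)
        (+-cong e₁ (-‿cong (*-congˡ (bar-cong e₂))))

    scaled-1 : ∀ {δ a₀ b₀ c₀ d₀} → ¬ δ ≈ 0# → a ≈ δ * a₀ → b ≈ δ * b₀ → c ≈ δ * c₀ → d ≈ δ * d₀ →
      Scaled a b c d 1# δ a₀ b₀ c₀ d₀
    scaled-1 δ≉0 a≈ b≈ c≈ d≈ = scaled (trans (*-identityʳ _) bar-1) δ≉0
      (trans a≈ (*-congˡ (sym (trans (*-congˡ (trans (*-identityʳ _) φ-1)) (*-identityʳ _)))))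
      (trans b≈ (*-congˡ (sym (trans (*-congˡ φ-1) (*-identityʳ _)))))
      (trans c≈ (*-congˡ (sym (*-identityʳ _)))) d≈

    -- After `untwist`, every coefficient times D is a combination of the same G and H. Dividing by
    -- G collects all of H into the single parameter `β` = H / G, and `δ` is the common factor G /
    -- D.
    module Normalise {D G H : Carrier} (D≉0 : ¬ D ≈ 0#) (G≉0 : ¬ G ≈ 0#) where
      δ β : Carrier
      δ = G * D ⁻¹
      β = H * G ⁻¹

      Dδ≈G : D * δ ≈ G
      Dδ≈G = trans (solve 3 (λ x y z → x ⊗ (y ⊗ z) ≣ y ⊗ (x ⊗ z)) refl D G (D ⁻¹)) (trans (*-congˡ (*-inverseʳ D≉0)) (*-identityʳ G))

      Gβ≈H : G * β ≈ H
      Gβ≈H = trans (solve 3 (λ x y z → x ⊗ (y ⊗ z) ≣ y ⊗ (x ⊗ z)) refl G H (G ⁻¹)) (trans (*-congˡ (*-inverseʳ G≉0)) (*-identityʳ H))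

      δ≉0 : ¬ δ ≈ 0#
      δ≉0 = *-nonzeroʳ (λ e → G≉0 (trans (sym Dδ≈G) e))

      normalise : ∀ {x s t} → D * x ≈ G * s + H * t → x ≈ δ * (s + t * β)
      normalise {x} {s} {t} e = *-cancelˡ D≉0 (begin
        D * x                     ≈⟨ e ⟩
        G * s + H * t             ≈⟨ +-congˡ (*-congʳ Gβ≈H) ⟨
        G * s + G * β * t         ≈⟨ solve 4 (λ g s b t → g ⊗ s ⊕ g ⊗ b ⊗ t ≣ g ⊗ (s ⊕ t ⊗ b)) refl G s β t ⟩
        G * (s + t * β)           ≈⟨ *-congʳ Dδ≈G ⟨
        D * δ * (s + t * β)       ≈⟨ *-assoc _ _ _ ⟩
        D * (δ * (s + t * β))     ∎)

      β-norm : bar β * β ≈ 1# → N H ≈ N G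
      β-norm e = begin
        H * bar H                 ≈⟨ *-cong Gβ≈H (bar-cong Gβ≈H) ⟨
        G * β * bar (G * β)       ≈⟨ solve 2 (λ g b → g ⊗ b ⊗ ⋆ (g ⊗ b) ≣ g ⊗ ⋆ g ⊗ (⋆ b ⊗ b)) refl G β ⟩
        N G * (bar β * β)         ≈⟨ trans (*-congˡ e) (*-identityʳ _) ⟩
        N G                       ∎

    module _ {z : Carrier} (z-norm : ¬ N 1# ≈ N z) {G : Carrier} (G≉0 : ¬ G ≈ 0#) where
      private
        NH≈ : N (- z * bar G) ≈ N z * N G
        NH≈ = solve 2 (λ z g → (⊝ z ⊗ ⋆ g) ⊗ ⋆ (⊝ z ⊗ ⋆ g) ≣ z ⊗ ⋆ z ⊗ (g ⊗ ⋆ g)) refl z G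

      -- The reason for β ∉ μ (q + 1): with H = - z Ḡ, the parameter β or its inverse has norm N z,
      -- which is not 1.
      NH≉NG : ¬ N (- z * bar G) ≈ N G
      NH≉NG e = z-norm (sym (*-cancelˡ (*-nonzero G≉0 (bar-nonzero G≉0)) (begin
        N G * N z           ≈⟨ *-comm _ _ ⟩
        N z * N G           ≈⟨ NH≈ ⟨
        N (- z * bar G)     ≈⟨ e ⟩
        N G                 ≈⟨ trans (*-congˡ N1≈1) (*-identityʳ _) ⟨
        N G * N 1#          ∎)))

    private
      -x≉0 : ∀ {x} → ¬ x ≈ 0# → ¬ - x ≈ 0#
      -x≉0 {x} x≉0 e = x≉0 (trans (solve 1 (λ x → x ≣ ⊝ (⊝ x)) refl x) (trans (-‿cong e) (solve 0 (⊝ 𝟘 ≣ 𝟘) refl)))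

      0≉1-norm : ¬ bar 0# * 0# ≈ 1#
      0≉1-norm e = 0≉1 (trans (sym (zeroʳ _)) e)

      G-only : ∀ z g → g - z * bar 0# ≈ g * 1# + 0# * 0#
      G-only = solve 2 (λ z g → g ⊝ z ⊗ ⋆ 𝟘 ≣ g ⊗ 𝟙 ⊕ 𝟘 ⊗ 𝟘) refl

      zero-only : ∀ z g → 0# - z * bar 0# ≈ g * 0# + 0# * 0#
      zero-only = solve 2 (λ z g → 𝟘 ⊝ z ⊗ ⋆ 𝟘 ≣ g ⊗ 𝟘 ⊕ 𝟘 ⊗ 𝟘) refl

      H-zero : ∀ {z} → z ≈ 0# → ∀ g → 0# - z * bar g ≈ g * 0# + 0# * 0#
      H-zero z≈0 g = trans (+-congˡ (-‿cong (*-congʳ z≈0))) (solve 1 (λ g → 𝟘 ⊝ 𝟘 ⊗ ⋆ g ≣ g ⊗ 𝟘 ⊕ 𝟘 ⊗ 𝟘) refl g)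

      drop-β : ∀ {x δ s β} → x ≈ δ * (s + 0# * β) → x ≈ δ * s
      drop-β e = trans e (*-congˡ (trans (+-congˡ (zeroˡ _)) (+-identityʳ _)))

      swap-G : ∀ z g h → g - z * bar 0# ≈ h * 0# + g * 1#
      swap-G = solve 3 (λ z g h → g ⊝ z ⊗ ⋆ 𝟘 ≣ h ⊗ 𝟘 ⊕ g ⊗ 𝟙) refl

      swap-H : ∀ z g → 0# - z * bar g ≈ - z * bar g * 1# + g * 0#
      swap-H = solve 2 (λ z g → 𝟘 ⊝ z ⊗ ⋆ g ≣ (⊝ z ⊗ ⋆ g) ⊗ 𝟙 ⊕ g ⊗ 𝟘) refl

      swap-zeros : ∀ z g h → 0# - z * bar 0# ≈ h * 0# + g * 0#
      swap-zeros = solve 3 (λ z g h → 𝟘 ⊝ z ⊗ ⋆ 𝟘 ≣ h ⊗ 𝟘 ⊕ g ⊗ 𝟘) refl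

      bar-φ-0 : bar (φ 0#) ≈ 0#
      bar-φ-0 = trans (bar-cong φ-0) bar-0

      module Quotient {w₁ w₂ : Carrier} (w₁≉0 : ¬ w₁ ≈ 0#) (w-norm : ¬ N w₁ ≈ N w₂) where
        -- Chosen so that w = w₁ (x + ᾱ x̄), which is the linear form inside the second and third
        -- families; bijectivity of w becomes N α ≠ 1.
        α : Carrier
        α = bar (w₂ * w₁ ⁻¹)

        w₂≈ : w₂ ≈ w₁ * bar α
        w₂≈ = sym (begin
          w₁ * bar α          ≈⟨ solve 3 (λ w v i → w ⊗ ⋆ (⋆ (v ⊗ i)) ≣ v ⊗ (w ⊗ i)) refl w₁ w₂ (w₁ ⁻¹) ⟩
          w₂ * (w₁ * w₁ ⁻¹)   ≈⟨ trans (*-congˡ (*-inverseʳ w₁≉0)) (*-identityʳ w₂) ⟩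
          w₂                  ∎)

        φw₂≈ : φ w₂ ≈ φ w₁ * bar (φ α)
        φw₂≈ = trans (φ-cong w₂≈) (trans (φ-* _ _) (*-congˡ (φ-bar α)))

        α-norm : ¬ bar α * α ≈ 1#
        α-norm e = w-norm (sym (begin
          w₂ * bar w₂                         ≈⟨ *-cong w₂≈ (bar-cong w₂≈) ⟩
          w₁ * bar α * bar (w₁ * bar α)
            ≈⟨ solve 2 (λ w a → w ⊗ ⋆ a ⊗ ⋆ (w ⊗ ⋆ a) ≣ w ⊗ ⋆ w ⊗ (⋆ a ⊗ a)) refl w₁ α ⟩
          N w₁ * (bar α * α)                  ≈⟨ trans (*-congˡ e) (*-identityʳ _) ⟩
          N w₁                                ∎))

    -- The parameters of the shape are projective, those of the family affine. The case w₁ = 0 is α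
    -- = ∞, which is traded for α = 0 by exchanging G and H; if moreover z = 0, then β would be ∞,
    -- and this is where the monomial comes from.
    normalA : ShapeA → Case₂ a b c d
    normalA S = cases (w₁ ≟ 0#) (z ≟ 0#)
      where
      open ShapeA S renaming (g to h)
      h-nonzero = FromA.h-nonzero S
      D : Carrier
      D = N 1# - N z
      D≉0 = x-y≉0 z-norm
      eqs = untwist fac
      Da = proj₁ eqs
      Db = proj₁ (proj₂ eqs)
      Dc = proj₁ (proj₂ (proj₂ eqs))
      Dd = proj₂ (proj₂ (proj₂ eqs))
      module W₁≉0 (w₁≉0 : ¬ w₁ ≈ 0#) where
        open Quotient w₁≉0 w-norm
        G H w Y : Carrier
        G = h * w₁ * φ w₁
        H = - z * bar G
        w = φ w₁
        Y = φ α
        G≉0 = *-nonzero (*-nonzero h-nonzero w₁≉0) (φ-nonzero w₁≉0)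
        open Normalise {D} {G} {H} D≉0 G≉0
        hw₂≈ : h * w₂ ≈ h * (w₁ * bar α)
        hw₂≈ = *-congˡ w₂≈
        result : Case₂ a b c d
        result = inj₂ (α , β , α-norm , (λ e → NH≉NG z-norm G≉0 (β-norm e)) , 1# , δ , scaled-1 δ≉0
          (trans (normalise (trans Da (trans (+-cong (*-cong hw₂≈ φw₂≈) refl)
            (solve 6 (λ h x w α Y z → h ⊗ (x ⊗ ⋆ α) ⊗ (w ⊗ ⋆ Y) ⊝ z ⊗ ⋆ (h ⊗ x ⊗ w) ≣
              h ⊗ x ⊗ w ⊗ (⋆ Y ⊗ ⋆ α) ⊕ (⊝ z ⊗ ⋆ (h ⊗ x ⊗ w)) ⊗ 𝟙) refl h w₁ w α Y z)))) (*-congˡ (+-congˡ (*-identityˡ β))))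
          (normalise (trans Db (trans (+-cong (*-congˡ φw₂≈) (-‿cong (*-congˡ (bar-cong (*-congʳ hw₂≈)))))
            (solve 6 (λ h x w α Y z → h ⊗ x ⊗ (w ⊗ ⋆ Y) ⊝ z ⊗ ⋆ (h ⊗ (x ⊗ ⋆ α) ⊗ w) ≣
              h ⊗ x ⊗ w ⊗ ⋆ Y ⊕ (⊝ z ⊗ ⋆ (h ⊗ x ⊗ w)) ⊗ α) refl h w₁ w α Y z))))
          (normalise (trans Dc (trans (+-cong (*-congʳ hw₂≈) (-‿cong (*-congˡ (bar-cong (*-congˡ φw₂≈)))))
            (solve 6 (λ h x w α Y z → h ⊗ (x ⊗ ⋆ α) ⊗ w ⊝ z ⊗ ⋆ (h ⊗ x ⊗ (w ⊗ ⋆ Y)) ≣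
              h ⊗ x ⊗ w ⊗ ⋆ α ⊕ (⊝ z ⊗ ⋆ (h ⊗ x ⊗ w)) ⊗ Y) refl h w₁ w α Y z))))
          (normalise (trans Dd (trans (+-congˡ (-‿cong (*-congˡ (bar-cong (*-cong hw₂≈ φw₂≈)))))
            (solve 6 (λ h x w α Y z → h ⊗ x ⊗ w ⊝ z ⊗ ⋆ (h ⊗ (x ⊗ ⋆ α) ⊗ (w ⊗ ⋆ Y)) ≣
              h ⊗ x ⊗ w ⊗ 𝟙 ⊕ (⊝ z ⊗ ⋆ (h ⊗ x ⊗ w)) ⊗ (Y ⊗ α)) refl h w₁ w α Y z)))))
      -- Now w = w₂ x̄, so only the coefficients of X^(Q+1) and of 1 survive. Taking H as the pivot
      -- in place of G makes the constant coefficient of A₀ equal to 1, which needs z ≠ 0.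
      module W₁≈0 (w₁≈0 : w₁ ≈ 0#) where
        G H w : Carrier
        w = φ w₂
        G = h * w₂ * w
        H = - z * bar G
        w₂≉0 : ¬ w₂ ≈ 0#
        w₂≉0 w₂≈0 = w-norm (trans (*-cong w₁≈0 (bar-cong w₁≈0)) (sym (*-cong w₂≈0 (bar-cong w₂≈0))))
        G≉0 = *-nonzero (*-nonzero h-nonzero w₂≉0) (φ-nonzero w₂≉0)
        φw₁≈0 : φ w₁ ≈ 0#
        φw₁≈0 = trans (φ-cong w₁≈0) φ-0
        hw₁≈0 : h * w₁ ≈ 0#
        hw₁≈0 = trans (*-congˡ w₁≈0) (zeroʳ h)
        Da′ : D * a ≈ G - z * bar 0#
        Da′ = trans Da (+-congˡ (-‿cong (*-congˡ (bar-cong (trans (*-congʳ hw₁≈0) (zeroˡ _))))))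
        Db′ : D * b ≈ 0# - z * bar 0#
        Db′ = trans Db (+-cong (trans (*-congʳ hw₁≈0) (zeroˡ _)) (-‿cong (*-congˡ (bar-cong (trans (*-congˡ φw₁≈0) (zeroʳ _))))))
        Dc′ : D * c ≈ 0# - z * bar 0#
        Dc′ = trans Dc (+-cong (trans (*-congˡ φw₁≈0) (zeroʳ _)) (-‿cong (*-congˡ (bar-cong (trans (*-congʳ hw₁≈0) (zeroˡ _))))))
        Dd′ : D * d ≈ 0# - z * bar G
        Dd′ = trans Dd (+-congʳ (trans (*-congʳ hw₁≈0) (zeroˡ _)))
        z≈0-result : z ≈ 0# → Case₂ a b c d
        z≈0-result z≈0 = inj₁ (1# , δ , scaled-1 δ≉0
            (drop-β (normalise (trans Da′ (G-only z G)))) (drop-β (normalise (trans Db′ (zero-only z G))))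
            (drop-β (normalise (trans Dc′ (zero-only z G)))) (drop-β (normalise (trans Dd′ (H-zero z≈0 G)))))
          where open Normalise {D} {G} {0#} D≉0 G≉0
        z≉0-result : ¬ z ≈ 0# → Case₂ a b c d
        z≉0-result z≉0 = inj₂ (0# , β , 0≉1-norm , (λ e → NH≉NG z-norm G≉0 (sym (β-norm e))) , 1# , δ , scaled-1 δ≉0
            (trans (normalise {s = 0#} {t = 1#} (trans Da′ (swap-G z G H)))
              (*-congˡ (+-cong (sym (trans (*-congʳ bar-φ-0) (zeroˡ _))) (*-identityˡ β))))
            (trans (normalise {s = 0#} {t = 0#} (trans Db′ (swap-zeros z G H))) (*-congˡ (+-congʳ (sym bar-φ-0))))
            (trans (normalise {s = 0#} {t = 0#} (trans Dc′ (swap-zeros z G H))) (*-congˡ (+-cong (sym bar-0) (*-congʳ (sym φ-0)))))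
            (trans (normalise {s = 1#} {t = 0#} (trans Dd′ (swap-H z G))) (*-congˡ (+-congˡ (*-congʳ (sym (zeroʳ (φ 0#))))))))
          where open Normalise {D} {H} {G} D≉0 (*-nonzero (-x≉0 z≉0) (bar-nonzero G≉0))
      cases : Dec (w₁ ≈ 0#) → Dec (z ≈ 0#) → Case₂ a b c d
      cases (no w₁≉0)  _         = W₁≉0.result w₁≉0
      cases (yes w₁≈0) (yes z≈0) = W₁≈0.z≈0-result w₁≈0 z≈0
      cases (yes w₁≈0) (no z≉0)  = W₁≈0.z≉0-result w₁≈0 z≉0

    -- The same change of parameters, with s̄ φ(s) in place of s φ(s): G now contains the conjugate
    -- of w₁ or w₂, and the surviving monomials for w₁ = 0 are X^Q and X.
    normalB : ShapeB → Case₃ a b c d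
    normalB S = cases (w₁ ≟ 0#) (z ≟ 0#)
      where
      open ShapeB S renaming (g to h)
      h-nonzero = FromB.h-nonzero S
      D : Carrier
      D = N 1# - N z
      D≉0 = x-y≉0 z-norm
      eqs = untwist fac
      Da = proj₁ eqs
      Db = proj₁ (proj₂ eqs)
      Dc = proj₁ (proj₂ (proj₂ eqs))
      Dd = proj₂ (proj₂ (proj₂ eqs))
      module W₁≉0 (w₁≉0 : ¬ w₁ ≈ 0#) where
        open Quotient w₁≉0 w-norm
        G H w Y : Carrier
        G = h * bar w₁ * φ w₁
        H = - z * bar G
        w = φ w₁
        Y = φ α
        G≉0 = *-nonzero (*-nonzero h-nonzero (bar-nonzero w₁≉0)) (φ-nonzero w₁≉0)
        open Normalise {D} {G} {H} D≉0 G≉0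
        hw₂≈ : h * bar w₂ ≈ h * (bar w₁ * α)
        hw₂≈ = *-congˡ (trans (bar-cong w₂≈) (solve 2 (λ w a → ⋆ (w ⊗ ⋆ a) ≣ ⋆ w ⊗ a) refl w₁ α))
        result : Case₃ a b c d
        result = inj₂ (α , β , α-norm , (λ e → NH≉NG z-norm G≉0 (β-norm e)) , 1# , δ , scaled-1 δ≉0
          (normalise (trans Da (trans (+-cong (*-congˡ φw₂≈) (-‿cong (*-congˡ (bar-cong (*-congʳ hw₂≈)))))
            (solve 6 (λ h x w α Y z → h ⊗ x ⊗ (w ⊗ ⋆ Y) ⊝ z ⊗ ⋆ (h ⊗ (x ⊗ α) ⊗ w) ≣
              h ⊗ x ⊗ w ⊗ ⋆ Y ⊕ (⊝ z ⊗ ⋆ (h ⊗ x ⊗ w)) ⊗ ⋆ α) refl h (bar w₁) w α Y z))))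
          (trans (normalise (trans Db (trans (+-cong (*-cong hw₂≈ φw₂≈) refl)
            (solve 6 (λ h x w α Y z → h ⊗ (x ⊗ α) ⊗ (w ⊗ ⋆ Y) ⊝ z ⊗ ⋆ (h ⊗ x ⊗ w) ≣
              h ⊗ x ⊗ w ⊗ (⋆ Y ⊗ α) ⊕ (⊝ z ⊗ ⋆ (h ⊗ x ⊗ w)) ⊗ 𝟙) refl h (bar w₁) w α Y z)))) (*-congˡ (+-congˡ (*-identityˡ β))))
          (normalise (trans Dc (trans (+-congˡ (-‿cong (*-congˡ (bar-cong (*-cong hw₂≈ φw₂≈)))))
            (solve 6 (λ h x w α Y z → h ⊗ x ⊗ w ⊝ z ⊗ ⋆ (h ⊗ (x ⊗ α) ⊗ (w ⊗ ⋆ Y)) ≣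
              h ⊗ x ⊗ w ⊗ 𝟙 ⊕ (⊝ z ⊗ ⋆ (h ⊗ x ⊗ w)) ⊗ (⋆ α ⊗ Y)) refl h (bar w₁) w α Y z))))
          (normalise (trans Dd (trans (+-cong (*-congʳ hw₂≈) (-‿cong (*-congˡ (bar-cong (*-congˡ φw₂≈)))))
            (solve 6 (λ h x w α Y z → h ⊗ (x ⊗ α) ⊗ w ⊝ z ⊗ ⋆ (h ⊗ x ⊗ (w ⊗ ⋆ Y)) ≣
              h ⊗ x ⊗ w ⊗ α ⊕ (⊝ z ⊗ ⋆ (h ⊗ x ⊗ w)) ⊗ Y) refl h (bar w₁) w α Y z)))))
      module W₁≈0 (w₁≈0 : w₁ ≈ 0#) where
        G H w : Carrier
        w = φ w₂
        G = h * bar w₂ * w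
        H = - z * bar G
        w₂≉0 : ¬ w₂ ≈ 0#
        w₂≉0 w₂≈0 = w-norm (trans (*-cong w₁≈0 (bar-cong w₁≈0)) (sym (*-cong w₂≈0 (bar-cong w₂≈0))))
        G≉0 = *-nonzero (*-nonzero h-nonzero (bar-nonzero w₂≉0)) (φ-nonzero w₂≉0)
        φw₁≈0 : φ w₁ ≈ 0#
        φw₁≈0 = trans (φ-cong w₁≈0) φ-0
        hw₁≈0 : h * bar w₁ ≈ 0#
        hw₁≈0 = trans (*-congˡ (trans (bar-cong w₁≈0) bar-0)) (zeroʳ h)
        Da′ : D * a ≈ 0# - z * bar 0#
        Da′ = trans Da (+-cong (trans (*-congʳ hw₁≈0) (zeroˡ _)) (-‿cong (*-congˡ (bar-cong (trans (*-congˡ φw₁≈0) (zeroʳ _))))))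
        Db′ : D * b ≈ G - z * bar 0#
        Db′ = trans Db (+-congˡ (-‿cong (*-congˡ (bar-cong (trans (*-congʳ hw₁≈0) (zeroˡ _))))))
        Dc′ : D * c ≈ 0# - z * bar G
        Dc′ = trans Dc (+-congʳ (trans (*-congʳ hw₁≈0) (zeroˡ _)))
        Dd′ : D * d ≈ 0# - z * bar 0#
        Dd′ = trans Dd (+-cong (trans (*-congˡ φw₁≈0) (zeroʳ _)) (-‿cong (*-congˡ (bar-cong (trans (*-congʳ hw₁≈0) (zeroˡ _))))))
        z≈0-result : z ≈ 0# → Case₃ a b c d
        z≈0-result z≈0 = inj₁ (1# , δ , scaled-1 δ≉0
            (drop-β (normalise (trans Da′ (zero-only z G)))) (drop-β (normalise (trans Db′ (G-only z G))))
            (drop-β (normalise (trans Dc′ (H-zero z≈0 G)))) (drop-β (normalise (trans Dd′ (zero-only z G)))))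
          where open Normalise {D} {G} {0#} D≉0 G≉0
        z≉0-result : ¬ z ≈ 0# → Case₃ a b c d
        z≉0-result z≉0 = inj₂ (0# , β , 0≉1-norm , (λ e → NH≉NG z-norm G≉0 (sym (β-norm e))) , 1# , δ , scaled-1 δ≉0
            (trans (normalise {s = 0#} {t = 0#} (trans Da′ (swap-zeros z G H)))
              (*-congˡ (+-cong (sym bar-φ-0) (*-congʳ (sym bar-0)))))
            (trans (normalise {s = 0#} {t = 1#} (trans Db′ (swap-G z G H)))
              (*-congˡ (+-cong (sym (zeroʳ (bar (φ 0#)))) (*-identityˡ β))))
            (trans (normalise {s = 1#} {t = 0#} (trans Dc′ (swap-H z G)))
              (*-congˡ (+-congˡ (*-congʳ (sym (trans (*-congʳ bar-0) (zeroˡ _)))))))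
            (trans (normalise {s = 0#} {t = 0#} (trans Dd′ (swap-zeros z G H)))
              (*-congˡ (+-congˡ (*-congʳ (sym φ-0))))))
          where open Normalise {D} {H} {G} D≉0 (*-nonzero (-x≉0 z≉0) (bar-nonzero G≉0))
      cases : Dec (w₁ ≈ 0#) → Dec (z ≈ 0#) → Case₃ a b c d
      cases (no w₁≉0)  _         = W₁≉0.result w₁≉0
      cases (yes w₁≈0) (yes z≈0) = W₁≈0.z≈0-result w₁≈0 z≈0
      cases (yes w₁≈0) (no z≉0)  = W₁≈0.z≉0-result w₁≈0 z≉0

    -- The family consists of the forms sq P + β sq R with sq s = s φ(s), P = ᾱ x + α x̄ and R = x +
    -- x̄. By Hilbert 90 scaling by γ turns R into a multiple of x + γ x̄ and P into a multiple of x
    -- + (α γ / ᾱ) x̄, so γ = ρ₂ and α is chosen to make the second ratio ρ₁.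
    normalC : ShapeC → Case₁ a b c d
    normalC S = α , β , barα≉α , barβ≉β , γ , δ ,
        scaled γ-norm δ≉0
          (combine (eliminate (Factor.m₂₂ fac₁) (Factor.m₂₂ fac₂)) (begin
            z₂ * (m₁ * ρ₁ * φ ρ₁)
              ≈⟨ solve 4 (λ z m r s → z ⊗ (m ⊗ r ⊗ s) ≣ z ⊗ m ⊗ (r ⊗ s)) refl z₂ m₁ ρ₁ (φ ρ₁) ⟩
            z₂ * m₁ * (ρ₁ * φ ρ₁)                     ≈⟨ *-congʳ PK≈ ⟨
            P * K * (ρ₁ * φ ρ₁)
              ≈⟨ solve 5 (λ P Y a r s → P ⊗ (⋆ Y ⊗ ⋆ a) ⊗ (r ⊗ s) ≣ P ⊗ ((⋆ Y ⊗ s) ⊗ (⋆ a ⊗ r))) refl P (φ α) α ρ₁ (φ ρ₁) ⟩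
            P * ((bar (φ α) * φ ρ₁) * (bar α * ρ₁))   ≈⟨ *-congˡ (*-cong φαρ₁≈ αρ₁≈) ⟩
            P * ((φ α * φ γ) * (α * γ))
              ≈⟨ solve 5 (λ P Y G a g → P ⊗ ((Y ⊗ G) ⊗ (a ⊗ g)) ≣ P ⊗ (Y ⊗ a ⊗ (G ⊗ g))) refl P (φ α) (φ γ) α γ ⟩
            P * (φ α * α * (φ γ * γ))                 ∎)
            (solve 4 (λ z m r s → z ⊗ (m ⊗ r ⊗ s) ≣ z ⊗ m ⊗ (s ⊗ r)) refl z₁ m₂ γ (φ γ)))
          (combine (eliminate (Factor.m₁₂ fac₁) (Factor.m₁₂ fac₂)) (begin
            z₂ * (m₁ * φ ρ₁)                          ≈⟨ trans (sym (*-assoc _ _ _)) (*-congʳ (sym PK≈)) ⟩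
            P * K * φ ρ₁
              ≈⟨ solve 4 (λ P Y a s → P ⊗ (⋆ Y ⊗ ⋆ a) ⊗ s ≣ P ⊗ ((⋆ Y ⊗ s) ⊗ ⋆ a)) refl P (φ α) α (φ ρ₁) ⟩
            P * ((bar (φ α) * φ ρ₁) * bar α)          ≈⟨ *-congˡ (*-congʳ φαρ₁≈) ⟩
            P * ((φ α * φ γ) * bar α)
              ≈⟨ solve 4 (λ P Y G a → P ⊗ ((Y ⊗ G) ⊗ ⋆ a) ≣ P ⊗ (⋆ a ⊗ Y ⊗ G)) refl P (φ α) (φ γ) α ⟩
            P * (bar α * φ α * φ γ)                   ∎)
            (sym (*-assoc _ _ _)))
          (combine (eliminate (trans (Factor.m₂₁ fac₁) m*φ1) (trans (Factor.m₂₁ fac₂) m*φ1)) (begin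
            z₂ * (m₁ * ρ₁)                            ≈⟨ trans (sym (*-assoc _ _ _)) (*-congʳ (sym PK≈)) ⟩
            P * K * ρ₁
              ≈⟨ solve 4 (λ P Y a r → P ⊗ (⋆ Y ⊗ ⋆ a) ⊗ r ≣ P ⊗ (⋆ Y ⊗ (⋆ a ⊗ r))) refl P (φ α) α ρ₁ ⟩
            P * (bar (φ α) * (bar α * ρ₁))            ≈⟨ *-congˡ (*-congˡ αρ₁≈) ⟩
            P * (bar (φ α) * (α * γ))                 ≈⟨ *-congˡ (sym (*-assoc _ _ _)) ⟩
            P * (bar (φ α) * α * γ)                   ∎)
            (sym (*-assoc _ _ _)))
          (trans (combine {s = K} {r = 1#} (eliminate (trans (Factor.m₁₁ fac₁) m*φ1) (trans (Factor.m₁₁ fac₂) m*φ1))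
            (sym (trans (*-congˡ (*-identityʳ K)) PK≈)) (sym (*-identityʳ _))) (*-congˡ (*-identityʳ _)))
      where
      open ShapeC S
      m*φ1 : ∀ {m} → m * φ 1# ≈ m
      m*φ1 = trans (*-congˡ φ-1) (*-identityʳ _)
      norm₁ : ∀ {x} → N 1# ≈ N x → x * bar x ≈ 1#
      norm₁ e = trans (sym e) N1≈1
      γ Z : Carrier
      γ = ρ₂
      Z = z₂ - z₁
      γ-norm = trans (*-comm _ _) (norm₁ ρ₂-norm)
      Z≉0 : ¬ Z ≈ 0#
      Z≉0 = x-y≉0 (λ e → z₁≉z₂ (sym e))
      -- The requirement ᾱ ρ₁ = α γ prescribes ᾱ / α = ρ₂ / ρ₁, which is ρ₂ ρ̄₁ because ρ₁ has norm
      -- 1.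
      α-spec = ∃-η {ρ₂ * bar ρ₁} (trans (solve 2 (λ r s → ⋆ (s ⊗ ⋆ r) ⊗ (s ⊗ ⋆ r) ≣ (s ⊗ ⋆ s) ⊗ (r ⊗ ⋆ r)) refl ρ₁ ρ₂)
        (trans (*-cong (norm₁ ρ₂-norm) (norm₁ ρ₁-norm)) (*-identityʳ 1#)))
      α = proj₁ α-spec
      α≉0 = proj₁ (proj₂ α-spec)
      barα≈ = proj₂ (proj₂ α-spec)
      αρ₁≈ : bar α * ρ₁ ≈ α * γ
      αρ₁≈ = trans (*-congʳ barα≈) (trans (solve 3 (λ r s a → s ⊗ ⋆ r ⊗ a ⊗ r ≣ r ⊗ ⋆ r ⊗ (a ⊗ s)) refl ρ₁ ρ₂ α)
        (trans (*-congʳ (norm₁ ρ₁-norm)) (*-identityˡ _)))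
      φαρ₁≈ : bar (φ α) * φ ρ₁ ≈ φ α * φ γ
      φαρ₁≈ = trans (*-congʳ (sym (φ-bar α))) (trans (sym (φ-* _ _)) (trans (φ-cong αρ₁≈) (φ-* _ _)))
      barα≉α : ¬ bar α ≈ α
      barα≉α e = ρ₁≉ρ₂ (*-cancelˡ α≉0 (trans (*-congʳ (sym e)) αρ₁≈))
      K P δ β : Carrier
      K = bar (φ α) * bar α
      P = z₂ * m₁ * K ⁻¹
      δ = P * Z ⁻¹
      β = - (z₁ * m₂) * P ⁻¹
      K≉0 : ¬ K ≈ 0#
      K≉0 = *-nonzero (bar-nonzero (φ-nonzero α≉0)) (bar-nonzero α≉0)
      unit-norm≉0 : ∀ {x} → N 1# ≈ N x → ¬ x ≈ 0#
      unit-norm≉0 e = *-nonzeroˡ (λ xx̄≈0 → 1≉0 (trans (sym (norm₁ e)) xx̄≈0))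
      PK≈ : P * K ≈ z₂ * m₁
      PK≈ = trans (*-assoc _ _ _) (trans (*-congˡ (*-inverseˡ K≉0)) (*-identityʳ _))
      P≉0 : ¬ P ≈ 0#
      P≉0 = *-nonzeroˡ (λ e → *-nonzero (unit-norm≉0 z₂-norm) m₁≉0 (trans (sym PK≈) e))
      Zδ≈P : Z * δ ≈ P
      Zδ≈P = trans (*-comm _ _) (trans (*-assoc _ _ _) (trans (*-congˡ (*-inverseˡ Z≉0)) (*-identityʳ _)))
      Pβ≈ : P * β ≈ - (z₁ * m₂)
      Pβ≈ = trans (*-comm _ _) (trans (*-assoc _ _ _) (trans (*-congˡ (*-inverseˡ P≉0)) (*-identityʳ _)))
      δ≉0 : ¬ δ ≈ 0#
      δ≉0 = *-nonzeroʳ (λ e → P≉0 (trans (sym Zδ≈P) e))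
      -- Cancels f̄ between the two twists: (z₂ - z₁) f = z₂ (f + z₁ f̄) - z₁ (f + z₂ f̄).
      eliminate : ∀ {x y r₁ r₂} → x + z₁ * y ≈ r₁ → x + z₂ * y ≈ r₂ → Z * x ≈ z₂ * r₁ - z₁ * r₂
      eliminate {x} {y} e₁ e₂ = trans (solve 4 (λ v w x y → (w ⊝ v) ⊗ x ≣ w ⊗ (x ⊕ v ⊗ y) ⊝ v ⊗ (x ⊕ w ⊗ y)) refl z₁ z₂ x y)
        (+-cong (*-congˡ e₁) (-‿cong (*-congˡ e₂)))
      combine : ∀ {x r₁ r₂ s r} → Z * x ≈ z₂ * r₁ - z₁ * r₂ → z₂ * r₁ ≈ P * (s * r) → z₁ * r₂ ≈ z₁ * m₂ * r → x ≈ δ * ((s + β) * r)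
      combine {x} {r₁} {r₂} {s} {r} e e₁ e₂ = *-cancelˡ Z≉0 (begin
        Z * x                             ≈⟨ e ⟩
        z₂ * r₁ - z₁ * r₂                 ≈⟨ +-cong e₁ (-‿cong e₂) ⟩
        P * (s * r) - z₁ * m₂ * r
          ≈⟨ solve 4 (λ P s r x → P ⊗ (s ⊗ r) ⊝ x ⊗ r ≣ P ⊗ (s ⊗ r) ⊕ (⊝ x) ⊗ r) refl P s r (z₁ * m₂) ⟩
        P * (s * r) + - (z₁ * m₂) * r     ≈⟨ +-congˡ (*-congʳ Pβ≈) ⟨
        P * (s * r) + P * β * r
          ≈⟨ solve 4 (λ P s b r → P ⊗ (s ⊗ r) ⊕ P ⊗ b ⊗ r ≣ P ⊗ ((s ⊕ b) ⊗ r)) refl P s β r ⟩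
        P * ((s + β) * r)                 ≈⟨ *-congʳ Zδ≈P ⟨
        Z * δ * ((s + β) * r)             ≈⟨ *-assoc _ _ _ ⟩
        Z * (δ * ((s + β) * r))           ∎)
      reflect : ∀ {z m ρ} → z * bar z ≈ 1# → Factor a b c d z m (m * ρ) (φ 1#) (φ ρ) → z * bar m ≈ m * ρ * φ ρ
      reflect {z} {m} {ρ} zz̄≈1 fac = begin
        z * bar m                       ≈⟨ *-congˡ (bar-cong (trans (sym m*φ1) (sym (Factor.m₁₁ fac)))) ⟩
        z * bar (d + z * bar a)
          ≈⟨ solve 3 (λ z a d → z ⊗ ⋆ (d ⊕ z ⊗ ⋆ a) ≣ z ⊗ ⋆ z ⊗ a ⊕ z ⊗ ⋆ d) refl z a d ⟩
        z * bar z * a + z * bar d       ≈⟨ +-congʳ (trans (*-congʳ zz̄≈1) (*-identityˡ a)) ⟩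
        a + z * bar d                   ≈⟨ Factor.m₂₂ fac ⟩
        m * ρ * φ ρ                     ∎
      z₂m₁β≈ : z₂ * m₁ * β ≈ - (z₁ * m₂) * K
      z₂m₁β≈ = trans (*-congʳ (sym PK≈)) (trans (solve 3 (λ P K b → P ⊗ K ⊗ b ≣ P ⊗ b ⊗ K) refl P K β) (*-congʳ Pβ≈))
      ρφρ≉0 : ¬ ρ₁ * φ ρ₁ ≈ 0#
      ρφρ≉0 = *-nonzero (unit-norm≉0 ρ₁-norm) (φ-nonzero (unit-norm≉0 ρ₁-norm))
      -- Obtained by conjugating `z₂m₁β≈` and applying `reflect` to both factorisations. Together
      -- the two give z₂ β = z₁ β̄, so that β is not fixed by `bar`, the roots being different.
      m₁β̄≈ : m₁ * bar β ≈ - m₂ * K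
      m₁β̄≈ = *-cancelˡ ρφρ≉0 (begin
        ρ₁ * φ ρ₁ * (m₁ * bar β)
          ≈⟨ solve 4 (λ r s m b → r ⊗ s ⊗ (m ⊗ ⋆ b) ≣ m ⊗ r ⊗ s ⊗ ⋆ b) refl ρ₁ (φ ρ₁) m₁ β ⟩
        m₁ * ρ₁ * φ ρ₁ * bar β              ≈⟨ *-congʳ (reflect (norm₁ z₁-norm) fac₁) ⟨
        z₁ * bar m₁ * bar β                 ≈⟨ *-identityˡ _ ⟨
        1# * (z₁ * bar m₁ * bar β)          ≈⟨ *-congʳ (norm₁ z₂-norm) ⟨
        z₂ * bar z₂ * (z₁ * bar m₁ * bar β)
          ≈⟨ solve 4 (λ w v m b → w ⊗ ⋆ w ⊗ (v ⊗ ⋆ m ⊗ ⋆ b) ≣ v ⊗ w ⊗ ⋆ (w ⊗ m ⊗ b)) refl z₂ z₁ m₁ β ⟩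
        z₁ * z₂ * bar (z₂ * m₁ * β)         ≈⟨ *-congˡ (bar-cong z₂m₁β≈) ⟩
        z₁ * z₂ * bar (- (z₁ * m₂) * K)     ≈⟨ solve 5 (λ w v m Y a → v ⊗ w ⊗ ⋆ ((⊝ (v ⊗ m)) ⊗ (⋆ Y ⊗ ⋆ a)) ≣
                                                 v ⊗ ⋆ v ⊗ (⊝ (w ⊗ ⋆ m) ⊗ (Y ⊗ a))) refl z₂ z₁ m₂ (φ α) α ⟩
        z₁ * bar z₁ * (- (z₂ * bar m₂) * (φ α * α))   ≈⟨ trans (*-congʳ (norm₁ z₁-norm)) (*-identityˡ _) ⟩
        - (z₂ * bar m₂) * (φ α * α)         ≈⟨ *-congʳ (-‿cong (reflect (norm₁ z₂-norm) fac₂)) ⟩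
        - (m₂ * ρ₂ * φ ρ₂) * (φ α * α)
          ≈⟨ solve 5 (λ m r s Y a → (⊝ (m ⊗ r ⊗ s)) ⊗ (Y ⊗ a) ≣ (⊝ m) ⊗ ((Y ⊗ s) ⊗ (a ⊗ r))) refl m₂ ρ₂ (φ ρ₂) (φ α) α ⟩
        - m₂ * ((φ α * φ γ) * (α * γ))      ≈⟨ *-congˡ (*-cong φαρ₁≈ αρ₁≈) ⟨
        - m₂ * ((bar (φ α) * φ ρ₁) * (bar α * ρ₁))
          ≈⟨ solve 5 (λ m r s Y a → (⊝ m) ⊗ ((⋆ Y ⊗ s) ⊗ (⋆ a ⊗ r)) ≣ r ⊗ s ⊗ ((⊝ m) ⊗ (⋆ Y ⊗ ⋆ a))) refl m₂ ρ₁ (φ ρ₁) (φ α) α ⟩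
        ρ₁ * φ ρ₁ * (- m₂ * K)              ∎)
      β≉0 : ¬ β ≈ 0#
      β≉0 e = -x≉0 (*-nonzero (unit-norm≉0 z₁-norm) m₂≉0) (trans (sym Pβ≈) (trans (*-congˡ e) (zeroʳ _)))
      barβ≉β : ¬ bar β ≈ β
      barβ≉β e = *-nonzero (*-nonzero m₁≉0 β≉0) Z≉0 (begin
        m₁ * β * (z₂ - z₁)
          ≈⟨ solve 4 (λ m b w v → m ⊗ b ⊗ (w ⊝ v) ≣ w ⊗ m ⊗ b ⊝ v ⊗ (m ⊗ b)) refl m₁ β z₂ z₁ ⟩
        z₂ * m₁ * β - z₁ * (m₁ * β)
          ≈⟨ +-cong z₂m₁β≈ (-‿cong (*-congˡ (trans (*-congˡ (sym e)) m₁β̄≈))) ⟩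
        - (z₁ * m₂) * K - z₁ * (- m₂ * K)
          ≈⟨ solve 3 (λ v m K → (⊝ (v ⊗ m)) ⊗ K ⊝ v ⊗ ((⊝ m) ⊗ K) ≣ 𝟘) refl z₁ m₂ K ⟩
        0#                                        ∎)

    necessity : (Trivial₁ × Case₁ a b c d) ⊎ (Trivial₂ × Case₂ a b c d) ⊎ (Trivial₃ × Case₃ a b c d)
    necessity = [ (λ S → inj₂ (inj₁ (FromA.trivial S , normalA S)))
                , [ (λ S → inj₂ (inj₂ (FromB.trivial S , normalB S)))
                  , (λ S → inj₁ (FromC.trivial S , normalC S)) ]′ ]′ classification

-- Sufficiency: the three families are injective on lines

module Sufficiency {u v} (p k ℓ : ℕ) (pr : Prime p) .{{_ : NonZero k}} .{{_ : NonZero ℓ}}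
  (F : FiniteField u v ((p ℕ.^ k) ℕ.^ 2)) where

  open FiniteField F hiding (zero)
  open QuadraticField p k ℓ pr F
  open FiniteFieldProperties F
  open LinearMaps p k ℓ pr F
  open Form p k ℓ pr F using (f)
  open NormalForms p k ℓ pr F
  open Algebra.Properties.Ring ring using (x∙y⁻¹≈ε⇒x≈y)
  open Relation.Binary.Reasoning.Setoid setoid

  private
    cross-* : ∀ h x y → cross (h * x) (h * y) ≈ N h * cross x y
    cross-* = solve 3 (λ h x y → (h ⊗ x) ⊗ ⋆ (h ⊗ y) ⊝ ⋆ (h ⊗ x) ⊗ (h ⊗ y) ≣ h ⊗ ⋆ h ⊗ (x ⊗ ⋆ y ⊝ ⋆ x ⊗ y)) refl

    *-∼ : ∀ h {x y} → x ∼ y → h * x ∼ h * y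
    *-∼ h e = trans (cross-* h _ _) (trans (*-congˡ e) (zeroʳ _))

    ∼-* : ∀ {h x y} → ¬ h ≈ 0# → h * x ∼ h * y → x ∼ y
    ∼-* h≉0 e = x*y≈0⇒y≈0 (*-nonzero h≉0 (bar-nonzero h≉0)) (trans (sym (cross-* _ _ _)) e)

    1≉norm : ∀ {x} → ¬ bar x * x ≈ 1# → ¬ N 1# ≈ N x
    1≉norm x-norm e = x-norm (trans (*-comm _ _) (trans (sym e) (solve 0 (𝟙 ⊗ ⋆ 𝟙 ≣ 𝟙) refl)))

  -- With γ = η̄ / η, replacing X by γ X is the substitution x ↦ η x up to the factor η φ(η).
  -- Multiplication by a nonzero element preserves and reflects `∼`.
  scaled-∼ : ∀ {a b c d γ δ a₀ b₀ c₀ d₀} → Scaled a b c d γ δ a₀ b₀ c₀ d₀ →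
    (∀ x y → f a₀ b₀ c₀ d₀ x ∼ f a₀ b₀ c₀ d₀ y → x ∼ y) → ∀ x y → f a b c d x ∼ f a b c d y → x ∼ y
  scaled-∼ {a} {b} {c} {d} {γ} {δ} {a₀} {b₀} {c₀} {d₀} (scaled γ-norm δ≉0 a≈ b≈ c≈ d≈) f₀-∼ x y e =
    ∼-* η≉0 (f₀-∼ (η * x) (η * y) (∼-* δ≉0 (trans (sym (cross-cong (f≈ x) (f≈ y))) (*-∼ (η * φ η) e))))
    where
    η-spec = ∃-η γ-norm
    η = proj₁ η-spec
    η≉0 = proj₁ (proj₂ η-spec)
    η̄≈ : bar η ≈ γ * η
    η̄≈ = proj₂ (proj₂ η-spec)
    φη̄≈ : bar (φ η) ≈ φ γ * φ η
    φη̄≈ = trans (sym (φ-bar η)) (trans (φ-cong η̄≈) (φ-* γ η))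
    f≈ : ∀ x → η * φ η * f a b c d x ≈ δ * f a₀ b₀ c₀ d₀ (η * x)
    f≈ x = begin
      η * φ η * f a b c d x
        ≈⟨ *-congˡ (+-cong (+-cong (+-cong (*-congʳ a≈) (*-congʳ b≈)) (*-congʳ c≈)) (*-congʳ d≈)) ⟩
      η * φ η * (δ * (a₀ * (φ γ * γ)) * (x̄ * X̄) + δ * (b₀ * φ γ) * (x * X̄) + δ * (c₀ * γ) * (x̄ * X) + δ * d₀ * (x * X))
        ≈⟨ ring-identity ⟩
      δ * (a₀ * ((γ * η * x̄) * (φ γ * φ η * X̄)) + b₀ * ((η * x) * (φ γ * φ η * X̄)) + c₀ * ((γ * η * x̄) * (φ η * X)) + d₀ * ((η * x) * (φ η * X)))
        ≈⟨ *-congˡ (+-cong (+-cong (+-cong (*-congˡ (*-cong x̄≈ X̄≈)) (*-congˡ (*-congˡ X̄≈))) (*-congˡ (*-cong x̄≈ X≈))) (*-congˡ (*-congˡ X≈))) ⟨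
      δ * f a₀ b₀ c₀ d₀ (η * x)   ∎
      where
      x̄ X X̄ : Carrier
      x̄ = bar x
      X = φ x
      X̄ = bar X
      x̄≈ : bar (η * x) ≈ γ * η * x̄
      x̄≈ = trans (bar-* η x) (*-congʳ η̄≈)
      X≈ : φ (η * x) ≈ φ η * X
      X≈ = φ-* η x
      X̄≈ : bar (φ (η * x)) ≈ φ γ * φ η * X̄
      X̄≈ = trans (bar-cong X≈) (trans (bar-* (φ η) X) (*-congʳ φη̄≈))
      ring-identity : η * φ η * (δ * (a₀ * (φ γ * γ)) * (x̄ * X̄) + δ * (b₀ * φ γ) * (x * X̄) + δ * (c₀ * γ) * (x̄ * X) + δ * d₀ * (x * X)) ≈
        δ * (a₀ * ((γ * η * x̄) * (φ γ * φ η * X̄)) + b₀ * ((η * x) * (φ γ * φ η * X̄)) + c₀ * ((γ * η * x̄) * (φ η * X)) + d₀ * ((η * x) * (φ η * X)))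
      ring-identity = trans (*-congˡ (+-cong (+-cong (+-cong
          (solve 6 (λ δ a g G x y → δ ⊗ (a ⊗ (G ⊗ g)) ⊗ (x ⊗ y) ≣ δ ⊗ (a ⊗ (g ⊗ x ⊗ (G ⊗ y)))) refl δ a₀ γ (φ γ) x̄ X̄)
          (solve 5 (λ δ b G x y → δ ⊗ (b ⊗ G) ⊗ (x ⊗ y) ≣ δ ⊗ (b ⊗ (x ⊗ (G ⊗ y)))) refl δ b₀ (φ γ) x X̄))
          (solve 5 (λ δ c g x y → δ ⊗ (c ⊗ g) ⊗ (x ⊗ y) ≣ δ ⊗ (c ⊗ (g ⊗ x ⊗ y))) refl δ c₀ γ x̄ X))
          (*-assoc δ d₀ _)))
        (trans (solve 7 (λ e E δ s t w z → e ⊗ E ⊗ (δ ⊗ s ⊕ δ ⊗ t ⊕ δ ⊗ w ⊕ δ ⊗ z) ≣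
                  δ ⊗ (e ⊗ E ⊗ s ⊕ e ⊗ E ⊗ t ⊕ e ⊗ E ⊗ w ⊕ e ⊗ E ⊗ z)) refl η (φ η) δ _ _ _ _)
        (*-congˡ (+-cong (+-cong (+-cong
          (solve 7 (λ e E a g G x y → e ⊗ E ⊗ (a ⊗ (g ⊗ x ⊗ (G ⊗ y))) ≣ a ⊗ (g ⊗ e ⊗ x ⊗ (G ⊗ E ⊗ y))) refl η (φ η) a₀ γ (φ γ) x̄ X̄)
          (solve 6 (λ e E b G x y → e ⊗ E ⊗ (b ⊗ (x ⊗ (G ⊗ y))) ≣ b ⊗ (e ⊗ x ⊗ (G ⊗ E ⊗ y))) refl η (φ η) b₀ (φ γ) x X̄))
          (solve 6 (λ e E c g x y → e ⊗ E ⊗ (c ⊗ (g ⊗ x ⊗ y)) ≣ c ⊗ (g ⊗ e ⊗ x ⊗ (E ⊗ y))) refl η (φ η) c₀ γ x̄ X))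
          (solve 5 (λ e E d x y → e ⊗ E ⊗ (d ⊗ (x ⊗ y)) ≣ d ⊗ (e ⊗ x ⊗ (E ⊗ y))) refl η (φ η) d₀ x X))))

  module Ratio {w : Carrier} (w≉0 : ¬ w ≈ 0#) where
    private
      i : Carrier
      i = bar w ⁻¹
      w̄i≈1 : bar w * i ≈ 1#
      w̄i≈1 = *-inverseʳ (bar-nonzero w≉0)

    -- The quotient w / w̄, which is 1 just when w lies in K; it turns membership of monomials of w
    -- in K into equations on the unit circle.
    ζ : Carrier
    ζ = w * i

    ζw̄≈w : ζ * bar w ≈ w
    ζw̄≈w = trans (solve 2 (λ w i → w ⊗ i ⊗ ⋆ w ≣ w ⊗ (⋆ w ⊗ i)) refl w i) (trans (*-congˡ w̄i≈1) (*-identityʳ w))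

    φζφw̄≈φw : φ ζ * bar (φ w) ≈ φ w
    φζφw̄≈φw = trans (*-congˡ (sym (φ-bar w))) (trans (sym (φ-* ζ (bar w))) (φ-cong ζw̄≈w))

    ζ-norm : bar ζ * ζ ≈ 1#
    ζ-norm = begin
      bar (w * i) * (w * i)         ≈⟨ solve 2 (λ w i → ⋆ (w ⊗ i) ⊗ (w ⊗ i) ≣ (⋆ w ⊗ i) ⊗ ⋆ (⋆ w ⊗ i)) refl w i ⟩
      bar w * i * bar (bar w * i)   ≈⟨ *-cong w̄i≈1 (trans (bar-cong w̄i≈1) bar-1) ⟩
      1# * 1#                       ≈⟨ *-identityʳ 1# ⟩
      1#                            ∎

    ζ≈1⇒ : ζ ≈ 1# → w ≈ bar w
    ζ≈1⇒ e = trans (sym ζw̄≈w) (trans (*-congʳ e) (*-identityˡ _))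

  fixed-if : ∀ {w} → (¬ w ≈ 0# → w ≈ bar w) → w ≈ bar w
  fixed-if {w} e with w ≟ 0#
  ... | yes w≈0 = trans w≈0 (sym (trans (bar-cong w≈0) bar-0))
  ... | no w≉0  = e w≉0

  ∼-from-fixed : ∀ {s t} → s * bar t ≈ bar (s * bar t) → s ∼ t
  ∼-from-fixed {s} {t} e = trans (+-congˡ (-‿cong (sym (trans e (solve 2 (λ s t → ⋆ (s ⊗ ⋆ t) ≣ ⋆ s ⊗ t) refl s t))))) (-‿inverseʳ _)

  -- For w = s t̄ the goal says w ∈ K and the hypothesis w φ(w) ∈ K. In terms of ζ = w / w̄ this is
  -- ζ^(Q+1) = 1 against ζ = 1.
  monomial₂ : Trivial₂ → ∀ s t → s * φ s ∼ t * φ t → s ∼ t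
  monomial₂ trivial s t e = ∼-from-fixed (fixed-if λ w≉0 → let open Ratio w≉0 in
    ζ≈1⇒ (trivial ζ ζ-norm (*-cancelˡ (*-nonzero (bar-nonzero w≉0) (bar-nonzero (φ-nonzero w≉0))) (begin
      bar w * bar (φ w) * (φ ζ * ζ)
        ≈⟨ solve 4 (λ w W z Z → ⋆ w ⊗ ⋆ W ⊗ (Z ⊗ z) ≣ (z ⊗ ⋆ w) ⊗ (Z ⊗ ⋆ W)) refl w (φ w) ζ (φ ζ) ⟩
      (ζ * bar w) * (φ ζ * bar (φ w))       ≈⟨ *-cong ζw̄≈w φζφw̄≈φw ⟩
      w * φ w
        ≈⟨ x∙y⁻¹≈ε⇒x≈y _ _ (trans (+-cong (*-congˡ φw≈) (-‿cong (*-congˡ (bar-cong φw≈)))) (trans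
        (solve 4 (λ s S t T → s ⊗ ⋆ t ⊗ (S ⊗ ⋆ T) ⊝ ⋆ (s ⊗ ⋆ t) ⊗ ⋆ (S ⊗ ⋆ T) ≣ (s ⊗ S) ⊗ ⋆ (t ⊗ T) ⊝ ⋆ (s ⊗ S) ⊗ (t ⊗ T)) refl s (φ s) t (φ t)) e)) ⟩
      bar w * bar (φ w)                     ≈⟨ *-identityʳ _ ⟨
      bar w * bar (φ w) * 1#                ∎))))
    where
    w : Carrier
    w = s * bar t
    φw≈ : φ w ≈ φ s * bar (φ t)
    φw≈ = trans (φ-* s (bar t)) (*-congˡ (φ-bar t))

  -- As before with w = s t̄, except that now w̄ φ(w) ∈ K, which says φ(ζ) = ζ.
  monomial₃ : Trivial₃ → ∀ s t → bar s * φ s ∼ bar t * φ t → s ∼ t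
  monomial₃ trivial s t e = ∼-from-fixed (fixed-if λ w≉0 → let open Ratio w≉0 in
    ζ≈1⇒ (trivial ζ ζ-norm (*-cancelˡ (*-nonzero (bar-nonzero w≉0) (bar-nonzero (φ-nonzero w≉0))) (begin
      bar w * bar (φ w) * φ ζ
        ≈⟨ solve 3 (λ w W Z → ⋆ w ⊗ ⋆ W ⊗ Z ≣ ⋆ w ⊗ (Z ⊗ ⋆ W)) refl w (φ w) (φ ζ) ⟩
      bar w * (φ ζ * bar (φ w))             ≈⟨ *-congˡ φζφw̄≈φw ⟩
      bar w * φ w
        ≈⟨ x∙y⁻¹≈ε⇒x≈y _ _ (trans (+-cong (*-congˡ φw≈) (-‿cong (*-congˡ (bar-cong φw≈)))) (trans
        (solve 4 (λ s S t T → ⋆ (s ⊗ ⋆ t) ⊗ (S ⊗ ⋆ T) ⊝ (s ⊗ ⋆ t) ⊗ ⋆ (S ⊗ ⋆ T) ≣ (⋆ s ⊗ S) ⊗ ⋆ (⋆ t ⊗ T) ⊝ ⋆ (⋆ s ⊗ S) ⊗ (⋆ t ⊗ T)) refl s (φ s) t (φ t)) e)) ⟩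
      w * bar (φ w)                         ≈⟨ *-congʳ ζw̄≈w ⟨
      ζ * bar w * bar (φ w)                 ≈⟨ solve 3 (λ w W z → z ⊗ ⋆ w ⊗ ⋆ W ≣ ⋆ w ⊗ ⋆ W ⊗ z) refl w (φ w) ζ ⟩
      bar w * bar (φ w) * ζ                 ∎))))
    where
    w : Carrier
    w = s * bar t
    φw≈ : φ w ≈ φ s * bar (φ t)
    φw≈ = trans (φ-* s (bar t)) (*-congˡ (φ-bar t))

  monomial₁ : Trivial₁ → ∀ s t → bar s ≈ s → bar t ≈ t → s * φ s ≈ t * φ t → s ≈ t
  monomial₁ trivial s t s̄≈s t̄≈t e with t ≟ 0#
  ... | yes t≈0 = trans ([ (λ z → z) , (λ φs≈0 → φ-injective (trans φs≈0 (sym φ-0))) ]′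
        (integral s (φ s) (trans e (trans (*-congʳ t≈0) (zeroˡ _))))) (sym t≈0)
  ... | no t≉0 = begin
    s                 ≈⟨ *-identityʳ s ⟨
    s * 1#            ≈⟨ *-congˡ ti≈1 ⟨
    s * (t * i)       ≈⟨ solve 3 (λ s t i → s ⊗ (t ⊗ i) ≣ t ⊗ (s ⊗ i)) refl s t i ⟩
    t * (s * i)       ≈⟨ *-congˡ (trivial (s * i) (trans (bar-* s i) (*-cong s̄≈s ī≈i)) (begin
      φ (s * i) * (s * i)           ≈⟨ *-congʳ (φ-* s i) ⟩
      φ s * φ i * (s * i)
        ≈⟨ solve 4 (λ s S i I → S ⊗ I ⊗ (s ⊗ i) ≣ s ⊗ S ⊗ (i ⊗ I)) refl s (φ s) i (φ i) ⟩
      s * φ s * (i * φ i)           ≈⟨ *-congʳ e ⟩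
      t * φ t * (i * φ i)
        ≈⟨ solve 4 (λ s S i I → s ⊗ S ⊗ (i ⊗ I) ≣ (s ⊗ i) ⊗ (S ⊗ I)) refl t (φ t) i (φ i) ⟩
      (t * i) * (φ t * φ i)         ≈⟨ *-cong ti≈1 (φ-ratio ti≈1) ⟩
      1# * 1#                       ≈⟨ *-identityʳ 1# ⟩
      1#                            ∎)) ⟩
    t * 1#            ≈⟨ *-identityʳ t ⟩
    t                 ∎
    where
    i : Carrier
    i = t ⁻¹
    ti≈1 = *-inverseʳ t≉0
    ī≈i : bar i ≈ i
    ī≈i = *-cancelˡ t≉0 (trans (*-congʳ (sym t̄≈t)) (trans (sym (bar-* t i)) (trans (bar-cong ti≈1) (trans bar-1 (sym ti≈1)))))

  -- Here `g` is sq P + β sq R with P and R valued in K, so `cross (g x) (g y)` is β̄ - β times the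
  -- determinant of the values of sq P and sq R at x and y. Its vanishing equates the (Q+1)-st
  -- powers of P x R y and P y R x, hence these elements of K themselves, and their difference is (ᾱ
  -- - α) `cross x y`.
  sufficiency₁ : ∀ {a b c d} → Trivial₁ → Case₁ a b c d → ∀ x y → f a b c d x ∼ f a b c d y → x ∼ y
  sufficiency₁ trivial (α , β , ᾱ≉α , β̄≉β , γ , δ , s) = scaled-∼ s λ x y e →
    x*y≈0⇒y≈0 (x-y≉0 ᾱ≉α) (begin
      (bar α - α) * cross x y
        ≈⟨ solve 3 (λ a x y → (⋆ a ⊝ a) ⊗ (x ⊗ ⋆ y ⊝ ⋆ x ⊗ y) ≣
             (⋆ a ⊗ x ⊕ a ⊗ ⋆ x) ⊗ (y ⊕ ⋆ y) ⊝ (⋆ a ⊗ y ⊕ a ⊗ ⋆ y) ⊗ (x ⊕ ⋆ x)) refl α x y ⟩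
      P x * R y - P y * R x
        ≈⟨ +-congʳ (monomial₁ trivial (P x * R y) (P y * R x) (fixed-* (P-fixed x) (R-fixed y)) (fixed-* (P-fixed y) (R-fixed x))
        (x∙y⁻¹≈ε⇒x≈y _ _ (x*y≈0⇒y≈0 (x-y≉0 β̄≉β) (begin
          (bar β - β) * (P x * R y * φ (P x * R y) - P y * R x * φ (P y * R x))
            ≈⟨ *-congˡ (+-cong (*-congˡ (φ-* (P x) (R y))) (-‿cong (*-congˡ (φ-* (P y) (R x))))) ⟩
          (bar β - β) * (P x * R y * (φ (P x) * φ (R y)) - P y * R x * (φ (P y) * φ (R x)))
            ≈⟨ *-congˡ (solve 8 (λ a b c d A B C′ D → a ⊗ d ⊗ (A ⊗ D) ⊝ c ⊗ b ⊗ (C′ ⊗ B) ≣ (a ⊗ A) ⊗ (d ⊗ D) ⊝ (c ⊗ C′) ⊗ (b ⊗ B)) refl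
                 (P x) (R x) (P y) (R y) (φ (P x)) (φ (R x)) (φ (P y)) (φ (R y))) ⟩
          (bar β - β) * (sq (P x) * sq (R y) - sq (P y) * sq (R x))
            ≈⟨ solve 6 (λ b B A S U T → (B ⊝ b) ⊗ (A ⊗ T ⊝ U ⊗ S) ≣ (A ⊕ b ⊗ S) ⊗ (U ⊕ B ⊗ T) ⊝ (A ⊕ B ⊗ S) ⊗ (U ⊕ b ⊗ T)) refl
                 β (bar β) (sq (P x)) (sq (R x)) (sq (P y)) (sq (R y)) ⟩
          (sq (P x) + β * sq (R x)) * (sq (P y) + bar β * sq (R y)) - (sq (P x) + bar β * sq (R x)) * (sq (P y) + β * sq (R y))
            ≈⟨ +-cong (*-cong (f≈ x) (f̄≈ y)) (-‿cong (*-cong (f̄≈ x) (f≈ y))) ⟨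
          cross (g x) (g y)   ≈⟨ e ⟩
          0#                  ∎)))) ⟩
      P y * R x - P y * R x     ≈⟨ -‿inverseʳ _ ⟩
      0#                        ∎)
    where
    P R sq : Carrier → Carrier
    P x = bar α * x + α * bar x
    R x = x + bar x
    sq s = s * φ s
    P-fixed : ∀ x → bar (P x) ≈ P x
    P-fixed = solve 2 (λ a x → ⋆ (⋆ a ⊗ x ⊕ a ⊗ ⋆ x) ≣ ⋆ a ⊗ x ⊕ a ⊗ ⋆ x) refl α
    R-fixed : ∀ x → bar (R x) ≈ R x
    R-fixed = solve 1 (λ x → ⋆ (x ⊕ ⋆ x) ≣ x ⊕ ⋆ x) refl
    fixed-* : ∀ {s t} → bar s ≈ s → bar t ≈ t → bar (s * t) ≈ s * t
    fixed-* e e′ = trans (bar-* _ _) (*-cong e e′)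
    φ-fixed : ∀ {s} → bar s ≈ s → bar (φ s) ≈ φ s
    φ-fixed e = trans (sym (φ-bar _)) (φ-cong e)
    g : Carrier → Carrier
    g = f (φ α * α + β) (bar α * φ α + β) (bar (φ α) * α + β) (bar (φ α) * bar α + β)
    φP≈ : ∀ x → φ (P x) ≈ bar (φ α) * φ x + φ α * bar (φ x)
    φP≈ x = trans (φ-+ _ _) (+-cong (trans (φ-* _ _) (*-congʳ (φ-bar α))) (trans (φ-* _ _) (*-congˡ (φ-bar x))))
    φR≈ : ∀ x → φ (R x) ≈ φ x + bar (φ x)
    φR≈ x = trans (φ-+ _ _) (+-congˡ (φ-bar x))
    f≈ : ∀ x → g x ≈ sq (P x) + β * sq (R x)
    f≈ x = sym (trans (+-cong (*-congˡ (φP≈ x)) (*-congˡ (*-congˡ (φR≈ x))))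
      (solve 5 (λ a A b x X → (⋆ a ⊗ x ⊕ a ⊗ ⋆ x) ⊗ (⋆ A ⊗ X ⊕ A ⊗ ⋆ X) ⊕ b ⊗ ((x ⊕ ⋆ x) ⊗ (X ⊕ ⋆ X)) ≣
        (A ⊗ a ⊕ b) ⊗ (⋆ x ⊗ ⋆ X) ⊕ (⋆ a ⊗ A ⊕ b) ⊗ (x ⊗ ⋆ X) ⊕ (⋆ A ⊗ a ⊕ b) ⊗ (⋆ x ⊗ X) ⊕ (⋆ A ⊗ ⋆ a ⊕ b) ⊗ (x ⊗ X))
        refl α (φ α) β x (φ x)))
    f̄≈ : ∀ x → bar (g x) ≈ sq (P x) + bar β * sq (R x)
    f̄≈ x = trans (bar-cong (f≈ x)) (trans (bar-+ _ _) (+-cong (fixed-* (P-fixed x) (φ-fixed (P-fixed x)))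
      (trans (bar-* _ _) (*-congˡ (fixed-* (R-fixed x) (φ-fixed (R-fixed x)))))))

  -- In the general case f is s ↦ s φ(s) between the maps x ↦ x + ᾱ x̄ and s ↦ s + β s̄, which are
  -- bijections since N α and N β differ from 1. In the monomial case f is the conjugate of x φ(x),
  -- which only changes the sign of `cross`.
  sufficiency₂ : ∀ {a b c d} → Trivial₂ → Case₂ a b c d → ∀ x y → f a b c d x ∼ f a b c d y → x ∼ y
  sufficiency₂ trivial (inj₁ (γ , δ , s)) = scaled-∼ s λ x y e → monomial₂ trivial x y (begin
    cross (x * φ x) (y * φ y)
      ≈⟨ solve 4 (λ x X y Y → let g = λ x X → 𝟙 ⊗ (⋆ x ⊗ ⋆ X) ⊕ 𝟘 ⊗ (x ⊗ ⋆ X) ⊕ 𝟘 ⊗ (⋆ x ⊗ X) ⊕ 𝟘 ⊗ (x ⊗ X) in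
           (x ⊗ X) ⊗ ⋆ (y ⊗ Y) ⊝ ⋆ (x ⊗ X) ⊗ (y ⊗ Y) ≣ ⊝ (g x X ⊗ ⋆ (g y Y) ⊝ ⋆ (g x X) ⊗ g y Y)) refl x (φ x) y (φ y) ⟩
    - cross (f 1# 0# 0# 0# x) (f 1# 0# 0# 0# y)     ≈⟨ -‿cong e ⟩
    - 0#                                            ≈⟨ solve 0 (⊝ 𝟘 ≣ 𝟘) refl ⟩
    0#                                              ∎)
  sufficiency₂ trivial (inj₂ (α , β , α-norm , β-norm , γ , δ , s)) = scaled-∼ s λ x y e →
    lin-∼ ᾱ-norm (monomial₂ trivial _ _ (lin-∼ (1≉norm β-norm) (trans (sym (cross-cong (f≈ x) (f≈ y))) e)))
    where
    ᾱ-norm : ¬ N 1# ≈ N (bar α)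
    ᾱ-norm = 1≉norm (λ e → α-norm (trans (*-comm _ _) (trans (*-congʳ (sym (bar-bar α))) e)))
    f≈ : ∀ x → f (bar (φ α) * bar α + β) (bar (φ α) + α * β) (bar α + φ α * β) (1# + φ α * α * β) x ≈
      lin 1# β (lin 1# (bar α) x * φ (lin 1# (bar α) x))
    f≈ x = sym (trans (lin-cong (*-congˡ (trans (φ-+ _ _) (+-cong (trans (φ-* _ _) (*-congʳ φ-1)) (trans (φ-* _ _) (*-cong (φ-bar α) (φ-bar x)))))))
      (solve 5 (λ a A b x X → let s = (𝟙 ⊗ x ⊕ ⋆ a ⊗ ⋆ x) ⊗ (𝟙 ⊗ X ⊕ ⋆ A ⊗ ⋆ X) in 𝟙 ⊗ s ⊕ b ⊗ ⋆ s ≣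
        (⋆ A ⊗ ⋆ a ⊕ b) ⊗ (⋆ x ⊗ ⋆ X) ⊕ (⋆ A ⊕ a ⊗ b) ⊗ (x ⊗ ⋆ X) ⊕ (⋆ a ⊕ A ⊗ b) ⊗ (⋆ x ⊗ X) ⊕ (𝟙 ⊕ A ⊗ a ⊗ b) ⊗ (x ⊗ X))
        refl α (φ α) β x (φ x)))

  sufficiency₃ : ∀ {a b c d} → Trivial₃ → Case₃ a b c d → ∀ x y → f a b c d x ∼ f a b c d y → x ∼ y
  sufficiency₃ trivial (inj₁ (γ , δ , s)) = scaled-∼ s λ x y e → monomial₃ trivial x y (begin
    cross (bar x * φ x) (bar y * φ y)
      ≈⟨ solve 4 (λ x X y Y → let g = λ x X → 𝟘 ⊗ (⋆ x ⊗ ⋆ X) ⊕ 𝟙 ⊗ (x ⊗ ⋆ X) ⊕ 𝟘 ⊗ (⋆ x ⊗ X) ⊕ 𝟘 ⊗ (x ⊗ X) in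
           (⋆ x ⊗ X) ⊗ ⋆ (⋆ y ⊗ Y) ⊝ ⋆ (⋆ x ⊗ X) ⊗ (⋆ y ⊗ Y) ≣ ⊝ (g x X ⊗ ⋆ (g y Y) ⊝ ⋆ (g x X) ⊗ g y Y)) refl x (φ x) y (φ y) ⟩
    - cross (f 0# 1# 0# 0# x) (f 0# 1# 0# 0# y)     ≈⟨ -‿cong e ⟩
    - 0#                                            ≈⟨ solve 0 (⊝ 𝟘 ≣ 𝟘) refl ⟩
    0#                                              ∎)
  sufficiency₃ trivial (inj₂ (α , β , α-norm , β-norm , γ , δ , s)) = scaled-∼ s λ x y e →
    lin-∼ ᾱ-norm (monomial₃ trivial _ _ (lin-∼ (1≉norm β-norm) (trans (sym (cross-cong (f≈ x) (f≈ y))) e)))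
    where
    ᾱ-norm : ¬ N 1# ≈ N (bar α)
    ᾱ-norm = 1≉norm (λ e → α-norm (trans (*-comm _ _) (trans (*-congʳ (sym (bar-bar α))) e)))
    f≈ : ∀ x → f (bar (φ α) + bar α * β) (bar (φ α) * α + β) (1# + bar α * φ α * β) (α + φ α * β) x ≈
      lin 1# β (bar (lin 1# (bar α) x) * φ (lin 1# (bar α) x))
    f≈ x = sym (trans (lin-cong (*-congˡ (trans (φ-+ _ _) (+-cong (trans (φ-* _ _) (*-congʳ φ-1)) (trans (φ-* _ _) (*-cong (φ-bar α) (φ-bar x)))))))
      (solve 5 (λ a A b x X → let s = ⋆ (𝟙 ⊗ x ⊕ ⋆ a ⊗ ⋆ x) ⊗ (𝟙 ⊗ X ⊕ ⋆ A ⊗ ⋆ X) in 𝟙 ⊗ s ⊕ b ⊗ ⋆ s ≣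
        (⋆ A ⊕ ⋆ a ⊗ b) ⊗ (⋆ x ⊗ ⋆ X) ⊕ (⋆ A ⊗ a ⊕ b) ⊗ (x ⊗ ⋆ X) ⊕ (𝟙 ⊕ ⋆ a ⊗ A ⊗ b) ⊗ (⋆ x ⊗ X) ⊕ (a ⊕ A ⊗ b) ⊗ (x ⊗ X))
        refl α (φ α) β x (φ x)))

-- Evaluation and coefficients of polynomials

module PolynomialProperties {c ℓ} (R : CommutativeRing c ℓ) where
  open CommutativeRing R hiding (zero)
  open Polynomials R
  open Algebra.Properties.Semiring.Exp semiring
  open IntegerSolver R using (solve; _:=_; _:+_; _:*_; con)
  open Relation.Binary.Reasoning.Setoid setoid

  eval-cong : ∀ f {x y} → x ≈ y → eval f x ≈ eval f y
  eval-cong List.[]      e = refl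
  eval-cong (a List.∷ f) e = +-congˡ (*-cong e (eval-cong f e))

  eval-+ₚ : ∀ f g x → eval (f +ₚ g) x ≈ eval f x + eval g x
  eval-+ₚ List.[]      g            x = sym (+-identityˡ _)
  eval-+ₚ (a List.∷ f) List.[]      x = sym (+-identityʳ _)
  eval-+ₚ (a List.∷ f) (b List.∷ g) x = trans (+-congˡ (*-congˡ (eval-+ₚ f g x)))
    (solve 5 (λ a b x s t → (a :+ b) :+ x :* (s :+ t) := (a :+ x :* s) :+ (b :+ x :* t)) refl a b x (eval f x) (eval g x))

  eval-· : ∀ a f x → eval (a · f) x ≈ a * eval f x
  eval-· a List.[]      x = sym (zeroʳ a)
  eval-· a (b List.∷ f) x = trans (+-congˡ (*-congˡ (eval-· a f x)))
    (solve 4 (λ a b x s → a :* b :+ x :* (a :* s) := a :* (b :+ x :* s)) refl a b x (eval f x))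

  eval-*ₚ : ∀ f g x → eval (f *ₚ g) x ≈ eval f x * eval g x
  eval-*ₚ List.[]      g x = sym (zeroˡ _)
  eval-*ₚ (a List.∷ f) g x = begin
    eval (a · g +ₚ (0# List.∷ f *ₚ g)) x            ≈⟨ eval-+ₚ (a · g) (0# List.∷ f *ₚ g) x ⟩
    eval (a · g) x + (0# + x * eval (f *ₚ g) x)     ≈⟨ +-cong (eval-· a g x) (+-congˡ (*-congˡ (eval-*ₚ f g x))) ⟩
    a * eval g x + (0# + x * (eval f x * eval g x))
      ≈⟨ solve 4 (λ a x s t → a :* t :+ (con (+ 0) :+ x :* (s :* t)) := (a :+ x :* s) :* t) refl a x (eval f x) (eval g x) ⟩
    (a + x * eval f x) * eval g x                   ∎

  eval-∘ₚ : ∀ f g x → eval (f ∘ₚ g) x ≈ eval f (eval g x)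
  eval-∘ₚ List.[]      g x = refl
  eval-∘ₚ (a List.∷ f) g x = trans (eval-+ₚ List.[ a ] (g *ₚ (f ∘ₚ g)) x)
    (+-cong (trans (+-congˡ (zeroʳ x)) (+-identityʳ a)) (trans (eval-*ₚ g (f ∘ₚ g) x) (*-congˡ (eval-∘ₚ f g x))))

  eval-X^ : ∀ m x → eval (X^ m) x ≈ x ^ m
  eval-X^ ℕ.zero  x = trans (+-congˡ (zeroʳ x)) (+-identityʳ 1#)
  eval-X^ (suc m) x = trans (+-identityˡ _) (*-congˡ (eval-X^ m x))

  eval-quadrinomial : ∀ m a b c d x → eval (quadrinomial m a b c d) x ≈ a * x ^ (m ℕ.+ 1) + b * x ^ m + c * x ^ 1 + d * x ^ 0
  eval-quadrinomial m a b c d x = begin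
    eval (a · X^ (m ℕ.+ 1) +ₚ b · X^ m +ₚ c · X^ 1 +ₚ d · X^ 0) x
      ≈⟨ eval-+ₚ (a · X^ (m ℕ.+ 1) +ₚ b · X^ m +ₚ c · X^ 1) (d · X^ 0) x ⟩
    eval (a · X^ (m ℕ.+ 1) +ₚ b · X^ m +ₚ c · X^ 1) x + eval (d · X^ 0) x
      ≈⟨ +-congʳ (trans (eval-+ₚ (a · X^ (m ℕ.+ 1) +ₚ b · X^ m) (c · X^ 1) x) (+-congʳ (eval-+ₚ (a · X^ (m ℕ.+ 1)) (b · X^ m) x))) ⟩
    eval (a · X^ (m ℕ.+ 1)) x + eval (b · X^ m) x + eval (c · X^ 1) x + eval (d · X^ 0) x
      ≈⟨ +-cong (+-cong (+-cong (monomial a (m ℕ.+ 1)) (monomial b m)) (monomial c 1)) (monomial d 0) ⟩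
    a * x ^ (m ℕ.+ 1) + b * x ^ m + c * x ^ 1 + d * x ^ 0 ∎
    where
    monomial : ∀ a m → eval (a · X^ m) x ≈ a * x ^ m
    monomial a m = trans (eval-· a (X^ m) x) (*-congˡ (eval-X^ m x))

  coeff-+ₚ : ∀ f g i → coeff (f +ₚ g) i ≈ coeff f i + coeff g i
  coeff-+ₚ List.[]      g            i       = sym (+-identityˡ _)
  coeff-+ₚ (a List.∷ f) List.[]      i       = sym (+-identityʳ _)
  coeff-+ₚ (a List.∷ f) (b List.∷ g) ℕ.zero  = refl
  coeff-+ₚ (a List.∷ f) (b List.∷ g) (suc i) = coeff-+ₚ f g i

  coeff-· : ∀ a f i → coeff (a · f) i ≈ a * coeff f i
  coeff-· a List.[]      i       = sym (zeroʳ a)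
  coeff-· a (b List.∷ f) ℕ.zero  = refl
  coeff-· a (b List.∷ f) (suc i) = coeff-· a f i

  coeff-scale : ∀ γ f i → coeff (f ∘ₚ (γ · X^ 1)) i ≈ γ ^ i * coeff f i
  coeff-scale γ List.[]      i       = sym (zeroʳ _)
  coeff-scale γ (a List.∷ f) ℕ.zero  = begin
    coeff (List.[ a ] +ₚ (γ · X^ 1) *ₚ h) 0             ≈⟨ coeff-+ₚ List.[ a ] ((γ · X^ 1) *ₚ h) 0 ⟩
    a + coeff ((γ · X^ 1) *ₚ h) 0                       ≈⟨ +-congˡ (coeff-+ₚ ((γ * 0#) · h) _ 0) ⟩
    a + (coeff ((γ * 0#) · h) 0 + 0#)                   ≈⟨ +-congˡ (+-congʳ (coeff-· (γ * 0#) h 0)) ⟩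
    a + (γ * 0# * coeff h 0 + 0#)
      ≈⟨ solve 3 (λ a g h → a :+ (g :* con (+ 0) :* h :+ con (+ 0)) := con (+ 1) :* a) refl a γ (coeff h 0) ⟩
    1# * a                                              ∎
    where h = f ∘ₚ (γ · X^ 1)
  coeff-scale γ (a List.∷ f) (suc i) = begin
    coeff (List.[ a ] +ₚ (γ · X^ 1) *ₚ h) (suc i)       ≈⟨ coeff-+ₚ List.[ a ] ((γ · X^ 1) *ₚ h) (suc i) ⟩
    0# + coeff ((γ · X^ 1) *ₚ h) (suc i)                ≈⟨ +-congˡ (coeff-+ₚ ((γ * 0#) · h) _ (suc i)) ⟩
    0# + (coeff ((γ * 0#) · h) (suc i) + coeff ((γ * 1#) · h +ₚ List.[ 0# ]) i)
      ≈⟨ +-congˡ (+-cong (coeff-· (γ * 0#) h (suc i)) (trans (coeff-+ₚ ((γ * 1#) · h) List.[ 0# ] i) (+-cong (coeff-· (γ * 1#) h i) (coeff-[0] i)))) ⟩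
    0# + (γ * 0# * coeff h (suc i) + (γ * 1# * coeff h i + 0#))
      ≈⟨ +-congˡ (+-congˡ (+-congʳ (*-congˡ (coeff-scale γ f i)))) ⟩
    0# + (γ * 0# * coeff h (suc i) + (γ * 1# * (γ ^ i * coeff f i) + 0#))
      ≈⟨ solve 4 (λ g h s t → con (+ 0) :+ (g :* con (+ 0) :* h :+ (g :* con (+ 1) :* (s :* t) :+ con (+ 0))) := (g :* s) :* t) refl γ (coeff h (suc i)) (γ ^ i) (coeff f i) ⟩
    γ * γ ^ i * coeff f i                               ∎
    where
    h = f ∘ₚ (γ · X^ 1)
    coeff-[0] : ∀ i → coeff List.[ 0# ] i ≈ 0#
    coeff-[0] ℕ.zero  = refl
    coeff-[0] (suc i) = refl

  coeff-X^-≡ : ∀ m → coeff (X^ m) m ≈ 1#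
  coeff-X^-≡ ℕ.zero  = refl
  coeff-X^-≡ (suc m) = coeff-X^-≡ m

  coeff-X^-≢ : ∀ m i → m ≢ i → coeff (X^ m) i ≈ 0#
  coeff-X^-≢ ℕ.zero  ℕ.zero  m≢i = contradiction ≡.refl m≢i
  coeff-X^-≢ ℕ.zero  (suc i) m≢i = refl
  coeff-X^-≢ (suc m) ℕ.zero  m≢i = refl
  coeff-X^-≢ (suc m) (suc i) m≢i = coeff-X^-≢ m i (λ e → m≢i (≡.cong suc e))

  -- Either i = m, or the coefficient is 0 and the power in front is immaterial. This exchanges the
  -- position-dependent factor of a scaled polynomial for a constant one.
  ^*coeff-X^ : ∀ γ m i → γ ^ i * coeff (X^ m) i ≈ γ ^ m * coeff (X^ m) i
  ^*coeff-X^ γ m i with m ℕ.≟ i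
  ... | yes ≡.refl = refl
  ... | no m≢i     = trans (*-congˡ z) (trans (zeroʳ _) (sym (trans (*-congˡ z) (zeroʳ _))))
    where z = coeff-X^-≢ m i m≢i

  module _ (m : ℕ) where
    coeff-quadrinomial : ∀ a b c d i → coeff (quadrinomial m a b c d) i ≈
      a * coeff (X^ (m ℕ.+ 1)) i + b * coeff (X^ m) i + c * coeff (X^ 1) i + d * coeff (X^ 0) i
    coeff-quadrinomial a b c d i = trans (coeff-+ₚ (a · X^ (m ℕ.+ 1) +ₚ b · X^ m +ₚ c · X^ 1) (d · X^ 0) i)
      (+-cong (trans (coeff-+ₚ (a · X^ (m ℕ.+ 1) +ₚ b · X^ m) (c · X^ 1) i)
        (+-cong (trans (coeff-+ₚ (a · X^ (m ℕ.+ 1)) (b · X^ m) i)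
          (+-cong (coeff-· a (X^ (m ℕ.+ 1)) i) (coeff-· b (X^ m) i))) (coeff-· c (X^ 1) i))) (coeff-· d (X^ 0) i))

    quadrinomial-cong : ∀ {a b c d a′ b′ c′ d′} → a ≈ a′ → b ≈ b′ → c ≈ c′ → d ≈ d′ →
      quadrinomial m a b c d ≈ₚ quadrinomial m a′ b′ c′ d′
    quadrinomial-cong a≈ b≈ c≈ d≈ i = trans (coeff-quadrinomial _ _ _ _ i)
      (trans (+-cong (+-cong (+-cong (*-congʳ a≈) (*-congʳ b≈)) (*-congʳ c≈)) (*-congʳ d≈)) (sym (coeff-quadrinomial _ _ _ _ i)))

    quadrinomial-1000 : quadrinomial m 1# 0# 0# 0# ≈ₚ X^ (m ℕ.+ 1)
    quadrinomial-1000 i = trans (coeff-quadrinomial _ _ _ _ i)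
      (solve 4 (λ w x y z → con (+ 1) :* w :+ con (+ 0) :* x :+ con (+ 0) :* y :+ con (+ 0) :* z := w) refl
        (coeff (X^ (m ℕ.+ 1)) i) (coeff (X^ m) i) (coeff (X^ 1) i) (coeff (X^ 0) i))

    quadrinomial-0100 : quadrinomial m 0# 1# 0# 0# ≈ₚ X^ m
    quadrinomial-0100 i = trans (coeff-quadrinomial _ _ _ _ i)
      (solve 4 (λ w x y z → con (+ 0) :* w :+ con (+ 1) :* x :+ con (+ 0) :* y :+ con (+ 0) :* z := x) refl
        (coeff (X^ (m ℕ.+ 1)) i) (coeff (X^ m) i) (coeff (X^ 1) i) (coeff (X^ 0) i))

    -- `A₀` is an arbitrary list that may carry trailing zeros, so it is compared with the
    -- quadrinomial one coefficient at a time, after the composite has been resolved by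
    -- `coeff-scale`.
    scale-quadrinomial : ∀ γ δ a b c d A₀ → A₀ ≈ₚ quadrinomial m a b c d →
      δ · (A₀ ∘ₚ (γ · X^ 1)) ≈ₚ quadrinomial m (δ * (a * γ ^ (m ℕ.+ 1))) (δ * (b * γ ^ m)) (δ * (c * γ ^ 1)) (δ * (d * γ ^ 0))
    scale-quadrinomial γ δ a b c d A₀ A₀≈ i = begin
      coeff (δ · (A₀ ∘ₚ (γ · X^ 1))) i
        ≈⟨ trans (coeff-· δ (A₀ ∘ₚ (γ · X^ 1)) i) (*-congˡ (trans (coeff-scale γ A₀ i) (*-congˡ (A₀≈ i)))) ⟩
      δ * (γ ^ i * coeff (quadrinomial m a b c d) i)  ≈⟨ *-congˡ (*-congˡ (coeff-quadrinomial a b c d i)) ⟩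
      δ * (γ ^ i * (a * e₁ + b * e₂ + c * e₃ + d * e₄))
        ≈⟨ solve 10 (λ δ g a b c d e₁ e₂ e₃ e₄ → δ :* (g :* (a :* e₁ :+ b :* e₂ :+ c :* e₃ :+ d :* e₄)) :=
             δ :* a :* (g :* e₁) :+ δ :* b :* (g :* e₂) :+ δ :* c :* (g :* e₃) :+ δ :* d :* (g :* e₄)) refl δ (γ ^ i) a b c d e₁ e₂ e₃ e₄ ⟩
      δ * a * (γ ^ i * e₁) + δ * b * (γ ^ i * e₂) + δ * c * (γ ^ i * e₃) + δ * d * (γ ^ i * e₄)
        ≈⟨ +-cong (+-cong (+-cong (term a (m ℕ.+ 1)) (term b m)) (term c 1)) (term d 0) ⟩
      δ * (a * γ ^ (m ℕ.+ 1)) * e₁ + δ * (b * γ ^ m) * e₂ + δ * (c * γ ^ 1) * e₃ + δ * (d * γ ^ 0) * e₄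
        ≈⟨ coeff-quadrinomial _ _ _ _ i ⟨
      coeff (quadrinomial m (δ * (a * γ ^ (m ℕ.+ 1))) (δ * (b * γ ^ m)) (δ * (c * γ ^ 1)) (δ * (d * γ ^ 0))) i ∎
      where
      e₁ e₂ e₃ e₄ : Carrier
      e₁ = coeff (X^ (m ℕ.+ 1)) i
      e₂ = coeff (X^ m) i
      e₃ = coeff (X^ 1) i
      e₄ = coeff (X^ 0) i
      term : ∀ a m → δ * a * (γ ^ i * coeff (X^ m) i) ≈ δ * (a * γ ^ m) * coeff (X^ m) i
      term a m = trans (*-congˡ (^*coeff-X^ γ m i)) (solve 4 (λ δ a g e → δ :* a :* (g :* e) := δ :* (a :* g) :* e) refl δ a (γ ^ m) (coeff (X^ m) i))

    -- The bound keeps the exponents 0, 1, m and m + 1 distinct, so that reading off one coefficient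
    -- isolates one parameter.
    quadrinomial-injective : 1 ℕ.< m → ∀ {a b c d a′ b′ c′ d′} → quadrinomial m a b c d ≈ₚ quadrinomial m a′ b′ c′ d′ →
      (a ≈ a′) × (b ≈ b′) × (c ≈ c′) × (d ≈ d′)
    quadrinomial-injective 1<m {a} {b} {c} {d} {a′} {b′} {c′} {d′} e =
      at (m ℕ.+ 1) 1# 0# 0# 0# (coeff-X^-≡ (m ℕ.+ 1)) (coeff-X^-≢ _ _ m≢m+1) (coeff-X^-≢ _ _ 1≢m+1) (coeff-X^-≢ _ _ 0≢m+1) first ,
      at m 0# 1# 0# 0# (coeff-X^-≢ _ _ (m≢m+1 ∘ ≡.sym)) (coeff-X^-≡ m) (coeff-X^-≢ _ _ (ℕ.<⇒≢ 1<m)) (coeff-X^-≢ _ _ 0≢m) second ,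
      at 1 0# 0# 1# 0# (coeff-X^-≢ _ _ (1≢m+1 ∘ ≡.sym)) (coeff-X^-≢ _ _ (ℕ.<⇒≢ 1<m ∘ ≡.sym)) (coeff-X^-≡ 1) (coeff-X^-≢ 0 1 (λ ())) third ,
      at 0 0# 0# 0# 1# (coeff-X^-≢ _ _ (0≢m+1 ∘ ≡.sym)) (coeff-X^-≢ _ _ (0≢m ∘ ≡.sym)) (coeff-X^-≢ 1 0 (λ ())) (coeff-X^-≡ 0) fourth
      where
      m≢m+1 : m ≢ m ℕ.+ 1
      m≢m+1 e = ℕ.<⇒≢ (ℕ.n<1+n m) (≡.trans e (ℕ.+-comm m 1))
      1≢m+1 : 1 ≢ m ℕ.+ 1
      1≢m+1 = ℕ.<⇒≢ (ℕ.<-≤-trans 1<m (ℕ.m≤m+n m 1))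
      0≢m : 0 ≢ m
      0≢m = ℕ.<⇒≢ (ℕ.<-trans (s≤s z≤n) 1<m)
      0≢m+1 : 0 ≢ m ℕ.+ 1
      0≢m+1 = ℕ.<⇒≢ (ℕ.<-≤-trans (ℕ.<-trans (s≤s z≤n) 1<m) (ℕ.m≤m+n m 1))
      at : ∀ i w x y z {s : Carrier → Carrier → Carrier → Carrier → Carrier} →
        coeff (X^ (m ℕ.+ 1)) i ≈ w → coeff (X^ m) i ≈ x → coeff (X^ 1) i ≈ y → coeff (X^ 0) i ≈ z →
        (∀ a b c d → a * w + b * x + c * y + d * z ≈ s a b c d) → s a b c d ≈ s a′ b′ c′ d′
      at i w x y z e₁ e₂ e₃ e₄ pick = trans (sym (value a b c d)) (trans (e i) (value a′ b′ c′ d′))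
        where
        value : ∀ a b c d → coeff (quadrinomial m a b c d) i ≈ _
        value a b c d = trans (coeff-quadrinomial a b c d i)
          (trans (+-cong (+-cong (+-cong (*-congˡ e₁) (*-congˡ e₂)) (*-congˡ e₃)) (*-congˡ e₄)) (pick a b c d))
      first : ∀ a b c d → a * 1# + b * 0# + c * 0# + d * 0# ≈ a
      first = solve 4 (λ a b c d → a :* con (+ 1) :+ b :* con (+ 0) :+ c :* con (+ 0) :+ d :* con (+ 0) := a) refl
      second : ∀ a b c d → a * 0# + b * 1# + c * 0# + d * 0# ≈ b
      second = solve 4 (λ a b c d → a :* con (+ 0) :+ b :* con (+ 1) :+ c :* con (+ 0) :+ d :* con (+ 0) := b) refl
      third : ∀ a b c d → a * 0# + b * 0# + c * 1# + d * 0# ≈ c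
      third = solve 4 (λ a b c d → a :* con (+ 0) :+ b :* con (+ 0) :+ c :* con (+ 1) :+ d :* con (+ 0) := c) refl
      fourth : ∀ a b c d → a * 0# + b * 0# + c * 0# + d * 1# ≈ d
      fourth = solve 4 (λ a b c d → a :* con (+ 0) :+ b :* con (+ 0) :+ c :* con (+ 0) :+ d :* con (+ 1) := d) refl

-- The permutation polynomial compared with f on lines

module Permutation {u v} (p k ℓ r : ℕ) (pr : Prime p) .{{_ : NonZero k}} .{{_ : NonZero ℓ}} .{{r≢0 : NonZero r}}
  (r≡ : r % (1 ℕ.+ p ℕ.^ k) ≡ (p ℕ.^ ℓ ℕ.+ 1) % (1 ℕ.+ p ℕ.^ k))
  (F : FiniteField u v ((p ℕ.^ k) ℕ.^ 2)) (a b c d : FiniteField.Carrier F) where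

  open FiniteField F hiding (zero)
  open QuadraticField p k ℓ pr F
  open FiniteFieldProperties F
  open LinearMaps p k ℓ pr F
  open Form p k ℓ pr F a b c d using (f; f-0)
  open Polynomials commutativeRing
  open PolynomialProperties commutativeRing
  open Algebra.Properties.Ring ring using (x∙y⁻¹≈ε⇒x≈y)
  open Algebra.Properties.Semiring.Exp semiring hiding (_^_)
  open Algebra.Properties.CommutativeSemiring.Exp commutativeSemiring using (^-distrib-*)
  open Relation.Binary.Reasoning.Setoid setoid

  A : Carrier → Carrier
  A = eval (quadrinomial Q a b c d)

  G : Carrier → Carrier
  G = eval (X^ r *ₚ (quadrinomial Q a b c d ∘ₚ X^ (q ∸ 1)))

  G≈ : ∀ x → G x ≈ x ^ r * A (x ^ (q ∸ 1))
  G≈ x = trans (eval-*ₚ (X^ r) (quadrinomial Q a b c d ∘ₚ X^ (q ∸ 1)) x) (*-cong (eval-X^ r x)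
    (trans (eval-∘ₚ (quadrinomial Q a b c d) (X^ (q ∸ 1)) x) (eval-cong (quadrinomial Q a b c d) (eval-X^ (q ∸ 1) x))))

  G-cong : ∀ {x y} → x ≈ y → G x ≈ G y
  G-cong = eval-cong (X^ r *ₚ (quadrinomial Q a b c d ∘ₚ X^ (q ∸ 1)))

  G-0 : ∀ {x} → x ≈ 0# → G x ≈ 0#
  G-0 {x} x≈0 = trans (G≈ x) (trans (*-congʳ (trans (^-congˡ r x≈0) (0^ r))) (zeroˡ _))

  -- x · x^(q-1) is x̄, so the factor x^(Q+1) homogenises A in x and x̄.
  f≈ : ∀ x → f x ≈ x ^ (Q ℕ.+ 1) * A (x ^ (q ∸ 1))
  f≈ x = sym (begin
    x ^ (Q ℕ.+ 1) * A z
      ≈⟨ *-cong (trans (^-homo-* x Q 1) (*-congˡ (*-identityʳ x)))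
           (trans (eval-quadrinomial Q a b c d z) (+-cong (+-cong (+-congʳ (*-congˡ (trans (^-homo-* z Q 1) (*-congˡ (*-identityʳ z)))))
             (*-congˡ (*-identityʳ z))) (*-identityʳ d))) ⟩
    φ x * x * (a * (φ z * z) + b * φ z + c * z + d)
      ≈⟨ solve 8 (λ a b c d x X z Z → X ⊗ x ⊗ (a ⊗ (Z ⊗ z) ⊕ b ⊗ Z ⊕ c ⊗ z ⊕ d) ≣
           a ⊗ ((x ⊗ z) ⊗ (X ⊗ Z)) ⊕ b ⊗ (x ⊗ (X ⊗ Z)) ⊕ c ⊗ ((x ⊗ z) ⊗ X) ⊕ d ⊗ (x ⊗ X)) refl a b c d x (φ x) z (φ z) ⟩
    a * ((x * z) * (φ x * φ z)) + b * (x * (φ x * φ z)) + c * ((x * z) * φ x) + d * (x * φ x)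
      ≈⟨ +-congʳ (+-cong (+-cong (*-congˡ (*-cong xz≈ XZ≈)) (*-congˡ (*-congˡ XZ≈))) (*-congˡ (*-congʳ xz≈))) ⟩
    f x ∎)
    where
    z : Carrier
    z = x ^ (q ∸ 1)
    xz≈ : x * z ≈ bar x
    xz≈ = ^-congʳ x suc-pred-q
    XZ≈ : φ x * φ z ≈ bar (φ x)
    XZ≈ = trans (sym (φ-* x z)) (trans (φ-cong xz≈) (φ-bar x))

  private
    e₁ e₂ : ℕ
    e₁ = r ℕ./ (1 ℕ.+ q)
    e₂ = (Q ℕ.+ 1) ℕ./ (1 ℕ.+ q)

    exponents : (1 ℕ.+ q) ℕ.* e₂ ℕ.+ r ≡ (1 ℕ.+ q) ℕ.* e₁ ℕ.+ (Q ℕ.+ 1)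
    exponents = ≡.trans (≡.cong ((1 ℕ.+ q) ℕ.* e₂ ℕ.+_) (m≡m%n+[m/n]*n r (1 ℕ.+ q)))
      (≡.trans (rearrange (r % (1 ℕ.+ q)) (1 ℕ.+ q) e₁ e₂)
      (≡.cong ((1 ℕ.+ q) ℕ.* e₁ ℕ.+_) (≡.trans (≡.cong (ℕ._+ e₂ ℕ.* (1 ℕ.+ q)) r≡) (≡.sym (m≡m%n+[m/n]*n (Q ℕ.+ 1) (1 ℕ.+ q))))))
      where
      rearrange : ∀ s m x y → m ℕ.* y ℕ.+ (s ℕ.+ x ℕ.* m) ≡ m ℕ.* x ℕ.+ (s ℕ.+ y ℕ.* m)
      rearrange = S.solve 4 (λ s m x y → m S.:* y S.:+ (s S.:+ x S.:* m) S.:= m S.:* x S.:+ (s S.:+ y S.:* m)) ≡.refl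
        where module S = ℕSolver.+-*-Solver

  -- Powers of the norm x^(q+1), hence elements of K. The exponents r and Q + 1 differ by a multiple
  -- of q + 1 of either sign, so one such power stands on each side of `n₂G≈n₁f`.
  n₁ n₂ : Carrier → Carrier
  n₁ x = (x ^ (1 ℕ.+ q)) ^ e₁
  n₂ x = (x ^ (1 ℕ.+ q)) ^ e₂

  n₂G≈n₁f : ∀ x → n₂ x * G x ≈ n₁ x * f x
  n₂G≈n₁f x = begin
    n₂ x * G x                                            ≈⟨ *-congˡ (G≈ x) ⟩
    n₂ x * (x ^ r * A z)                                  ≈⟨ *-assoc _ _ _ ⟨
    n₂ x * x ^ r * A z                                    ≈⟨ *-congʳ (combine e₂ r) ⟩
    x ^ ((1 ℕ.+ q) ℕ.* e₂ ℕ.+ r) * A z                    ≡⟨ ≡.cong (λ j → x ^ j * A z) exponents ⟩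
    x ^ ((1 ℕ.+ q) ℕ.* e₁ ℕ.+ (Q ℕ.+ 1)) * A z            ≈⟨ *-congʳ (combine e₁ (Q ℕ.+ 1)) ⟨
    n₁ x * x ^ (Q ℕ.+ 1) * A z                            ≈⟨ *-assoc _ _ _ ⟩
    n₁ x * (x ^ (Q ℕ.+ 1) * A z)                          ≈⟨ *-congˡ (f≈ x) ⟨
    n₁ x * f x                                            ∎
    where
    z : Carrier
    z = x ^ (q ∸ 1)
    combine : ∀ e s → (x ^ (1 ℕ.+ q)) ^ e * x ^ s ≈ x ^ ((1 ℕ.+ q) ℕ.* e ℕ.+ s)
    combine e s = trans (*-congʳ (^-assocʳ x (1 ℕ.+ q) e)) (sym (^-homo-* x ((1 ℕ.+ q) ℕ.* e) s))

  bar-^ : ∀ {x} e → bar x ≈ x → bar (x ^ e) ≈ x ^ e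
  bar-^ ℕ.zero  x̄≈x = bar-1
  bar-^ (suc e) x̄≈x = trans (bar-* _ _) (*-cong x̄≈x (bar-^ e x̄≈x))

  norm-fixed : ∀ x → bar (x ^ (1 ℕ.+ q)) ≈ x ^ (1 ℕ.+ q)
  norm-fixed = solve 1 (λ x → ⋆ (x ⊗ ⋆ x) ≣ x ⊗ ⋆ x) refl

  n₁-fixed : ∀ x → bar (n₁ x) ≈ n₁ x
  n₁-fixed x = bar-^ e₁ (norm-fixed x)

  n₂-fixed : ∀ x → bar (n₂ x) ≈ n₂ x
  n₂-fixed x = bar-^ e₂ (norm-fixed x)

  n₁≉0 : ∀ {x} → ¬ x ≈ 0# → ¬ n₁ x ≈ 0#
  n₁≉0 x≉0 = ^-nonzero e₁ (^-nonzero (1 ℕ.+ q) x≉0)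

  n₂≉0 : ∀ {x} → ¬ x ≈ 0# → ¬ n₂ x ≈ 0#
  n₂≉0 x≉0 = ^-nonzero e₂ (^-nonzero (1 ℕ.+ q) x≉0)

  cross-fixed : ∀ {h l s t} → bar h ≈ h → bar l ≈ l → cross (h * s) (l * t) ≈ h * l * cross s t
  cross-fixed {h} {l} {s} {t} h̄≈h l̄≈l = begin
    h * s * bar (l * t) - bar (h * s) * (l * t)
      ≈⟨ +-cong (*-congˡ (trans (bar-* l t) (*-congʳ l̄≈l))) (-‿cong (*-congʳ (trans (bar-* h s) (*-congʳ h̄≈h)))) ⟩
    h * s * (l * bar t) - h * bar s * (l * t)
      ≈⟨ solve 4 (λ h l s t → h ⊗ s ⊗ (l ⊗ ⋆ t) ⊝ h ⊗ ⋆ s ⊗ (l ⊗ t) ≣ h ⊗ l ⊗ (s ⊗ ⋆ t ⊝ ⋆ s ⊗ t)) refl h l s t ⟩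
    h * l * cross s t                               ∎

  cross-n : ∀ x y → n₂ x * n₂ y * cross (G x) (G y) ≈ n₁ x * n₁ y * cross (f x) (f y)
  cross-n x y = begin
    n₂ x * n₂ y * cross (G x) (G y)           ≈⟨ cross-fixed (n₂-fixed x) (n₂-fixed y) ⟨
    cross (n₂ x * G x) (n₂ y * G y)           ≈⟨ cross-cong (n₂G≈n₁f x) (n₂G≈n₁f y) ⟩
    cross (n₁ x * f x) (n₁ y * f y)           ≈⟨ cross-fixed (n₁-fixed x) (n₁-fixed y) ⟩
    n₁ x * n₁ y * cross (f x) (f y)           ∎

  cross-self : ∀ x → x ∼ x
  cross-self = solve 1 (λ x → x ⊗ ⋆ x ⊝ ⋆ x ⊗ x ≣ 𝟘) refl

  cross-swap : ∀ {x y} → x ∼ y → y ∼ x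
  cross-swap {x} {y} e = trans (solve 2 (λ x y → y ⊗ ⋆ x ⊝ ⋆ y ⊗ x ≣ ⊝ (x ⊗ ⋆ y ⊝ ⋆ x ⊗ y)) refl x y)
    (trans (-‿cong e) (solve 0 (⊝ 𝟘 ≣ 𝟘) refl))

  ^[q-1]≈1 : ∀ {x} → ¬ x ≈ 0# → bar x ≈ x → x ^ (q ∸ 1) ≈ 1#
  ^[q-1]≈1 {x} x≉0 x̄≈x = *-cancelˡ x≉0 (trans (^-congʳ x suc-pred-q) (trans x̄≈x (sym (*-identityʳ x))))

  G-homogeneous : ∀ {t} x → ¬ t ≈ 0# → bar t ≈ t → G (t * x) ≈ t ^ r * G x
  G-homogeneous {t} x t≉0 t̄≈t = begin
    G (t * x)                                       ≈⟨ G≈ (t * x) ⟩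
    (t * x) ^ r * A ((t * x) ^ (q ∸ 1))
      ≈⟨ *-cong (^-distrib-* t x r) (eval-cong (quadrinomial Q a b c d)
      (trans (^-distrib-* t x (q ∸ 1)) (trans (*-congʳ (^[q-1]≈1 t≉0 t̄≈t)) (*-identityˡ _)))) ⟩
    t ^ r * x ^ r * A (x ^ (q ∸ 1))                 ≈⟨ *-assoc _ _ _ ⟩
    t ^ r * (x ^ r * A (x ^ (q ∸ 1)))               ≈⟨ *-congˡ (G≈ x) ⟨
    t ^ r * G x                                     ∎

  quotient-fixed : ∀ {x y} → ¬ y ≈ 0# → x ∼ y → bar (x * y ⁻¹) ≈ x * y ⁻¹
  quotient-fixed {x} {y} y≉0 e = *-cancelˡ (*-nonzero y≉0 (bar-nonzero y≉0)) (begin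
    y * bar y * bar (x * y ⁻¹)
      ≈⟨ solve 3 (λ x y i → y ⊗ ⋆ y ⊗ ⋆ (x ⊗ i) ≣ ⋆ x ⊗ y ⊗ ⋆ (y ⊗ i)) refl x y (y ⁻¹) ⟩
    bar x * y * bar (y * y ⁻¹)      ≈⟨ *-congˡ (trans (bar-cong yi≈1) bar-1) ⟩
    bar x * y * 1#                  ≈⟨ *-cong (sym (x∙y⁻¹≈ε⇒x≈y _ _ e)) (sym yi≈1) ⟩
    x * bar y * (y * y ⁻¹)          ≈⟨ solve 3 (λ x y i → x ⊗ ⋆ y ⊗ (y ⊗ i) ≣ y ⊗ ⋆ y ⊗ (x ⊗ i)) refl x y (y ⁻¹) ⟩
    y * bar y * (x * y ⁻¹)          ∎)
    where yi≈1 = *-inverseʳ y≉0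

  quotient-* : ∀ {x y} → ¬ y ≈ 0# → x * y ⁻¹ * y ≈ x
  quotient-* {x} {y} y≉0 = trans (*-assoc _ _ _) (trans (*-congˡ (*-inverseˡ y≉0)) (*-identityʳ x))

  module Injective⇒Permutes (gcd≡1 : gcd r (q ∸ 1) ≡ 1) (f-∼ : ∀ x y → f x ∼ f y → x ∼ y) where

    G≉0 : ∀ {x} → ¬ x ≈ 0# → ¬ G x ≈ 0#
    G≉0 {x} x≉0 Gx≈0 = x≉0 (∼⇒0 (f-∼ x 1# (0∼ _ fx≈0)) (f-∼ x θ (0∼ _ fx≈0)))
      where
      fx≈0 : f x ≈ 0#
      fx≈0 = x*y≈0⇒y≈0 (n₁≉0 x≉0) (trans (sym (n₂G≈n₁f x)) (trans (*-congˡ Gx≈0) (zeroʳ _)))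

    coprime-power : ∀ {t} → t ^ r ≈ 1# → t ^ (q ∸ 1) ≈ 1# → t ≈ 1#
    coprime-power {t} t^r≈1 t^[q-1]≈1 with Bézout.identity (≡.subst (GCD r (q ∸ 1)) gcd≡1 (gcd-GCD r (q ∸ 1)))
    ... | Bézout.+- x y eq = trans (sym (*-identityʳ t)) (trans (*-congˡ (sym (^-∣ (n∣m*n y) t^[q-1]≈1)))
            (trans (^-congʳ t eq) (^-∣ (n∣m*n x) t^r≈1)))
    ... | Bézout.-+ x y eq = trans (sym (*-identityʳ t)) (trans (*-congˡ (sym (^-∣ (n∣m*n x) t^r≈1)))
            (trans (^-congʳ t eq) (^-∣ (n∣m*n y) t^[q-1]≈1)))

    -- Equal values of `G` put x and y on one K-line. Along that line `G` is t ↦ t^r times a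
    -- constant, and r is prime to the order q - 1 of K*.
    G-injective-≉0 : ∀ {x y} → ¬ x ≈ 0# → ¬ y ≈ 0# → G x ≈ G y → x ≈ y
    G-injective-≉0 {x} {y} x≉0 y≉0 e = begin
      x               ≈⟨ quotient-* y≉0 ⟨
      t * y           ≈⟨ *-congʳ (coprime-power t^r≈1 (^[q-1]≈1 t≉0 t-fixed)) ⟩
      1# * y          ≈⟨ *-identityˡ y ⟩
      y               ∎
      where
      t : Carrier
      t = x * y ⁻¹
      x∼y : x ∼ y
      x∼y = f-∼ x y (x*y≈0⇒y≈0 (*-nonzero (n₁≉0 x≉0) (n₁≉0 y≉0)) (trans (sym (cross-n x y))
        (trans (*-congˡ (trans (cross-cong e refl) (cross-self (G y)))) (zeroʳ _))))
      t-fixed : bar t ≈ t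
      t-fixed = quotient-fixed y≉0 x∼y
      t≉0 : ¬ t ≈ 0#
      t≉0 = *-nonzeroˡ (λ z → x≉0 (trans (sym (quotient-* y≉0)) z))
      t^r≈1 : t ^ r ≈ 1#
      t^r≈1 = *-cancelˡ (G≉0 y≉0) (begin
        G y * t ^ r       ≈⟨ *-comm _ _ ⟩
        t ^ r * G y       ≈⟨ G-homogeneous y t≉0 t-fixed ⟨
        G (t * y)         ≈⟨ G-cong (quotient-* y≉0) ⟩
        G x               ≈⟨ e ⟩
        G y               ≈⟨ *-identityʳ _ ⟨
        G y * 1#          ∎)

    G-injective : ∀ {x y} → G x ≈ G y → x ≈ y
    G-injective {x} {y} e with x ≟ 0# | y ≟ 0#
    ... | yes x≈0 | yes y≈0 = trans x≈0 (sym y≈0)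
    ... | yes x≈0 | no y≉0  = contradiction (trans (sym e) (G-0 x≈0)) (G≉0 y≉0)
    ... | no x≉0  | yes y≈0 = contradiction (trans e (G-0 y≈0)) (G≉0 x≉0)
    ... | no x≉0  | no y≉0  = G-injective-≉0 x≉0 y≉0 e

    permutes : Permutes (X^ r *ₚ (quadrinomial Q a b c d ∘ₚ X^ (q ∸ 1)))
    permutes = G-injective , λ y →
      let i , e = injective⇒surjective {f = λ i → index (G (elem i))}
            (λ e → elem-injective (G-injective (index-injective e))) (index y)
      in elem i , λ z≈ → trans (G-cong z≈) (index-injective e)

  module Permutes⇒Injective (G-injective : ∀ {x y} → G x ≈ G y → x ≈ y) where

    G≉0 : ∀ {x} → ¬ x ≈ 0# → ¬ G x ≈ 0#
    G≉0 x≉0 Gx≈0 = x≉0 (G-injective (trans Gx≈0 (sym (G-0 refl))))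

    -- A common divisor g > 1 would make `G` agree at 1 and at a nontrivial g-th root of unity,
    -- since neither x^r nor x^(q-1) tells them apart. That root is y^s with s = (q² - 1) / g.
    gcd≡1 : gcd r (q ∸ 1) ≡ 1
    gcd≡1 with gcd r (q ∸ 1) | gcd[m,n]∣m r (q ∸ 1) | gcd[m,n]∣n r (q ∸ 1)
    ... | 0             | _   | divides j q-1≡ = contradiction (≡.trans q-1≡ (ℕ.*-zeroʳ j)) (ℕ.≢-nonZero⁻¹ (q ∸ 1))
    ... | 1             | _   | _ = ≡.refl
    ... | g@(suc (suc _)) | g∣r | g∣q-1@(divides j q-1≡) = contradiction y^s≈1 y^s≉1
      where
      s : ℕ
      s = j ℕ.* (q ℕ.+ 1)
      sg≡ : s ℕ.* g ≡ n ∸ 1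
      sg≡ = ≡.trans (rearrange j (q ℕ.+ 1) g) (≡.trans (≡.cong (ℕ._* (q ℕ.+ 1)) (≡.sym q-1≡)) (≡.sym n-1≡))
        where
        rearrange : ∀ x y z → x ℕ.* y ℕ.* z ≡ x ℕ.* z ℕ.* y
        rearrange = S.solve 3 (λ x y z → x S.:* y S.:* z S.:= x S.:* z S.:* y) ≡.refl
          where module S = ℕSolver.+-*-Solver
      instance
        s≢0 : NonZero s
        s≢0 = ℕ.≢-nonZero λ s≡0 → ℕ.≢-nonZero⁻¹ (n ∸ 1) (≡.trans (≡.sym sg≡) (≡.cong (ℕ._* g) s≡0))
      s< : suc s ℕ.< n
      s< = ≡.subst (suc s ℕ.<_) suc-pred-order (s≤s (≡.subst (s ℕ.<_) sg≡ (ℕ.m<m*n s g (s≤s (s≤s z≤n)))))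
      y : Carrier
      y = proj₁ (∃-^≉1 s s<)
      y≉0 = proj₁ (proj₂ (∃-^≉1 s s<))
      y^s≉1 = proj₂ (proj₂ (∃-^≉1 s s<))
      t^g≈1 : (y ^ s) ^ g ≈ 1#
      t^g≈1 = trans (^-assocʳ y s g) (trans (^-congʳ y sg≡) (^-pred-order y≉0))
      y^s≈1 : y ^ s ≈ 1#
      y^s≈1 = G-injective (begin
        G (y ^ s)                                         ≈⟨ G≈ (y ^ s) ⟩
        (y ^ s) ^ r * A ((y ^ s) ^ (q ∸ 1))               ≈⟨ *-cong (trans (^-∣ g∣r t^g≈1) (sym (1^ r)))
          (eval-cong (quadrinomial Q a b c d) (trans (^-∣ g∣q-1 t^g≈1) (sym (1^ (q ∸ 1))))) ⟩
        1# ^ r * A (1# ^ (q ∸ 1))                         ≈⟨ G≈ 1# ⟨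
        G 1#                                              ∎)

    -- A Bézout coefficient of r modulo q - 1 serves as the exponent of an r-th root in K*. When the
    -- identity carries it with the opposite sign, κ is inverted first.
    root-of-fixed : ∀ {κ} → ¬ κ ≈ 0# → bar κ ≈ κ → ∃[ τ ] (¬ τ ≈ 0#) × (bar τ ≈ τ) × τ ^ r ≈ κ
    root-of-fixed {κ} κ≉0 κ̄≈κ with Bézout.identity (≡.subst (GCD r (q ∸ 1)) gcd≡1 (gcd-GCD r (q ∸ 1)))
    ... | Bézout.+- x y eq = κ ^ x , ^-nonzero x κ≉0 , bar-^ x κ̄≈κ , (begin
      (κ ^ x) ^ r               ≈⟨ ^-assocʳ κ x r ⟩
      κ ^ (x ℕ.* r)             ≡⟨ ≡.cong (κ ^_) eq ⟨
      κ * κ ^ (y ℕ.* (q ∸ 1))   ≈⟨ *-congˡ (^-∣ (n∣m*n y) (^[q-1]≈1 κ≉0 κ̄≈κ)) ⟩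
      κ * 1#                    ≈⟨ *-identityʳ κ ⟩
      κ                         ∎)
    ... | Bézout.-+ x y eq = i ^ x , ^-nonzero x i≉0 , bar-^ x ī≈i , *-cancelˡ (^-nonzero (x ℕ.* r) κ≉0) (begin
      κ ^ (x ℕ.* r) * (i ^ x) ^ r         ≈⟨ *-congˡ (^-assocʳ i x r) ⟩
      κ ^ (x ℕ.* r) * i ^ (x ℕ.* r)       ≈⟨ ^-distrib-* κ i (x ℕ.* r) ⟨
      (κ * i) ^ (x ℕ.* r)                 ≈⟨ trans (^-congˡ (x ℕ.* r) κi≈1) (1^ (x ℕ.* r)) ⟩
      1#                                  ≈⟨ ^-∣ (n∣m*n y) (^[q-1]≈1 κ≉0 κ̄≈κ) ⟨
      κ ^ (y ℕ.* (q ∸ 1))                 ≡⟨ ≡.cong (κ ^_) eq ⟨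
      κ * κ ^ (x ℕ.* r)                   ≈⟨ *-comm _ _ ⟩
      κ ^ (x ℕ.* r) * κ                   ∎)
      where
      i : Carrier
      i = κ ⁻¹
      κi≈1 = *-inverseʳ κ≉0
      i≉0 : ¬ i ≈ 0#
      i≉0 = *-nonzeroʳ {κ} (λ e → 1≉0 (trans (sym κi≈1) e))
      ī≈i : bar i ≈ i
      ī≈i = *-cancelˡ κ≉0 (trans (*-congʳ (sym κ̄≈κ)) (trans (sym (bar-* κ i)) (trans (bar-cong κi≈1) (trans bar-1 (sym κi≈1)))))

    -- The quotient of the two values lies in K*, so it is τ^r with τ ∈ K*. By homogeneity G x = G
    -- (τ y), and then x = τ y.
    G-∼ : ∀ {x y} → ¬ x ≈ 0# → ¬ y ≈ 0# → G x ∼ G y → x ∼ y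
    G-∼ {x} {y} x≉0 y≉0 e =
      let κ≉0 = *-nonzeroˡ (λ z → G≉0 x≉0 (trans (sym (quotient-* (G≉0 y≉0))) z))
          τ , τ≉0 , τ̄≈τ , τ^r≈κ = root-of-fixed κ≉0 (quotient-fixed (G≉0 y≉0) e)
          x≈τy = G-injective (trans (sym (quotient-* (G≉0 y≉0))) (trans (*-congʳ (sym τ^r≈κ)) (sym (G-homogeneous y τ≉0 τ̄≈τ))))
      in begin
        cross x y                     ≈⟨ cross-cong x≈τy (sym (*-identityˡ y)) ⟩
        cross (τ * y) (1# * y)        ≈⟨ cross-fixed τ̄≈τ bar-1 ⟩
        τ * 1# * cross y y            ≈⟨ trans (*-congˡ (cross-self y)) (zeroʳ _) ⟩
        0#                            ∎

    f-∼ : ∀ x y → f x ∼ f y → x ∼ y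
    f-∼ x y e with x ≟ 0# | y ≟ 0#
    ... | yes x≈0 | _       = 0∼ y x≈0
    ... | no _    | yes y≈0 = cross-swap (0∼ x y≈0)
    ... | no x≉0  | no y≉0  = G-∼ x≉0 y≉0 (x*y≈0⇒y≈0 (*-nonzero (n₂≉0 x≉0) (n₂≉0 y≉0))
      (trans (cross-n x y) (trans (*-congˡ e) (zeroʳ _))))

    private
      lin-fixed : ∀ {h} z s → bar h ≈ h → lin 1# z (h * s) ≈ h * lin 1# z s
      lin-fixed {h} z s h̄≈h = trans (+-congˡ (*-congˡ (trans (bar-* h s) (*-congʳ h̄≈h))))
        (solve 3 (λ h z s → 𝟙 ⊗ (h ⊗ s) ⊕ z ⊗ (h ⊗ ⋆ s) ≣ h ⊗ (𝟙 ⊗ s ⊕ z ⊗ ⋆ s)) refl h z s)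

      drop-fixed : ∀ {h} z s → ¬ h ≈ 0# → bar h ≈ h → lin 1# z (h * s) ^ (q ∸ 1) ≈ lin 1# z s ^ (q ∸ 1)
      drop-fixed {h} z s h≉0 h̄≈h = begin
        lin 1# z (h * s) ^ (q ∸ 1)              ≈⟨ ^-congˡ (q ∸ 1) (lin-fixed z s h̄≈h) ⟩
        (h * lin 1# z s) ^ (q ∸ 1)              ≈⟨ ^-distrib-* h _ (q ∸ 1) ⟩
        h ^ (q ∸ 1) * lin 1# z s ^ (q ∸ 1)      ≈⟨ trans (*-congʳ (^[q-1]≈1 h≉0 h̄≈h)) (*-identityˡ _) ⟩
        lin 1# z s ^ (q ∸ 1)                    ∎

      ψ : Carrier → Carrier → Carrier
      ψ z s = lin 1# z s ^ (q ∸ 1)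

      ψ-cong : ∀ z {s t} → s ≈ t → ψ z s ≈ ψ z t
      ψ-cong z e = ^-congˡ (q ∸ 1) (lin-cong e)

      -- The factors by which `f` and `G` differ lie in K*; they pass through the K-linear twist and
      -- become 1 under the exponent q - 1.
      ψf≈ψG : ∀ z x → ψ z (f x) ≈ ψ z (G x)
      ψf≈ψG z x with x ≟ 0#
      ... | yes x≈0 = ψ-cong z (trans (f-0 x≈0) (sym (G-0 x≈0)))
      ... | no x≉0  = begin
        ψ z (f x)             ≈⟨ drop-fixed z (f x) (n₁≉0 x≉0) (n₁-fixed x) ⟨
        ψ z (n₁ x * f x)      ≈⟨ ψ-cong z (n₂G≈n₁f x) ⟨
        ψ z (n₂ x * G x)      ≈⟨ drop-fixed z (G x) (n₂≉0 x≉0) (n₂-fixed x) ⟩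
        ψ z (G x)             ∎

      n-1∤q-1 : ¬ n ∸ 1 ∣ q ∸ 1
      n-1∤q-1 e = ℕ.<⇒≱ (ℕ.m<m*n (q ∸ 1) (q ℕ.+ 1) (ℕ.<-≤-trans q>1 (ℕ.m≤m+n q 1))) (≡.subst (ℕ._≤ q ∸ 1) n-1≡ (∣⇒≤ e))

    -- Both `G` and s ↦ s + z s̄ permute F, so what remains is the power sum of exponent q - 1,
    -- which is too small to be a multiple of q² - 1.
    f-sum : ∀ z → ¬ N 1# ≈ N z → Σ.fold (λ x → lin 1# z (f x) ^ (q ∸ 1)) ≈ 0#
    f-sum z z-norm = begin
      Σ.fold (λ x → ψ z (f x))      ≈⟨ Σ.fold-cong (ψf≈ψG z) ⟩
      Σ.fold (λ x → ψ z (G x))      ≈⟨ Σ.fold-reindex (ψ z) G (ψ-cong z) G-injective ⟩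
      Σ.fold (ψ z)
        ≈⟨ Σ.fold-reindex (_^ (q ∸ 1)) (lin 1# z) (^-congˡ (q ∸ 1)) (lin-injective z-norm) ⟩
      powerSum (q ∸ 1)              ≈⟨ powerSum-∤ (q ∸ 1) n-1∤q-1 ⟩
      0#                            ∎

-- Translation to the statement and assembly

module Statements {u v} (p k ℓ : ℕ) (pr : Prime p) .{{_ : NonZero k}} .{{_ : NonZero ℓ}}
  (F : FiniteField u v ((p ℕ.^ k) ℕ.^ 2)) where

  open FiniteField F hiding (zero)
  open QuadraticField p k ℓ pr F
  open NormalForms p k ℓ pr F
  open Subsets F using (μ)
  open Polynomials commutativeRing
  open PolynomialProperties commutativeRing
  open Algebra.Properties.Semiring.Exp semiring hiding (_^_)
  open Algebra.Properties.Semiring.Mult semiring using (×-assocˡ; ×-congʳ) renaming (_×_ to _⋅_)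
  open FiniteFieldProperties F using (1≉0)
  open Relation.Binary.Reasoning.Setoid setoid

  ^[Q+1] : ∀ α → α ^ (Q ℕ.+ 1) ≈ φ α * α
  ^[Q+1] α = trans (^-homo-* α Q 1) (*-congˡ (*-identityʳ α))

  ^[q+1] : ∀ α → α ^ (q ℕ.+ 1) ≈ bar α * α
  ^[q+1] α = trans (^-homo-* α q 1) (*-congˡ (*-identityʳ α))

  ^[q+Q] : ∀ α → α ^ (q ℕ.+ Q) ≈ bar α * φ α
  ^[q+Q] α = ^-homo-* α q Q

  ^[qQ] : ∀ α → α ^ (q ℕ.* Q) ≈ bar (φ α)
  ^[qQ] α = sym (trans (^-assocʳ α Q q) (^-congʳ α (ℕ.*-comm Q q)))

  ^[qQ+1] : ∀ α → α ^ (q ℕ.* Q ℕ.+ 1) ≈ bar (φ α) * α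
  ^[qQ+1] α = trans (^-homo-* α (q ℕ.* Q) 1) (*-cong (^[qQ] α) (*-identityʳ α))

  ^[qQ+q] : ∀ α → α ^ (q ℕ.* Q ℕ.+ q) ≈ bar (φ α) * bar α
  ^[qQ+q] α = trans (^-homo-* α (q ℕ.* Q) q) (*-congʳ (^[qQ] α))

  module _ {a b c d : Carrier} where

    scaled⇒poly : ∀ {γ δ a₀ b₀ c₀ d₀} → Scaled a b c d γ δ a₀ b₀ c₀ d₀ →
      γ ∈ μ (q ℕ.+ 1) × ¬ δ ≈ 0# × quadrinomial Q a b c d ≈ₚ δ · (quadrinomial Q a₀ b₀ c₀ d₀ ∘ₚ (γ · X^ 1))
    scaled⇒poly {γ} {δ} {a₀} {b₀} {c₀} {d₀} (scaled γ-norm δ≉0 a≈ b≈ c≈ d≈) =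
      trans (^[q+1] γ) γ-norm , δ≉0 , λ i → trans
        (quadrinomial-cong Q (trans a≈ (*-congˡ (*-congˡ (sym (^[Q+1] γ))))) b≈
          (trans c≈ (*-congˡ (*-congˡ (sym (*-identityʳ γ))))) (trans d≈ (*-congˡ (sym (*-identityʳ d₀)))) i)
        (sym (scale-quadrinomial Q γ δ a₀ b₀ c₀ d₀ (quadrinomial Q a₀ b₀ c₀ d₀) (λ _ → refl) i))

    poly⇒scaled : ∀ {γ δ a₀ b₀ c₀ d₀} A₀ → A₀ ≈ₚ quadrinomial Q a₀ b₀ c₀ d₀ →
      γ ∈ μ (q ℕ.+ 1) → ¬ δ ≈ 0# → quadrinomial Q a b c d ≈ₚ δ · (A₀ ∘ₚ (γ · X^ 1)) → Scaled a b c d γ δ a₀ b₀ c₀ d₀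
    poly⇒scaled {γ} {δ} {a₀} {b₀} {c₀} {d₀} A₀ A₀≈ γ∈μ δ≉0 A≈ =
      let a≈ , b≈ , c≈ , d≈ = quadrinomial-injective Q Q>1 (λ i → trans (A≈ i) (scale-quadrinomial Q γ δ a₀ b₀ c₀ d₀ A₀ A₀≈ i))
      in scaled (trans (sym (^[q+1] γ)) γ∈μ) δ≉0 (trans a≈ (*-congˡ (*-congˡ (^[Q+1] γ)))) b≈
           (trans c≈ (*-congˡ (*-congˡ (*-identityʳ γ)))) (trans d≈ (*-congˡ (*-identityʳ d₀)))

  quadrinomial₁ : ∀ α β → quadrinomial Q (φ α * α + β) (bar α * φ α + β) (bar (φ α) * α + β) (bar (φ α) * bar α + β) ≈ₚ
    quadrinomial Q (α ^ (Q ℕ.+ 1) + β) (α ^ (q ℕ.+ Q) + β) (α ^ (q ℕ.* Q ℕ.+ 1) + β) (α ^ (q ℕ.* Q ℕ.+ q) + β)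
  quadrinomial₁ α β = quadrinomial-cong Q (+-congʳ (sym (^[Q+1] α))) (+-congʳ (sym (^[q+Q] α)))
    (+-congʳ (sym (^[qQ+1] α))) (+-congʳ (sym (^[qQ+q] α)))

  quadrinomial₂ : ∀ α β → quadrinomial Q (bar (φ α) * bar α + β) (bar (φ α) + α * β) (bar α + φ α * β) (1# + φ α * α * β) ≈ₚ
    quadrinomial Q (α ^ (q ℕ.* Q ℕ.+ q) + β) (α ^ (q ℕ.* Q) + α * β) (α ^ q + α ^ Q * β) (1# + α ^ (Q ℕ.+ 1) * β)
  quadrinomial₂ α β = quadrinomial-cong Q (+-congʳ (sym (^[qQ+q] α))) (+-congʳ (sym (^[qQ] α))) refl
    (+-congˡ (*-congʳ (sym (^[Q+1] α))))

  quadrinomial₃ : ∀ α β → quadrinomial Q (bar (φ α) + bar α * β) (bar (φ α) * α + β) (1# + bar α * φ α * β) (α + φ α * β) ≈ₚ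
    quadrinomial Q (α ^ (q ℕ.* Q) + α ^ q * β) (α ^ (q ℕ.* Q ℕ.+ 1) + β) (1# + α ^ (q ℕ.+ Q) * β) (α + α ^ Q * β)
  quadrinomial₃ α β = quadrinomial-cong Q (+-congʳ (sym (^[qQ] α))) (+-congʳ (sym (^[qQ+1] α)))
    (+-congˡ (*-congʳ (sym (^[q+Q] α)))) refl

  -- The element -1 is fixed by both Frobenius powers and is its own inverse, so it meets the
  -- hypotheses of all three conditions.
  Trivial⇒-1≈1 : Trivial₁ ⊎ Trivial₂ ⊎ Trivial₃ → - 1# ≈ 1#
  Trivial⇒-1≈1 = [ (λ t → t (- 1#) bar-1≈ φ-inv) , [ (λ t → t (- 1#) bar-inv φ-inv) , (λ t → t (- 1#) bar-inv φ-1≈) ]′ ]′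
    where
    bar-1≈ : bar (- 1#) ≈ - 1#
    bar-1≈ = trans (bar-neg 1#) (-‿cong bar-1)
    φ-1≈ : φ (- 1#) ≈ - 1#
    φ-1≈ = trans (φ-neg 1#) (-‿cong φ-1)
    square : - 1# * - 1# ≈ 1#
    square = solve 0 (⊝ 𝟙 ⊗ (⊝ 𝟙) ≣ 𝟙) refl
    bar-inv : bar (- 1#) * - 1# ≈ 1#
    bar-inv = trans (*-congʳ bar-1≈) square
    φ-inv : φ (- 1#) * - 1# ≈ 1#
    φ-inv = trans (*-congʳ φ-1≈) square

  -- Now 2 ⋅ 1 = 0, so for odd p the vanishing multiple p ⋅ 1 would equal 1.
  -1≈1⇒p≡2 : - 1# ≈ 1# → p ≡ 2
  -1≈1⇒p≡2 -1≈1 with p ℕ.% 2 in p%2 | m≡m%n+[m/n]*n p 2 | m%n<n p 2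
  ... | 0           | p≡ | _ = [ (λ ()) , ≡.sym ]′ (prime⇒irreducible pr (divides (p ℕ./ 2) p≡))
  ... | 1           | p≡ | _ = contradiction (begin
    1#                                ≈⟨ +-identityʳ 1# ⟨
    1# + 0#                           ≈⟨ +-congˡ (half⋅0≈0 (p ℕ./ 2)) ⟨
    1# + (p ℕ./ 2) ⋅ 0#               ≈⟨ +-congˡ (×-congʳ (p ℕ./ 2) 2⋅1≈0) ⟨
    1# + (p ℕ./ 2) ⋅ (2 ⋅ 1#)         ≈⟨ +-congˡ (×-assocˡ 1# (p ℕ./ 2) 2) ⟩
    suc (p ℕ./ 2 ℕ.* 2) ⋅ 1#          ≡⟨ ≡.cong (_⋅ 1#) p≡ ⟨
    p ⋅ 1#                            ≈⟨ p⋅1≈0 ⟩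
    0#                                ∎) 1≉0
    where
    half⋅0≈0 : ∀ m → m ⋅ 0# ≈ 0#
    half⋅0≈0 ℕ.zero  = refl
    half⋅0≈0 (suc m) = trans (+-identityˡ _) (half⋅0≈0 m)
    2⋅1≈0 : 2 ⋅ 1# ≈ 0#
    2⋅1≈0 = trans (+-cong (sym -1≈1) (+-identityʳ 1#)) (-‿inverseˡ 1#)
  ... | suc (suc _) | _  | s≤s (s≤s ())

-- Stated outside the modules that fix `p`, so that matching on `p≡2` can replace `p` by 2 in the
-- type of the field. `bar` and `φ` are the Frobenius powers at `k` and `ℓ`, which turns the three
-- conditions into combinations of `Fixes` and `Inverts`.
ord₂-conditions : ∀ {u v p} k ℓ .{{_ : NonZero k}} .{{_ : NonZero ℓ}} (p≡2 : p ≡ 2) (pr : Prime p)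
  (F : FiniteField u v ((p ℕ.^ k) ℕ.^ 2)) → let open NormalForms p k ℓ pr F in
  (Trivial₁ ⇔ ord₂ k ℕ.≤ ord₂ ℓ) × (Trivial₂ ⇔ ord₂ k ≢ ord₂ ℓ) × (Trivial₃ ⇔ ord₂ k ℕ.≥ ord₂ ℓ)
ord₂-conditions k ℓ ≡.refl pr F =
  mk⇔ ord₂-≤ (λ k≤ℓ t → fixes-inverts⇒1 k ℓ k≤ℓ) ,
  mk⇔ ord₂-≢ (λ k≢ℓ t e f →
    [ (λ k<ℓ → inverts-inverts⇒1 k ℓ k<ℓ e f) , (λ ℓ<k → inverts-inverts⇒1 ℓ k ℓ<k f e) ]′ (<⊎> (ord₂ k) (ord₂ ℓ) k≢ℓ)) ,
  mk⇔ ord₂-≥ (λ ℓ≤k t e f → fixes-inverts⇒1 ℓ k ℓ≤k f e)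
  where
  open TwoPowers k ℓ F
  <⊎> : ∀ i j → i ≢ j → i ℕ.< j ⊎ j ℕ.< i
  <⊎> i j i≢j = Sum.map (λ i≤j → ℕ.≤∧≢⇒< i≤j i≢j) (λ j≤i → ℕ.≤∧≢⇒< j≤i (i≢j ∘ ≡.sym)) (ℕ.≤-total i j)

module Alternatives {u v} (p k ℓ : ℕ) (pr : Prime p) .{{_ : NonZero k}} .{{_ : NonZero ℓ}}
  (F : FiniteField u v ((p ℕ.^ k) ℕ.^ 2)) (a b c d : FiniteField.Carrier F) where

  open FiniteField F hiding (zero)
  open QuadraticField p k ℓ pr F
  open LinearMaps p k ℓ pr F using (_∼_)
  open Form p k ℓ pr F a b c d using (f)
  open FixedField p k ℓ pr F using (bar-fixed⇒∈𝔽; ∈𝔽⇒bar-fixed)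
  open NormalForms p k ℓ pr F
  open Sufficiency p k ℓ pr F
  open Statements p k ℓ pr F
  open Subsets F
  open Polynomials commutativeRing
  open PolynomialProperties commutativeRing

  -- Spelled with powers and membership in `𝔽` and `μ`, whereas `Case₁` to `Case₃` speak of `bar`
  -- and `φ`; the lemmas below translate between the two.
  Alternative₁ Alternative₂ Alternative₃ : Poly → Set (u ⊔ v)
  Alternative₁ A₀ = ord₂ k ℕ.≤ ord₂ ℓ × (∃[ α ] ∃[ β ] α ∉ 𝔽 q × β ∉ 𝔽 q ×
    A₀ ≈ₚ quadrinomial Q (α ^ (Q ℕ.+ 1) + β) (α ^ (q ℕ.+ Q) + β) (α ^ (q ℕ.* Q ℕ.+ 1) + β) (α ^ (q ℕ.* Q ℕ.+ q) + β))
  Alternative₂ A₀ = ord₂ k ≢ ord₂ ℓ × (A₀ ≈ₚ X^ (Q ℕ.+ 1) ⊎ (∃[ α ] ∃[ β ] α ∉ μ (q ℕ.+ 1) × β ∉ μ (q ℕ.+ 1) ×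
    A₀ ≈ₚ quadrinomial Q (α ^ (q ℕ.* Q ℕ.+ q) + β) (α ^ (q ℕ.* Q) + α * β) (α ^ q + α ^ Q * β) (1# + α ^ (Q ℕ.+ 1) * β)))
  Alternative₃ A₀ = ord₂ k ℕ.≥ ord₂ ℓ × (A₀ ≈ₚ X^ Q ⊎ (∃[ α ] ∃[ β ] α ∉ μ (q ℕ.+ 1) × β ∉ μ (q ℕ.+ 1) ×
    A₀ ≈ₚ quadrinomial Q (α ^ (q ℕ.* Q) + α ^ q * β) (α ^ (q ℕ.* Q ℕ.+ 1) + β) (1# + α ^ (q ℕ.+ Q) * β) (α + α ^ Q * β)))

  Represented : (Poly → Set (u ⊔ v)) → Set (u ⊔ v)
  Represented P = ∃[ γ ] ∃[ δ ] ∃[ A₀ ] γ ∈ μ (q ℕ.+ 1) × ¬ (δ ≈ 0#) ×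
    quadrinomial Q a b c d ≈ₚ δ · (A₀ ∘ₚ (γ · X^ 1)) × P A₀

  private
    represent : ∀ {P γ δ a₀ b₀ c₀ d₀} → Scaled a b c d γ δ a₀ b₀ c₀ d₀ → P (quadrinomial Q a₀ b₀ c₀ d₀) → Represented P
    represent s P = let γ∈μ , δ≉0 , A≈ = scaled⇒poly s in _ , _ , _ , γ∈μ , δ≉0 , A≈ , P

  Case₁⇒Alternative₁ : ord₂ k ℕ.≤ ord₂ ℓ → Case₁ a b c d → Represented Alternative₁
  Case₁⇒Alternative₁ o (α , β , ᾱ≉α , β̄≉β , γ , δ , s) = represent {Alternative₁} s
    (o , α , β , ᾱ≉α ∘ ∈𝔽⇒bar-fixed , β̄≉β ∘ ∈𝔽⇒bar-fixed , quadrinomial₁ α β)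

  Case₂⇒Alternative₂ : ord₂ k ≢ ord₂ ℓ → Case₂ a b c d → Represented Alternative₂
  Case₂⇒Alternative₂ o (inj₁ (γ , δ , s)) = represent {Alternative₂} s (o , inj₁ (quadrinomial-1000 Q))
  Case₂⇒Alternative₂ o (inj₂ (α , β , α-norm , β-norm , γ , δ , s)) = represent {Alternative₂} s
    (o , inj₂ (α , β , α-norm ∘ trans (sym (^[q+1] α)) , β-norm ∘ trans (sym (^[q+1] β)) , quadrinomial₂ α β))

  Case₃⇒Alternative₃ : ord₂ k ℕ.≥ ord₂ ℓ → Case₃ a b c d → Represented Alternative₃
  Case₃⇒Alternative₃ o (inj₁ (γ , δ , s)) = represent {Alternative₃} s (o , inj₁ (quadrinomial-0100 Q))
  Case₃⇒Alternative₃ o (inj₂ (α , β , α-norm , β-norm , γ , δ , s)) = represent {Alternative₃} s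
    (o , inj₂ (α , β , α-norm ∘ trans (sym (^[q+1] α)) , β-norm ∘ trans (sym (^[q+1] β)) , quadrinomial₃ α β))

  module _ {γ δ : Carrier} {A₀ : Poly} (γ∈μ : γ ∈ μ (q ℕ.+ 1)) (δ≉0 : ¬ δ ≈ 0#)
    (A≈ : quadrinomial Q a b c d ≈ₚ δ · (A₀ ∘ₚ (γ · X^ 1))) where

    private
      normal : ∀ {a₀ b₀ c₀ d₀} → A₀ ≈ₚ quadrinomial Q a₀ b₀ c₀ d₀ → Scaled a b c d γ δ a₀ b₀ c₀ d₀
      normal A₀≈ = poly⇒scaled A₀ A₀≈ γ∈μ δ≉0 A≈

    Alternative₁⇒injective : Trivial₁ → Alternative₁ A₀ → ∀ x y → f x ∼ f y → x ∼ y
    Alternative₁⇒injective trivial (_ , α , β , α∉ , β∉ , A₀≈) = sufficiency₁ trivial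
      (α , β , α∉ ∘ bar-fixed⇒∈𝔽 , β∉ ∘ bar-fixed⇒∈𝔽 , γ , δ , normal (λ i → trans (A₀≈ i) (sym (quadrinomial₁ α β i))))

    Alternative₂⇒injective : Trivial₂ → Alternative₂ A₀ → ∀ x y → f x ∼ f y → x ∼ y
    Alternative₂⇒injective trivial (_ , inj₁ A₀≈) = sufficiency₂ trivial (inj₁ (γ , δ , normal (λ i → trans (A₀≈ i) (sym (quadrinomial-1000 Q i)))))
    Alternative₂⇒injective trivial (_ , inj₂ (α , β , α∉ , β∉ , A₀≈)) = sufficiency₂ trivial (inj₂
      (α , β , α∉ ∘ trans (^[q+1] α) , β∉ ∘ trans (^[q+1] β) , γ , δ , normal (λ i → trans (A₀≈ i) (sym (quadrinomial₂ α β i)))))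

    Alternative₃⇒injective : Trivial₃ → Alternative₃ A₀ → ∀ x y → f x ∼ f y → x ∼ y
    Alternative₃⇒injective trivial (_ , inj₁ A₀≈) = sufficiency₃ trivial (inj₁ (γ , δ , normal (λ i → trans (A₀≈ i) (sym (quadrinomial-0100 Q i)))))
    Alternative₃⇒injective trivial (_ , inj₂ (α , β , α∉ , β∉ , A₀≈)) = sufficiency₃ trivial (inj₂
      (α , β , α∉ ∘ trans (^[q+1] α) , β∉ ∘ trans (^[q+1] β) , γ , δ , normal (λ i → trans (A₀≈ i) (sym (quadrinomial₃ α β i)))))

  Alternatives : Poly → Set (u ⊔ v)
  Alternatives A₀ = Alternative₁ A₀ ⊎ Alternative₂ A₀ ⊎ Alternative₃ A₀

  map-represented : ∀ {P P′ : Poly → Set (u ⊔ v)} → (∀ {A₀} → P A₀ → P′ A₀) → Represented P → Represented P′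
  map-represented P⇒P′ (γ , δ , A₀ , γ∈μ , δ≉0 , A≈ , x) = γ , δ , A₀ , γ∈μ , δ≉0 , A≈ , P⇒P′ x

module Main {u v} (p k ℓ r : ℕ) (pr : Prime p) .{{_ : NonZero k}} .{{_ : NonZero ℓ}} .{{_ : NonZero r}}
  (r≡ : r % (1 ℕ.+ p ℕ.^ k) ≡ (p ℕ.^ ℓ ℕ.+ 1) % (1 ℕ.+ p ℕ.^ k))
  (F : FiniteField u v ((p ℕ.^ k) ℕ.^ 2)) (a b c d : FiniteField.Carrier F) where

  open FiniteField F hiding (zero)
  open QuadraticField p k ℓ pr F using (q; Q)
  open NormalForms p k ℓ pr F
  open Statements p k ℓ pr F
  open Alternatives p k ℓ pr F a b c d
  open Polynomials commutativeRing
  open Permutation p k ℓ r pr r≡ F a b c d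

  permutes⇒represented : Permutes (X^ r *ₚ (quadrinomial Q a b c d ∘ₚ X^ (q ∸ 1))) →
    p ≡ 2 × gcd r (q ∸ 1) ≡ 1 × Represented Alternatives
  permutes⇒represented (G-injective , _) = conclude outcome
    where
    open Permutes⇒Injective G-injective
    Outcome : Set (u ⊔ v)
    Outcome = (Trivial₁ × Case₁ a b c d) ⊎ (Trivial₂ × Case₂ a b c d) ⊎ (Trivial₃ × Case₃ a b c d)
    outcome : Outcome
    outcome = Necessity.necessity a b c d f-∼ f-sum
    characteristic : Trivial₁ ⊎ Trivial₂ ⊎ Trivial₃ → p ≡ 2
    characteristic t = -1≈1⇒p≡2 (Trivial⇒-1≈1 t)
    conclude : Outcome → p ≡ 2 × gcd r (q ∸ 1) ≡ 1 × Represented Alternatives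
    conclude (inj₁ (t , case₁)) =
      let p≡2 = characteristic (inj₁ t) in p≡2 , gcd≡1 , map-represented {Alternative₁} {Alternatives} inj₁
        (Case₁⇒Alternative₁ (Equivalence.to (proj₁ (ord₂-conditions k ℓ p≡2 pr F)) t) case₁)
    conclude (inj₂ (inj₁ (t , case₂))) =
      let p≡2 = characteristic (inj₂ (inj₁ t)) in p≡2 , gcd≡1 , map-represented {Alternative₂} {Alternatives} (inj₂ ∘ inj₁)
        (Case₂⇒Alternative₂ (Equivalence.to (proj₁ (proj₂ (ord₂-conditions k ℓ p≡2 pr F))) t) case₂)
    conclude (inj₂ (inj₂ (t , case₃))) =
      let p≡2 = characteristic (inj₂ (inj₂ t)) in p≡2 , gcd≡1 , map-represented {Alternative₃} {Alternatives} (inj₂ ∘ inj₂)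
        (Case₃⇒Alternative₃ (Equivalence.to (proj₂ (proj₂ (ord₂-conditions k ℓ p≡2 pr F))) t) case₃)

  represented⇒permutes : p ≡ 2 → gcd r (q ∸ 1) ≡ 1 → Represented Alternatives →
    Permutes (X^ r *ₚ (quadrinomial Q a b c d ∘ₚ X^ (q ∸ 1)))
  represented⇒permutes p≡2 gcd≡1 (γ , δ , A₀ , γ∈μ , δ≉0 , A≈ , alternatives) =
    Injective⇒Permutes.permutes gcd≡1 (injective alternatives)
    where
    open LinearMaps p k ℓ pr F using (_∼_)
    open Form p k ℓ pr F a b c d using (f)
    conditions = ord₂-conditions k ℓ p≡2 pr F
    injective : Alternatives A₀ → ∀ x y → f x ∼ f y → x ∼ y
    injective (inj₁ x)        = Alternative₁⇒injective {A₀ = A₀} γ∈μ δ≉0 A≈ (Equivalence.from (proj₁ conditions) (proj₁ x)) x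
    injective (inj₂ (inj₁ x)) = Alternative₂⇒injective {A₀ = A₀} γ∈μ δ≉0 A≈ (Equivalence.from (proj₁ (proj₂ conditions)) (proj₁ x)) x
    injective (inj₂ (inj₂ x)) = Alternative₃⇒injective {A₀ = A₀} γ∈μ δ≉0 A≈ (Equivalence.from (proj₂ (proj₂ conditions)) (proj₁ x)) x

theorem1p2 :
    ∀ {u v} (p k ℓ r : ℕ) → Prime p →
    .{{_ : NonZero k}} → .{{_ : NonZero ℓ}} → .{{_ : NonZero r}} →
    let q = p ℕ.^ k
        Q = p ℕ.^ ℓ
    in
    r % (1 ℕ.+ q) ≡ (Q ℕ.+ 1) % (1 ℕ.+ q) →
    (F : FiniteField u v (q ℕ.^ 2)) →
    let open FiniteField F
        open Subsets F
        open Polynomials commutativeRing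
    in
    (a b c d : Carrier) →
    let A = quadrinomial Q a b c d in
    Permutes (X^ r *ₚ (A ∘ₚ X^ (q ℕ.∸ 1)))
    ⇔
    ( p ≡ 2 ×
      gcd r (q ℕ.∸ 1) ≡ 1 ×
      (∃[ γ ] ∃[ δ ] ∃[ A₀ ]
        γ ∈ μ (q ℕ.+ 1) ×
        ¬ (δ ≈ 0#) ×
        A ≈ₚ δ · (A₀ ∘ₚ (γ · X^ 1)) ×
        ( ( ord₂ k ℕ.≤ ord₂ ℓ ×
            (∃[ α ] ∃[ β ] α ∉ 𝔽 q × β ∉ 𝔽 q ×
              A₀ ≈ₚ quadrinomial Q
                (α ^ (Q ℕ.+ 1) + β)
                (α ^ (q ℕ.+ Q) + β)
                (α ^ (q ℕ.* Q ℕ.+ 1) + β)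
                (α ^ (q ℕ.* Q ℕ.+ q) + β)))
        ⊎ ( ord₂ k ≢ ord₂ ℓ ×
            ( A₀ ≈ₚ X^ (Q ℕ.+ 1)
            ⊎ (∃[ α ] ∃[ β ] α ∉ μ (q ℕ.+ 1) × β ∉ μ (q ℕ.+ 1) ×
                A₀ ≈ₚ quadrinomial Q
                  (α ^ (q ℕ.* Q ℕ.+ q) + β)
                  (α ^ (q ℕ.* Q) + α * β)
                  (α ^ q + α ^ Q * β)
                  (1# + α ^ (Q ℕ.+ 1) * β))))
        ⊎ ( ord₂ k ℕ.≥ ord₂ ℓ ×
            ( A₀ ≈ₚ X^ Q
            ⊎ (∃[ α ] ∃[ β ] α ∉ μ (q ℕ.+ 1) × β ∉ μ (q ℕ.+ 1) ×
                A₀ ≈ₚ quadrinomial Q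
                  (α ^ (q ℕ.* Q) + α ^ q * β)
                  (α ^ (q ℕ.* Q ℕ.+ 1) + β)
                  (1# + α ^ (q ℕ.+ Q) * β)
                  (α + α ^ Q * β)))))))
theorem1p2 p k ℓ r pr r≡ F a b c d = mk⇔ permutes⇒represented
  (λ (p≡2 , gcd≡1 , representation) → represented⇒permutes p≡2 gcd≡1 representation)
  where open Main p k ℓ r pr r≡ F a b c d
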